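{- (Affine Decomposition Lemma) For every $v\in\widetilde S_n$, $$\lvert\widetilde{\mathtt s}^{ -1}(v)\rvert=\sum_{\mathscr M\in\mathrm{Sky}(v)}\ \prod_{i=1}^{r(\mathscr M)}\left\lvert\mathtt s^{ -1}\!\left(z_i^{\mathscr M}\right)\right\rvert .$$
   Context: West's stack-sorting map $\mathtt s$ acts on permutations of finite sets of integers (written as words with distinct letters): $\mathtt s(\varepsilon)=\varepsilon$ for the empty word, and if $m$ is the largest entry of $w=\mathsf L\,m\,\mathsf R$, then $\mathtt s(w)=\mathtt s(\mathsf L)\,\mathtt s(\mathsf R)\,m$. An affine permutation of size $n$ is a bijection $w:\mathbb Z\to\mathbb Z$ with $w(i+n)=w(i)+n$ for all $i\in\mathbb Z$ and $\sum_{i=1}^n w(i)=\binom{n+1}{2}$. They form the affine symmetric group $\widetilde S_n$ under composition (trivial if $n=1$), a Coxeter group with simple generators $\widetilde s_1,\ldots,\widetilde s_n$, where $\widetilde s_i$ swaps $i+mn$ and $i+mn+1$ for all $m\in\mathbb Z$ and fixes all other integers. The left weak order is $x\leq_L y\iff\ell(yx^{ -1})=\ell(y)-\ell(x)$, $\ell$ being Coxeter length. Affine sylvester congruence. For $w\in\widetilde S_n$ define a partial order $\preceq_w$ on $\mathbb Z$ (positions): for $i<j$, the positions $i,j$ are incomparable if and only if there is $k$ with $i<k<j$ and $w(k)>\max\{w(i),w(j)\}$; otherwise the position with the smaller value of $w$ is below the other. (This is the descendant order of the decreasing affine binary plane tree with in-order reading $w$.) The affine sylvester congruence is $v\equiv_{\widetilde{\mathrm{syl}}}w\iff{\preceq_v}={\preceq_w}$;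 it is a semilattice congruence on $(\widetilde S_n,\leq_L)$ in which $\{e\}$ is a class, and each class has a unique $\leq_L$-minimal element. Let $\pi_\downarrow(w)$ be the minimal element of the class of $w$. The affine stack-sorting map is $\widetilde{\mathtt s}:\widetilde S_n\to\widetilde S_n$, $\widetilde{\mathtt s}(w)=w\,(\pi_\downarrow(w))^{ -1}$. Let $v\in\widetilde S_n$. A left-to-right maximum of $v$ is an integer $m$ larger than every integer appearing to its left in the word $\cdots v(0)v(1)v(2)\cdots$. A set $Y\subseteq\mathbb Z$ is $n$-periodic if $j\in Y\iff j+n\in Y$. $\mathrm{Sky}(v)$ is the collection of all nonempty $n$-periodic subsets of the set of left-to-right maxima of $v$. For $\mathscr M\in\mathrm{Sky}(v)$ write $\mathscr M=\{\cdots<m_0<m_1<m_2<\cdots\}$ with indices chosen so that $v^{ -1}(m_1)\le 1<v^{ -1}(m_2)$; $r(\mathscr M)$ is the positive integer with $m_{j+r(\mathscr M)}=m_j+n$ for all $j$; and $z_i^{\mathscr M}$ is the (finite, possibly empty) permutation whose word consists of the entries of $v$ strictly between $m_i$ and $m_{i+1}$. -}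

module Defs where

open import Algebra.Properties.CommutativeMonoid.Sum using (sum)
open import Data.Bool.Base using (Bool; T)
open import Data.Fin.Base using (Fin; toℕ)
open import Data.Integer.Base as ℤ using (ℤ; +_; 1ℤ; ∣_∣)
open import Data.Integer.Divisibility.Signed using (_∣?_)
import Data.Integer.Properties as ℤ
open import Data.List.Base using (List; []; _∷_; _++_; [_]; length; map; upTo)
open import Data.List.Properties using (length-++)
open import Data.List.Relation.Unary.All using (All; []; _∷_)
open import Data.List.Relation.Unary.Unique.Propositional using (Unique)
open import Data.Nat.Base as ℕ using (ℕ; zero; suc; NonZero; z≤n; s≤s)
open import Data.Nat.Combinatorics using (_C_)
import Data.Nat.Properties as ℕ
open import Data.Product.Base using (∃; _×_; _,_)
open import Function.Base using (_∘_; id)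
open import Function.Bundles using (_↔_; Inverse; Bijection; _⇔_)
open import Level using (0ℓ)
open import Relation.Binary.Bundles using (Setoid)
import Relation.Binary.Construct.On as On
open import Relation.Binary.PropositionalEquality
  using (_≡_; _≗_; refl; cong; cong₂; _→-setoid_; setoid)
open import Relation.Nullary using (¬_; yes; no; contradiction)

------------------------------------------------------------------------
-- Cardinality and finite sums

record Finite (S : Setoid 0ℓ 0ℓ) : Set where
  field
    card        : ℕ
    enumeration : Bijection (setoid (Fin card)) S

  open Bijection enumeration public using () renaming (to to element)

open Finite public using (card)

∑Fin : ∀ k → (Fin k → ℕ) → ℕ
∑Fin k = sum ℕ.+-0-commutativeMonoid {k}

∏Fin : ∀ k → (Fin k → ℕ) → ℕ
∏Fin k = sum ℕ.*-1-commutativeMonoid {k}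

∑ : ∀ {S} → Finite S → (Setoid.Carrier S → ℕ) → ℕ
∑ F f = ∑Fin (card F) (f ∘ Finite.element F)

------------------------------------------------------------------------
-- West's stack-sorting map

-- The decomposition (L , m , R) of the word x ∷ xs = L ++ m ∷ R at its
-- largest entry m.
splitMax : ℤ → List ℤ → List ℤ × ℤ × List ℤ
splitMax x []       = [] , x , []
splitMax x (y ∷ ys) with splitMax y ys
... | L , m , R with x ℤ.<? m
...   | yes _ = x ∷ L , m , R
...   | no  _ = [] , x , y ∷ ys

-- The first argument bounds the recursion depth; any bound at least the
-- length of the word gives the same result (see stackSort-split).
sortWithin : ℕ → List ℤ → List ℤ
sortWithin _       []       = []
sortWithin zero    (_ ∷ _)  = []
sortWithin (suc d) (x ∷ xs) with splitMax x xs
... | L , m , R = sortWithin d L ++ sortWithin d R ++ [ m ]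

stackSort : List ℤ → List ℤ
stackSort w = sortWithin (length w) w

private
  splitMax-here : ∀ {m} R → All (ℤ._< m) R → splitMax m R ≡ ([] , m , R)
  splitMax-here []      _ = refl
  splitMax-here {m} (y ∷ ys) (y<m ∷ ys<m)
    with splitMax y ys | max<m y ys y<m ys<m
    where
    max<m : ∀ {m} y ys → y ℤ.< m → All (ℤ._< m) ys →
            let (_ , k , _) = splitMax y ys in k ℤ.< m
    max<m y []       y<m _ = y<m
    max<m y (z ∷ zs) y<m (z<m ∷ zs<m)
      with splitMax z zs | max<m z zs z<m zs<m
    ... | _ , k , _ | k<m with y ℤ.<? k
    ...   | yes _ = k<m
    ...   | no  _ = y<m
  ... | _ , k , _ | k<m with m ℤ.<? k
  ...   | yes m<k = contradiction m<k (ℤ.<-asym k<m)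
  ...   | no  _   = refl

  splitMax-there : ∀ {m} x L R → x ℤ.< m → All (ℤ._< m) L → All (ℤ._< m) R →
                   splitMax x (L ++ m ∷ R) ≡ (x ∷ L , m , R)
  splitMax-there {m} x [] R x<m _ R<m rewrite splitMax-here R R<m
    with x ℤ.<? m
  ... | yes _   = refl
  ... | no  x≮m = contradiction x<m x≮m
  splitMax-there {m} x (y ∷ L) R x<m (y<m ∷ L<m) R<m
    rewrite splitMax-there y L R y<m L<m R<m
    with x ℤ.<? m
  ... | yes _   = refl
  ... | no  x≮m = contradiction x<m x≮m

  splitMax-length : ∀ x xs → let (L , _ , R) = splitMax x xs in
                    length L ℕ.+ length R ≡ length xs
  splitMax-length x []       = refl
  splitMax-length x (y ∷ ys) with splitMax y ys | splitMax-length y ys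
  ... | L , m , R | eq with x ℤ.<? m
  ...   | yes _ = cong suc eq
  ...   | no  _ = refl

  sortWithin-bound : ∀ {d e} w → length w ℕ.≤ d → length w ℕ.≤ e →
                     sortWithin d w ≡ sortWithin e w
  sortWithin-bound []       _          _          = refl
  sortWithin-bound (x ∷ xs) (s≤s xs≤d) (s≤s xs≤e)
    with splitMax x xs | splitMax-length x xs
  ... | L , m , R | eq = cong₂ (λ u v → u ++ v ++ [ m ])
    (sortWithin-bound L (left xs≤d) (left xs≤e))
    (sortWithin-bound R (right xs≤d) (right xs≤e))
    where
    left : ∀ {b} → length xs ℕ.≤ b → length L ℕ.≤ b
    left xs≤b = ℕ.m+n≤o⇒m≤o (length L) (ℕ.≤-trans (ℕ.≤-reflexive eq) xs≤b)

    right : ∀ {b} → length xs ℕ.≤ b → length R ℕ.≤ b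
    right xs≤b = ℕ.m+n≤o⇒n≤o (length L) (ℕ.≤-trans (ℕ.≤-reflexive eq) xs≤b)

stackSort-split : ∀ {m} L R → All (ℤ._< m) L → All (ℤ._< m) R →
                  stackSort (L ++ m ∷ R) ≡ stackSort L ++ stackSort R ++ [ m ]
stackSort-split {m} [] R _ R<m rewrite splitMax-here R R<m = refl
stackSort-split {m} (x ∷ L) R (x<m ∷ L<m) R<m
  rewrite splitMax-there x L R x<m L<m R<m
        | length-++ L {m ∷ R}
        | ℕ.+-suc (length L) (length R)
  = cong₂ (λ u v → u ++ v ++ [ m ])
      (sortWithin-bound (x ∷ L) (s≤s (ℕ.m≤m+n _ _)) ℕ.≤-refl)
      (sortWithin-bound R (ℕ.m≤n⇒m≤1+n (ℕ.m≤n+m _ (length L))) ℕ.≤-refl)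

record StackSortPreimage (z : List ℤ) : Set where
  field
    word     : List ℤ
    distinct : Unique word
    sorts    : stackSort word ≡ z

stackSort⁻¹ : List ℤ → Setoid 0ℓ 0ℓ
stackSort⁻¹ z = On.setoid (setoid (List ℤ)) (StackSortPreimage.word {z})

------------------------------------------------------------------------
-- Affine permutations

record AffinePerm (n : ℕ) : Set where
  field
    bijection : ℤ ↔ ℤ

  open Inverse bijection public using (to; from)

  field
    shift  : ∀ i → to (i ℤ.+ + n) ≡ to i ℤ.+ + n
    window : sum ℤ.+-0-commutativeMonoid {n} (λ i → to (+ suc (toℕ i)))
             ≡ + (suc n C 2)

open AffinePerm public using (to; from)

infix 4 _≈_
_≈_ : ∀ {n} → AffinePerm n → AffinePerm n → Set
v ≈ w = to v ≗ to w

-- The group is trivial for n = 1, so there are then no generators.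
record Generator (n : ℕ) : Set where
  field
    1<n   : 1 ℕ.< n
    index : Fin n

-- The generator with index i : Fin n is s̃ᵢ₊₁.
generate : ∀ {n} → Generator n → ℤ → ℤ
generate {n} g x with + n ∣? x ℤ.- + suc (toℕ (Generator.index g))
... | yes _ = ℤ.suc x
... | no  _ with + n ∣? x ℤ.- ℤ.suc (+ suc (toℕ (Generator.index g)))
...   | yes _ = ℤ.pred x
...   | no  _ = x

evaluate : ∀ {n} → List (Generator n) → ℤ → ℤ
evaluate []       = id
evaluate (g ∷ gs) = generate g ∘ evaluate gs

-- Coxeter length, as the graph of a function. It is stated for maps
-- ℤ → ℤ so that it applies directly to composites.
record HasLength (n : ℕ) (f : ℤ → ℤ) (k : ℕ) : Set where
  field
    expression : List (Generator n)
    evaluates  : evaluate expression ≗ f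
    size       : length expression ≡ k
    shortest   : ∀ (gs : List (Generator n)) → evaluate gs ≗ f → k ℕ.≤ length gs

-- Left weak order. The subtraction ℓ(y) - ℓ(x) is taken in ℤ.
infix 4 _≤L_
record _≤L_ {n} (x y : AffinePerm n) : Set where
  field
    {ℓx ℓy ℓyx⁻¹} : ℕ
    length-x    : HasLength n (to x) ℓx
    length-y    : HasLength n (to y) ℓy
    length-yx⁻¹ : HasLength n (to y ∘ from x) ℓyx⁻¹
    difference  : + ℓyx⁻¹ ≡ + ℓy ℤ.- + ℓx

------------------------------------------------------------------------
-- Affine sylvester congruence and affine stack-sorting

-- Using the minimum and maximum of the positions makes this symmetric,
-- and false for equal positions.
Incomparable : ∀ {n} → AffinePerm n → ℤ → ℤ → Set
Incomparable w i j = ∃ λ k →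
  i ℤ.⊓ j ℤ.< k × k ℤ.< i ℤ.⊔ j × to w i ℤ.⊔ to w j ℤ.< to w k

infix 4 _≼[_]_
_≼[_]_ : ∀ {n} → ℤ → AffinePerm n → ℤ → Set
i ≼[ w ] j = ¬ Incomparable w i j × to w i ℤ.≤ to w j

infix 4 _≡syl_
_≡syl_ : ∀ {n} → AffinePerm n → AffinePerm n → Set
v ≡syl w = ∀ i j → (i ≼[ v ] j) ⇔ (i ≼[ w ] j)

-- u is the element π↓(w): the (unique) ≤L-minimal element of the class of w.
record _isπ↓_ {n} (u w : AffinePerm n) : Set where
  field
    congruent : u ≡syl w
    minimal   : ∀ u′ → u′ ≡syl w → u′ ≤L u → u′ ≈ u

-- s̃(w) = v, that is, v = w ∘ π↓(w)⁻¹.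
AffineStackSortsTo : ∀ {n} → AffinePerm n → AffinePerm n → Set
AffineStackSortsTo w v = ∃ λ u → u isπ↓ w × to v ≗ to w ∘ from u

record AffineStackSortPreimage {n} (v : AffinePerm n) : Set where
  field
    perm  : AffinePerm n
    sorts : AffineStackSortsTo perm v

affineStackSort⁻¹ : ∀ {n} → AffinePerm n → Setoid 0ℓ 0ℓ
affineStackSort⁻¹ v =
  On.setoid (ℤ →-setoid ℤ) (to ∘ AffineStackSortPreimage.perm {v = v})

------------------------------------------------------------------------
-- Skylines

IsLeftToRightMax : ∀ {n} → AffinePerm n → ℤ → Set
IsLeftToRightMax v m = ∀ p → p ℤ.< from v m → to v p ℤ.< m

-- Subsets of ℤ are given by characteristic functions: with subsets as
-- arbitrary predicates the collection could not be enumerated constructively.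
record SkySet {n} (v : AffinePerm n) : Set where
  field
    member   : ℤ → Bool
    periodic : ∀ j → member (j ℤ.+ + n) ≡ member j
    nonempty : ∃ λ j → T (member j)
    maxima   : ∀ j → T (member j) → IsLeftToRightMax v j

Sky : ∀ {n} → AffinePerm n → Setoid 0ℓ 0ℓ
Sky v = On.setoid (ℤ →-setoid Bool) (SkySet.member {v = v})

-- The numbering ⋯ < m₀ < m₁ < m₂ < ⋯ of M and the period r(M); both are
-- determined by M.
record Indexing {n} {v : AffinePerm n} (M : SkySet v) : Set where
  open SkySet M
  field
    m          : ℤ → ℤ
    increasing : ∀ {i j} → i ℤ.< j → m i ℤ.< m j
    sound      : ∀ i → T (member (m i))
    complete   : ∀ j → T (member j) → ∃ λ i → m i ≡ j
    start₁     : from v (m (+ 1)) ℤ.≤ 1ℤ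
    start₂     : 1ℤ ℤ.< from v (m (+ 2))
    r          : ℕ
    r-positive : NonZero r
    r-shift    : ∀ j → m (j ℤ.+ + r) ≡ m j ℤ.+ + n

-- For a < b, the integers strictly between a and b, in increasing order.
between : ℤ → ℤ → List ℤ
between a b = map (λ k → ℤ.suc a ℤ.+ + k) (upTo ∣ b ℤ.- ℤ.suc a ∣)

-- The entries of v positioned strictly between mᵢ and mᵢ₊₁; the position of
-- mᵢ precedes that of mᵢ₊₁, as both are left-to-right maxima.
z : ∀ {n} {v : AffinePerm n} {M : SkySet v} → Indexing M → ℤ → List ℤ
z {v = v} I i = map (to v) (between (from v (m i)) (from v (m (ℤ.suc i))))
  where open Indexing I

-- The index k : Fin (r M) stands for i = k + 1 in {1, …, r(M)}.
zAt : ∀ {n} {v : AffinePerm n} {M : SkySet v} (I : Indexing M) →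
      Fin (Indexing.r I) → List ℤ
zAt I k = z I (+ suc (toℕ k))

-- The map s̃ reads the entries of w in the postorder of its decreasing tree. By
-- the exchange condition for words in the simple generators, the minimal
-- element π↓(w) of the sylvester class inverts exactly the positions i < j with
-- w(i) larger than all of w(i + 1), …, w(j), since any other inversion leaves a
-- descent that can be removed within the class. So s̃(w) = v if and only if
-- u = v⁻¹w has these inversions. There are none across the position of a
-- left-to-right maximum of w, so u preserves each of the blocks into which the
-- left-to-right maxima cut ℤ, and it sends the first position of a block to the
-- last one. These maxima form a skyline of v, and in each block the entries of
-- w after the first one form a word that s sends to the entries of v between
-- two consecutive elements of the skyline. Conversely a skyline of v and such
-- words, one for each block in a period, determine w.

module Submission where

open import Defs
import Algebra.Properties.CommutativeMonoid.Sum as Sum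
import Data.Bool.Properties as Bool
open import Data.Bool.Base using (Bool; true; false; T; _∧_)
open import Data.Empty using (⊥; ⊥-elim)
open import Data.Fin.Base as Fin using (Fin; toℕ; fromℕ<)
import Data.Fin.Permutation as Permutation
import Data.Fin.Properties as Fin
open import Data.Integer.Base as ℤ using (ℤ; +_; -[1+_]; 0ℤ; 1ℤ; -1ℤ; ∣_∣; _+_; _-_; -_; _*_; _/ℕ_; _≤_; _<_; +≤+; +<+; -<+; -≤+)
  renaming (suc to 1+)
import Data.Integer.DivMod as ℤ
open import Data.Integer.Divisibility.Signed using (_∣_; _∣?_; divides)
open import Data.Integer.Properties as ℤ using
  (≤-trans; <-trans; ≤-<-trans; <-≤-trans; <⇒≤; <⇒≢; <⇒≱; ≤⇒≯; ≰⇒>; ≮⇒≥;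
  ≤∧≢⇒<; _≤?_; _<?_; <-asym; <-irrefl; <-cmp; ≤-refl; ≤-reflexive; ≤-antisym;
  i<j⇒suc[i]≤j; suc[i]≤j⇒i<j; i<j⇒i≤pred[j]; suc-pred; +-assoc;
  +-identityˡ; +-identityʳ; +-inverseʳ; +-monoˡ-<; +-monoʳ-<; +-monoˡ-≤;
  +-mono-≤; +-mono-<; i≤i+j; drop‿+<+; neg-distribˡ-*; *-monoʳ-≤-nonNeg;
  suc-*; 0≤i⇒+∣i∣≡i; i≤j⇒0≤j-i)
open import Data.Integer.Tactic.RingSolver using (solve-∀)
open import Data.List.Base using (List; []; _∷_; _++_; [_]; length; map; upTo; applyUpTo; cartesianProductWith)
open import Data.List.Membership.Propositional using (_∈_)
import Data.List.Membership.Propositional.Properties as ∈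
import Data.List.Properties as List
open import Data.List.Relation.Binary.Permutation.Propositional using (_↭_; ↭-refl; ↭-sym; ↭-trans; ↭-prep)
import Data.List.Relation.Binary.Permutation.Propositional.Properties as ↭
open import Data.List.Relation.Unary.All as All using (All; []; _∷_)
import Data.List.Relation.Unary.All.Properties as All
open import Data.List.Relation.Unary.AllPairs using ([]; _∷_)
open import Data.List.Relation.Unary.Any using (here; there)
open import Data.List.Relation.Unary.Unique.Propositional using (Unique)
import Data.List.Relation.Unary.Unique.DecPropositional as DecUnique
import Data.List.Relation.Unary.Unique.Propositional.Properties as Unique
open import Data.Nat.Base as ℕ using (ℕ; zero; suc; NonZero; z≤n; s≤s)
open import Data.Nat.Combinatorics using (_C_; nC1≡n; nCk+nC[k+1]≡[n+1]C[k+1])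
import Data.Nat.Induction as ℕ
import Data.Nat.Properties as ℕ
open import Data.Product.Base using (∃; Σ-syntax; _×_; _,_; proj₁; proj₂)
open import Data.Sum.Base using (_⊎_; inj₁; inj₂)
open import Data.Unit.Base using (tt)
open import Data.Vec.Base as Vec using (Vec; []; _∷_)
open import Data.Vec.N-ary using (N-ary; _$ⁿ_; curryⁿ; ∀ⁿ)
import Data.Vec.Properties as Vec
open import Function.Base using (_∘_; id)
open import Function.Bundles using (mk↔ₛ′; Inverse; Bijection; mk⇔; Equivalence)
open import Induction.WellFounded using (Acc; acc)
open import Relation.Binary.Definitions using (Tri; tri<; tri≈; tri>)
open import Relation.Binary.PropositionalEquality hiding ([_])
open import Level using (0ℓ)
open import Relation.Binary.Bundles using (Setoid)
open import Relation.Nullary using (¬_; Dec; yes; no; contradiction)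
open import Relation.Nullary.Decidable using (T?; _×-dec_; _→-dec_; map′; isYes; toWitness; fromWitness)

-- Coxeter length is given only through shortest words, so two facts about the weak order have to be
-- extracted from words: removing a descent leads downwards (`descent-≤L`), and going up keeps
-- inversions (`≤L-inversion`). Both rest on the strong exchange condition. Removing descents
-- terminates because a sum of squared displacements over one period decreases.
--
-- The obstacle peculiar to the infinite setting is drift: a translation has no inversions and yet
-- moves positions past every cut. The normalisation of the window excludes it; it is used as the
-- vanishing of `degree`, which is additive under composition.
--
-- A block of `v` is compared with the same block of positions of `w`. There the words are read one
-- step to the right of the entries of `z`, which is the origin of the shift `1ℤ` in the trees of
-- the blocks. That ranks do fill the expected intervals is a matter of counting within a block.

open ≡-Reasoning

-- Linear arithmetic over ℤ

data Linear (n : ℕ) : Set where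
  var       : Fin n → Linear n
  κ         : ℤ → Linear n
  :1+_      : Linear n → Linear n
  _:+_ _:-_ : Linear n → Linear n → Linear n

infix 8 :1+_
infixl 7 _:+_ _:-_

data Atomic (n : ℕ) : Set where
  _:≤_ _:<_ _:≡_ : Linear n → Linear n → Atomic n
  :⊥             : Atomic n

infix 6 _:≤_ _:<_ _:≡_

record Sequent (n : ℕ) : Set where
  constructor _⊢_
  field
    hypotheses : List (Atomic n)
    conclusion : Atomic n

infix 4 _⊢_

module _ {n : ℕ} where

  ⟦_⟧ : Linear n → Vec ℤ n → ℤ
  ⟦ var i ⟧ ρ  = Vec.lookup ρ i
  ⟦ κ c ⟧ ρ    = c
  ⟦ :1+ e ⟧ ρ  = 1+ (⟦ e ⟧ ρ)
  ⟦ e :+ f ⟧ ρ = ⟦ e ⟧ ρ + ⟦ f ⟧ ρ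
  ⟦ e :- f ⟧ ρ = ⟦ e ⟧ ρ - ⟦ f ⟧ ρ

  ⟦_⟧ᵃ : Atomic n → Vec ℤ n → Set
  ⟦ e :≤ f ⟧ᵃ ρ = ⟦ e ⟧ ρ ≤ ⟦ f ⟧ ρ
  ⟦ e :< f ⟧ᵃ ρ = ⟦ e ⟧ ρ < ⟦ f ⟧ ρ
  ⟦ e :≡ f ⟧ᵃ ρ = ⟦ e ⟧ ρ ≡ ⟦ f ⟧ ρ
  ⟦ :⊥ ⟧ᵃ ρ     = ⊥

  ⟦_⟧ˢ : Sequent n → Vec ℤ n → Set
  ⟦ []     ⊢ φ ⟧ˢ ρ = ⟦ φ ⟧ᵃ ρ
  ⟦ ψ ∷ ψs ⊢ φ ⟧ˢ ρ = ⟦ ψ ⟧ᵃ ρ → ⟦ ψs ⊢ φ ⟧ˢ ρ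

  Normal : Set
  Normal = Vec ℤ n × ℤ

  dot : Vec ℤ n → Vec ℤ n → ℤ
  dot cs ρ = Vec.foldr _ _+_ 0ℤ (Vec.zipWith _*_ cs ρ)

  ⟦_⟧ⁿ : Normal → Vec ℤ n → ℤ
  ⟦ cs , c ⟧ⁿ ρ = dot cs ρ + c

  unit : ∀ {m} → Fin m → Vec ℤ m
  unit Fin.zero    = 1ℤ ∷ Vec.replicate _ 0ℤ
  unit (Fin.suc i) = 0ℤ ∷ unit i

  normal : Linear n → Normal
  normal (var i)  = unit i , 0ℤ
  normal (κ c)    = Vec.replicate _ 0ℤ , c
  normal (:1+ e)  = let (cs , c) = normal e in cs , 1+ c
  normal (e :+ f) = let (cs , c) = normal e; (ds , d) = normal f in
                    Vec.zipWith _+_ cs ds , c + d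
  normal (e :- f) = let (cs , c) = normal e; (ds , d) = normal f in
                    Vec.zipWith _-_ cs ds , c - d

  -- Strictness becomes a gap of one unit, so that over ℤ nothing is lost when inequalities are
  -- added. Of an equation only one of the two inequalities is kept, and `:⊥` becomes the false
  -- claim `0ℤ ≤ -1ℤ`.
  excess : Atomic n → Linear n
  excess (e :≤ f) = f :- e
  excess (e :< f) = f :- :1+ e
  excess (e :≡ f) = f :- e
  excess :⊥       = κ -1ℤ

private
  interchange-+ : ∀ a b c d → (a + b) + (c + d) ≡ (a + c) + (b + d)
  interchange-+ = solve-∀

  interchange-- : ∀ a b c d → (a + b) - (c + d) ≡ (a - c) + (b - d)
  interchange-- = solve-∀

  dot-+ : ∀ {n} (cs ds ρ : Vec ℤ n) →
          dot (Vec.zipWith _+_ cs ds) ρ ≡ dot cs ρ + dot ds ρ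
  dot-+ []       []       []      = refl
  dot-+ (c ∷ cs) (d ∷ ds) (x ∷ ρ) = begin
    (c + d) * x + dot (Vec.zipWith _+_ cs ds) ρ
      ≡⟨ cong₂ _+_ (ℤ.*-distribʳ-+ x c d) (dot-+ cs ds ρ) ⟩
    (c * x + d * x) + (dot cs ρ + dot ds ρ)
      ≡⟨ interchange-+ (c * x) _ _ _ ⟩
    (c * x + dot cs ρ) + (d * x + dot ds ρ) ∎

  dot-- : ∀ {n} (cs ds ρ : Vec ℤ n) →
          dot (Vec.zipWith _-_ cs ds) ρ ≡ dot cs ρ - dot ds ρ
  dot-- []       []       []      = refl
  dot-- (c ∷ cs) (d ∷ ds) (x ∷ ρ) = begin
    (c - d) * x + dot (Vec.zipWith _-_ cs ds) ρ
      ≡⟨ cong₂ _+_ (distrib c d x) (dot-- cs ds ρ) ⟩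
    (c * x - d * x) + (dot cs ρ - dot ds ρ)
      ≡⟨ interchange-- (c * x) _ _ _ ⟨
    (c * x + dot cs ρ) - (d * x + dot ds ρ) ∎
    where
    distrib : ∀ a b x → (a - b) * x ≡ a * x - b * x
    distrib = solve-∀

  dot-0 : ∀ {n} (ρ : Vec ℤ n) → dot (Vec.replicate n 0ℤ) ρ ≡ 0ℤ
  dot-0 []      = refl
  dot-0 (x ∷ ρ) = trans (+-identityˡ _) (dot-0 ρ)

  dot-unit : ∀ {n} (i : Fin n) (ρ : Vec ℤ n) → dot (unit {n} i) ρ ≡ Vec.lookup ρ i
  dot-unit Fin.zero    (x ∷ ρ) =
    trans (cong₂ _+_ (ℤ.*-identityˡ x) (dot-0 ρ)) (+-identityʳ x)
  dot-unit (Fin.suc i) (x ∷ ρ) = trans (+-identityˡ _) (dot-unit i ρ)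

module _ {n : ℕ} (ρ : Vec ℤ n) where

  normal-correct : (e : Linear n) → ⟦ normal e ⟧ⁿ ρ ≡ ⟦ e ⟧ ρ
  normal-correct (var i)  = trans (+-identityʳ _) (dot-unit i ρ)
  normal-correct (κ c)    = trans (cong (_+ c) (dot-0 ρ)) (+-identityˡ c)
  normal-correct (:1+ e)  = let (cs , c) = normal e in
    trans (swap (dot cs ρ) c) (cong 1+ (normal-correct e))
    where
    swap : ∀ a c → a + (1ℤ + c) ≡ 1ℤ + (a + c)
    swap = solve-∀
  normal-correct (e :+ f) = let (cs , c) = normal e; (ds , d) = normal f in
    trans (cong (_+ (c + d)) (dot-+ cs ds ρ))
    (trans (interchange-+ (dot cs ρ) _ _ _)
    (cong₂ _+_ (normal-correct e) (normal-correct f)))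
  normal-correct (e :- f) = let (cs , c) = normal e; (ds , d) = normal f in
    trans (cong (_+ (c - d)) (dot-- cs ds ρ))
    (trans (sym (interchange-- (dot cs ρ) _ _ _))
    (cong₂ _-_ (normal-correct e) (normal-correct f)))

  excess-sound : ∀ φ → ⟦ φ ⟧ᵃ ρ → 0ℤ ≤ ⟦ excess φ ⟧ ρ
  excess-sound (e :≤ f) e≤f = i≤j⇒0≤j-i e≤f
  excess-sound (e :< f) e<f = i≤j⇒0≤j-i (i<j⇒suc[i]≤j e<f)
  excess-sound (e :≡ f) e≡f = i≤j⇒0≤j-i (≤-reflexive e≡f)

vanishes : ∀ {n} → Vec ℤ n → Bool
vanishes []              = true
vanishes (+ zero  ∷ cs)  = vanishes cs
vanishes (_       ∷ cs)  = false

vanishes-sound : ∀ {n} (cs ρ : Vec ℤ n) → T (vanishes cs) → dot cs ρ ≡ 0ℤ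
vanishes-sound []             []      _ = refl
vanishes-sound (+ zero  ∷ cs) (x ∷ ρ) p = trans (+-identityˡ _) (vanishes-sound cs ρ p)

-- No multipliers are searched for: an inequality must be the sum of the
-- hypotheses and a true inequality between constants, an equation the sum of
-- the hypotheses, all of them equations with this orientation.
module _ {n : ℕ} where

  total : Linear n → List (Atomic n) → Linear n
  total e []       = e
  total e (ψ ∷ ψs) = total (e :+ excess ψ) ψs

  equations : List (Atomic n) → Bool
  equations []              = true
  equations ((_ :≡ _) ∷ ψs) = equations ψs
  equations (_        ∷ ψs) = false

  constant≥0 constant≡0 : Linear n → Bool
  constant≥0 e = let (cs , c) = normal e in vanishes cs ∧ (0ℤ ℤ.≤ᵇ c)
  constant≡0 e = let (cs , c) = normal e in vanishes (c ∷ cs)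

  valid : Sequent n → Bool
  valid (ψs ⊢ φ@(_ :≡ _)) = equations ψs ∧ constant≡0 (excess φ :- total (κ 0ℤ) ψs)
  valid (ψs ⊢ φ)          = constant≥0 (excess φ :- total (κ 0ℤ) ψs)

private
  T-∧⁻ : ∀ a {b} → T (a ∧ b) → T a × T b
  T-∧⁻ true p = tt , p

module _ {n : ℕ} (ρ : Vec ℤ n) where

  constant≥0-sound : ∀ e → T (constant≥0 e) → 0ℤ ≤ ⟦ e ⟧ ρ
  constant≥0-sound e p with normal e | normal-correct ρ e
  ... | cs , c | eq with T-∧⁻ (vanishes cs) p
  ... | zeros , 0≤c = subst (0ℤ ≤_)
    (trans (sym (trans (cong (_+ c) (vanishes-sound cs ρ zeros)) (+-identityˡ c))) eq)
    (ℤ.≤ᵇ⇒≤ 0≤c)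

  constant≡0-sound : ∀ e → T (constant≡0 e) → ⟦ e ⟧ ρ ≡ 0ℤ
  constant≡0-sound e p with normal e | normal-correct ρ e
  ... | cs , + zero | eq = trans (sym eq) (trans (+-identityʳ _) (vanishes-sound cs ρ p))

  inequality-sound : ∀ φ {d} ψs → (0ℤ ≤ ⟦ excess φ ⟧ ρ → ⟦ φ ⟧ᵃ ρ) →
                     T (constant≥0 (excess φ :- total d ψs)) → 0ℤ ≤ ⟦ d ⟧ ρ →
                     ⟦ ψs ⊢ φ ⟧ˢ ρ
  inequality-sound φ {d} [] complete check 0≤d =
    complete (≤-trans 0≤d (ℤ.0≤i-j⇒j≤i (constant≥0-sound (excess φ :- d) check)))
  inequality-sound φ (ψ ∷ ψs) complete check 0≤d holds =
    inequality-sound φ ψs complete check (+-mono-≤ 0≤d (excess-sound ρ ψ holds))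

  equation-sound : ∀ e f {d} ψs → T (equations ψs) →
                   T (constant≡0 ((f :- e) :- total d ψs)) → ⟦ d ⟧ ρ ≡ 0ℤ →
                   ⟦ ψs ⊢ e :≡ f ⟧ˢ ρ
  equation-sound e f {d} [] _ check d≡0 = sym (ℤ.i-j≡0⇒i≡j _ _
    (trans (ℤ.i-j≡0⇒i≡j (⟦ f :- e ⟧ ρ) _ (constant≡0-sound (f :- e :- d) check)) d≡0))
  equation-sound e f ((g :≡ h) ∷ ψs) eqs check d≡0 g≡h =
    equation-sound e f ψs eqs check
      (cong₂ _+_ d≡0 (ℤ.i≡j⇒i-j≡0 (sym g≡h)))

  valid-sound : ∀ s → T (valid s) → ⟦ s ⟧ˢ ρ
  valid-sound (ψs ⊢ e :≤ f) p = inequality-sound (e :≤ f) ψs ℤ.0≤i-j⇒j≤i p ≤-refl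
  valid-sound (ψs ⊢ e :< f) p =
    inequality-sound (e :< f) ψs (suc[i]≤j⇒i<j ∘ ℤ.0≤i-j⇒j≤i) p ≤-refl
  valid-sound (ψs ⊢ e :≡ f) p = let (eqs , check) = T-∧⁻ (equations ψs) p in
    equation-sound e f ψs eqs check refl
  valid-sound (ψs ⊢ :⊥)     p = inequality-sound :⊥ ψs (λ ()) p ≤-refl

-- For a concrete sequent `valid s` evaluates to `true`, so the implicit argument is of unit type
-- and is filled in by itself.
linear : ∀ n (f : N-ary n (Linear n) (Sequent n)) →
         let s = f $ⁿ Vec.map var (Vec.allFin n) in
         {_ : T (valid s)} → ∀ⁿ n (curryⁿ ⟦ s ⟧ˢ)
linear n f {p} = close n (λ ρ → valid-sound ρ (f $ⁿ Vec.map var (Vec.allFin n)) p)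
  where
  close : ∀ m {P : Vec ℤ m → Set} → (∀ ρ → P ρ) → ∀ⁿ m (curryⁿ P)
  close zero    h = h []
  close (suc m) h = λ x → close m (h ∘ (x ∷_))

-- Integer intervals and residues

offset : ∀ {i j} → i ≤ j → ∃ λ k → j ≡ i + + k
offset {i} {j} i≤j = ∣ j - i ∣ , (begin
  j  ≡⟨ cancel i j ⟩
  i + (j - i)  ≡⟨ cong (λ x → i + x) (0≤i⇒+∣i∣≡i (i≤j⇒0≤j-i i≤j)) ⟨
  i + + ∣ j - i ∣  ∎)
  where
  cancel : ∀ i j → j ≡ i + (j - i)
  cancel = solve-∀

upward : (P : ℤ → Set) → ∀ a → P a → (∀ i → a ≤ i → P i → P (1+ i)) →
         ∀ {i} → a ≤ i → P i
upward P a base step {i} a≤i with k , refl ← offset a≤i = go k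
  where
  go : ∀ k → P (a + + k)
  go zero    = subst P (sym (+-identityʳ a)) base
  go (suc k) = subst P (linear 2 (λ a k → [] ⊢ :1+ (a :+ k) :≡ a :+ :1+ k) a (+ k))
    (step _ (i≤i+j a (+ k)) (go k))

ℤ-induction : (P : ℤ → Set) → P 0ℤ → (∀ i → P i → P (1+ i)) →
              (∀ i → P (1+ i) → P i) → ∀ i → P i
ℤ-induction P base up down (+ zero)     = base
ℤ-induction P base up down (+ suc n)    = up (+ n) (ℤ-induction P base up down (+ n))
ℤ-induction P base up down -[1+ zero ]  = down -1ℤ base
ℤ-induction P base up down -[1+ suc n ] =
  down -[1+ suc n ] (ℤ-induction P base up down -[1+ n ])

≤⇒<⊎≡ : ∀ {i j} → i ≤ j → i < j ⊎ i ≡ j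
≤⇒<⊎≡ {i} {j} i≤j with i ℤ.≟ j
... | yes i≡j = inj₂ i≡j
... | no  i≢j = inj₁ (≤∧≢⇒< i≤j i≢j)

<suc⇒≤ : ∀ {i j} → i < 1+ j → i ≤ j
<suc⇒≤ {i} {j} = linear 2 (λ i j → i :< :1+ j ∷ [] ⊢ i :≤ j) i j

≤⇒<suc : ∀ {i j} → i ≤ j → i < 1+ j
≤⇒<suc {i} {j} = linear 2 (λ i j → i :≤ j ∷ [] ⊢ i :< :1+ j) i j

<suc⇒<⊎≡ : ∀ {i j} → i < 1+ j → i < j ⊎ i ≡ j
<suc⇒<⊎≡ = ≤⇒<⊎≡ ∘ <suc⇒≤

i<suc[i] : ∀ i → i < 1+ i
i<suc[i] i = ≤⇒<suc ≤-refl

suc-1 : ∀ x → 1+ x - 1ℤ ≡ x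
suc-1 = linear 1 (λ x → [] ⊢ :1+ x :- κ 1ℤ :≡ x)

suc-< : ∀ {i j} → i < j → 1+ i < 1+ j
suc-< = +-monoʳ-< 1ℤ

length-bound : ∀ {a b} → a < b → ∃ λ d → b ≤ 1+ a + + d
length-bound a<b = let (d , eq) = offset (i<j⇒suc[i]≤j a<b) in d , ≤-reflexive eq

module _ (Q : ℤ → Set) (a b : ℤ) where

  LeastIn GreatestIn NoneIn : Set
  LeastIn    = ∃ λ k → a ≤ k × k < b × Q k × (∀ l → a ≤ l → l < k → ¬ Q l)
  GreatestIn = ∃ λ k → a ≤ k × k < b × Q k × (∀ l → k < l → l < b → ¬ Q l)
  NoneIn     = ∀ k → a ≤ k → k < b → ¬ Q k

module _ {Q : ℤ → Set} (Q? : ∀ i → Dec (Q i)) where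

  least : ∀ a b → LeastIn Q a b ⊎ NoneIn Q a b
  least a b with a ≤? b
  ... | no  a≰b = inj₂ λ k a≤k k<b → contradiction (≤-trans a≤k (<⇒≤ k<b)) a≰b
  ... | yes a≤b = upward
    (λ b → LeastIn Q a b ⊎ NoneIn Q a b)
    a (inj₂ λ k a≤k k<a → contradiction k<a (≤⇒≯ a≤k)) step a≤b
    where
    step : ∀ i → a ≤ i → LeastIn Q a i ⊎ NoneIn Q a i → LeastIn Q a (1+ i) ⊎ NoneIn Q a (1+ i)
    step i a≤i (inj₁ (k , a≤k , k<i , rest)) =
      inj₁ (k , a≤k , <-trans k<i (i<suc[i] i) , rest)
    step i a≤i (inj₂ none) with Q? i
    ... | yes q  = inj₁ (i , a≤i , i<suc[i] i , q , none)
    ... | no  ¬q = inj₂ λ k a≤k k<1+i → case-on k a≤k (<suc⇒<⊎≡ k<1+i)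
      where
      case-on : ∀ k → a ≤ k → k < i ⊎ k ≡ i → ¬ Q k
      case-on k a≤k (inj₁ k<i)  = none k a≤k k<i
      case-on k a≤k (inj₂ refl) = ¬q

  greatest : ∀ a b → GreatestIn Q a b ⊎ NoneIn Q a b
  greatest a b with a ≤? b
  ... | no  a≰b = inj₂ λ k a≤k k<b → contradiction (≤-trans a≤k (<⇒≤ k<b)) a≰b
  ... | yes a≤b = upward
    (λ b → GreatestIn Q a b ⊎ NoneIn Q a b)
    a (inj₂ λ k a≤k k<a → contradiction k<a (≤⇒≯ a≤k)) step a≤b
    where
    step : ∀ i → a ≤ i → GreatestIn Q a i ⊎ NoneIn Q a i → GreatestIn Q a (1+ i) ⊎ NoneIn Q a (1+ i)
    step i a≤i found with Q? i
    ... | yes q = inj₁ (i , a≤i , i<suc[i] i , q ,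
                        λ l i<l l<1+i → contradiction i<l (≤⇒≯ (<suc⇒≤ l<1+i)))
    ... | no ¬q = extend found
      where
      case-on : ∀ {C : ℤ → Set} k → C k → (∀ l → C l → l < i → ¬ Q l) → k < i ⊎ k ≡ i → ¬ Q k
      case-on k c none (inj₁ k<i)  = none k c k<i
      case-on k c none (inj₂ refl) = ¬q
      extend : GreatestIn Q a i ⊎ NoneIn Q a i → GreatestIn Q a (1+ i) ⊎ NoneIn Q a (1+ i)
      extend (inj₁ (k , a≤k , k<i , q , above)) =
        inj₁ (k , a≤k , <-trans k<i (i<suc[i] i) , q ,
              λ l k<l l<1+i → case-on l k<l above (<suc⇒<⊎≡ l<1+i))
      extend (inj₂ none) =
        inj₂ λ k a≤k k<1+i → case-on k a≤k none (<suc⇒<⊎≡ k<1+i)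

  search : ∀ a b → Dec (∃ λ k → a ≤ k × k < b × Q k)
  search a b with least a b
  ... | inj₁ (k , a≤k , k<b , q , _) = yes (k , a≤k , k<b , q)
  ... | inj₂ none                    = no λ (k , a≤k , k<b , q) → none k a≤k k<b q

MaximumIn : (ℤ → ℤ) → ℤ → ℤ → Set
MaximumIn f a b = ∃ λ m → a ≤ m × m < b × (∀ k → a ≤ k → k < b → f k ≤ f m)

argmax : (f : ℤ → ℤ) → ∀ {a b} → a < b → MaximumIn f a b
argmax f {a} {b} a<b = upward (MaximumIn f a)
  (1+ a)
  (a , ≤-refl , i<suc[i] a ,
   λ k a≤k k<1+a → ≤-reflexive (cong f (≤-antisym (<suc⇒≤ k<1+a) a≤k)))
  step (i<j⇒suc[i]≤j a<b)
  where
  step : ∀ i → 1+ a ≤ i → MaximumIn f a i → MaximumIn f a (1+ i)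
  step i a<i (m , a≤m , m<i , max) with ℤ.≤-total (f m) (f i)
  ... | inj₁ fm≤fi = i , <⇒≤ (suc[i]≤j⇒i<j a<i) , i<suc[i] i , λ k a≤k k<1+i →
    case-on k a≤k (<suc⇒<⊎≡ k<1+i)
    where
    case-on : ∀ k → a ≤ k → k < i ⊎ k ≡ i → f k ≤ f i
    case-on k a≤k (inj₁ k<i)  = ≤-trans (max k a≤k k<i) fm≤fi
    case-on k a≤k (inj₂ refl) = ≤-refl
  ... | inj₂ fi≤fm = m , a≤m , <-trans m<i (i<suc[i] i) , λ k a≤k k<1+i →
    case-on k a≤k (<suc⇒<⊎≡ k<1+i)
    where
    case-on : ∀ k → a ≤ k → k < i ⊎ k ≡ i → f k ≤ f m
    case-on k a≤k (inj₁ k<i)  = max k a≤k k<i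
    case-on k a≤k (inj₂ refl) = fi≤fm

pigeonhole : (f : ℤ → ℤ) (f-injective : ∀ {i j} → f i ≡ f j → i ≡ j) →
             ∀ {a b c d} → (∀ i → a ≤ i → i < b → c ≤ f i × f i < d) →
             a ≤ b → c ≤ d → b - a ≤ d - c
pigeonhole f f-injective {a} {b} {c} {d} inside a≤b c≤d
  with p , refl ← offset a≤b | q , refl ← offset c≤d
  = linear 4 (λ a c p q → p :≤ q ∷ [] ⊢ a :+ p :- a :≤ c :+ q :- c) a c (+ p) (+ q)
      (+≤+ (Fin.injective⇒≤ {f = g} g-injective))
  where
  bounds : ∀ (i : Fin p) → c ≤ f (a + + toℕ i) × f (a + + toℕ i) < c + + q
  bounds i = inside _ (i≤i+j a (+ toℕ i)) (+-monoʳ-< a (+<+ (Fin.toℕ<n i)))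

  index : ∀ i → + ∣ f (a + + toℕ i) - c ∣ ≡ f (a + + toℕ i) - c
  index i = 0≤i⇒+∣i∣≡i (i≤j⇒0≤j-i (proj₁ (bounds i)))

  index<q : ∀ i → ∣ f (a + + toℕ i) - c ∣ ℕ.< q
  index<q i = drop‿+<+ (subst (_< + q) (sym (index i))
    (linear 3 (λ x c q → x :< c :+ q ∷ [] ⊢ x :- c :< q) _ c (+ q) (proj₂ (bounds i))))

  g : Fin p → Fin q
  g i = fromℕ< (index<q i)

  g-injective : ∀ {i j} → g i ≡ g j → i ≡ j
  g-injective {i} {j} eq = Fin.toℕ-injective (ℤ.+-injective (cancel (f-injective
    (linear 3 (λ x y c → x :- c :≡ y :- c ∷ [] ⊢ x :≡ y) _ _ c same))))
    where
    same : f (a + + toℕ i) - c ≡ f (a + + toℕ j) - c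
    same = trans (sym (index i)) (trans (cong +_ (trans (sym (Fin.toℕ-fromℕ< (index<q i)))
      (trans (cong toℕ eq) (Fin.toℕ-fromℕ< (index<q j))))) (index j))
    cancel : ∀ {x y} → a + x ≡ a + y → x ≡ y
    cancel {x} {y} = linear 3 (λ a x y → a :+ x :≡ a :+ y ∷ [] ⊢ x :≡ y) a x y

quotient-step : ∀ n {q q′} → q < q′ → q * + n + + n ≤ q′ * + n
quotient-step n {q} {q′} q<q′ = ≤-trans
  (≤-reflexive (trans (ℤ.+-comm (q * + n) (+ n)) (sym (suc-* q (+ n)))))
  (*-monoʳ-≤-nonNeg (+ n) (i<j⇒suc[i]≤j q<q′))

quotient-unique : ∀ n {q q′ r r′} → 0ℤ ≤ r → r < + n → 0ℤ ≤ r′ → r′ < + n →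
                  r + q * + n ≡ r′ + q′ * + n → q ≡ q′ × r ≡ r′
quotient-unique n {q} {q′} {r} {r′} 0≤r r<n 0≤r′ r′<n eq with <-cmp q q′
... | tri< q<q′ _ _ = contradiction eq (<⇒≢ (linear 5
  (λ r r′ x x′ n → r :< n ∷ κ 0ℤ :≤ r′ ∷ x :+ n :≤ x′ ∷ [] ⊢ r :+ x :< r′ :+ x′)
  r r′ (q * + n) (q′ * + n) (+ n) r<n 0≤r′ (quotient-step n q<q′)))
... | tri≈ _ refl _ = refl ,
  linear 3 (λ r r′ x → r :+ x :≡ r′ :+ x ∷ [] ⊢ r :≡ r′) r r′ (q * + n) eq
... | tri> _ _ q′<q = contradiction (sym eq) (<⇒≢ (linear 5
  (λ r r′ x x′ n → r :< n ∷ κ 0ℤ :≤ r′ ∷ x :+ n :≤ x′ ∷ [] ⊢ r :+ x :< r′ :+ x′)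
  r′ r (q′ * + n) (q * + n) (+ n) r′<n 0≤r (quotient-step n q′<q)))

Equivariant : ℕ → (ℤ → ℤ) → Set
Equivariant n f = ∀ i → f (i + + n) ≡ f i + + n

Periodic : ∀ {A : Set} → ℕ → (ℤ → A) → Set
Periodic n f = ∀ i → f (i + + n) ≡ f i

module _ {n : ℕ} where

  suc-multiple : ∀ i t → i + 1+ t * + n ≡ (i + t * + n) + + n
  suc-multiple i t rewrite suc-* t (+ n) =
    linear 3 (λ i n x → [] ⊢ i :+ (n :+ x) :≡ (i :+ x) :+ n) i (+ n) (t * + n)

  periodic-* : ∀ {A : Set} (f : ℤ → A) → Periodic n f → ∀ i t → f (i + t * + n) ≡ f i
  periodic-* f per i = ℤ-induction _
    (cong f (+-identityʳ i))
    (λ t eq → trans (trans (cong f (suc-multiple i t)) (per _)) eq)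
    (λ t eq → trans (sym (trans (cong f (suc-multiple i t)) (per _))) eq)

  equivariant-* : ∀ f → Equivariant n f → ∀ i t → f (i + t * + n) ≡ f i + t * + n
  equivariant-* f equi i t = begin
    f i′  ≡⟨ linear 2 (λ a b → [] ⊢ a :≡ a :- b :+ b) (f i′) i′ ⟩
    f i′ - i′ + i′  ≡⟨ cong (_+ i′) (periodic-* (λ i → f i - i) displacement i t) ⟩
    f i - i + (i + t * + n)  ≡⟨ linear 3 (λ a b x → [] ⊢ a :- b :+ (b :+ x) :≡ a :+ x)
                                              (f i) i (t * + n) ⟩
    f i + t * + n  ∎
    where
    i′ = i + t * + n
    displacement : Periodic n (λ i → f i - i)
    displacement i = trans (cong (_- (i + + n)) (equi i))
      (linear 3 (λ a i n → [] ⊢ (a :+ n) :- (i :+ n) :≡ a :- i) (f i) i (+ n))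

-- Sums over a window of n consecutive integers

module ∑ℤ = Sum ℤ.+-0-commutativeMonoid

windowSum : ℕ → (ℤ → ℤ) → ℤ → ℤ
windowSum n h a = ∑ℤ.sum {n} (λ i → h (a + + toℕ i))

windowSum-cong : ∀ n {g h} a → g ≗ h → windowSum n g a ≡ windowSum n h a
windowSum-cong n a g≗h = ∑ℤ.sum-cong-≗ {n} λ i → g≗h (a + + toℕ i)

windowSum-+ : ∀ n g h a → windowSum n (λ i → g i + h i) a ≡ windowSum n g a + windowSum n h a
windowSum-+ n g h a = ∑ℤ.∑-distrib-+ {n} (λ i → g (a + + toℕ i)) (λ i → h (a + + toℕ i))

windowSum-suc : ∀ n h a → windowSum (suc n) h a ≡ h a + windowSum n h (1+ a)
windowSum-suc n h a = cong₂ _+_ (cong h (+-identityʳ a))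
  (∑ℤ.sum-cong-≗ {n} λ i → cong h
    (linear 2 (λ a k → [] ⊢ a :+ :1+ k :≡ :1+ a :+ k) a (+ toℕ i)))

windowSum-const0 : ∀ n a → windowSum n (λ _ → 0ℤ) a ≡ 0ℤ
windowSum-const0 n a = ∑ℤ.sum-replicate-zero n

windowSum-≤0 : ∀ n h a → (∀ i → h i ≤ 0ℤ) → windowSum n h a ≤ 0ℤ
windowSum-≤0 zero    h a h≤0 = ≤-refl
windowSum-≤0 (suc n) h a h≤0 = subst (_≤ 0ℤ) (sym (windowSum-suc n h a))
  (+-mono-≤ (h≤0 a) (windowSum-≤0 n h (1+ a) h≤0))

windowSum-<0 : ∀ n h a (k : Fin n) → (∀ i → h i ≤ 0ℤ) → h (a + + toℕ k) < 0ℤ →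
               windowSum n h a < 0ℤ
windowSum-<0 (suc n) h a k h≤0 h<0 = subst (_< 0ℤ) (sym (windowSum-suc n h a)) (by-index k h<0)
  where
  by-index : ∀ k → h (a + + toℕ k) < 0ℤ → h a + windowSum n h (1+ a) < 0ℤ
  by-index Fin.zero    h<0 = ℤ.+-mono-<-≤ (subst (λ i → h i < 0ℤ) (+-identityʳ a) h<0)
    (windowSum-≤0 n h (1+ a) h≤0)
  by-index (Fin.suc k) h<0 = ℤ.+-mono-≤-< (h≤0 a) (windowSum-<0 n h (1+ a) k h≤0 (subst (λ i → h i < 0ℤ)
    (linear 2 (λ a k → [] ⊢ a :+ :1+ k :≡ :1+ a :+ k) a (+ toℕ k)) h<0))

windowSum-≥0 : ∀ n h a → (∀ i → 0ℤ ≤ h i) → 0ℤ ≤ windowSum n h a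
windowSum-≥0 zero    h a 0≤h = ≤-refl
windowSum-≥0 (suc n) h a 0≤h = subst (0ℤ ≤_) (sym (windowSum-suc n h a))
  (+-mono-≤ (0≤h a) (windowSum-≥0 n h (1+ a) 0≤h))

windowSum-id : ∀ n → windowSum n id 1ℤ ≡ + (suc n C 2)
windowSum-id zero    = refl
windowSum-id (suc n) = begin
  windowSum (suc n) id 1ℤ
    ≡⟨ ∑ℤ.sum-init-last {n} (λ i → 1ℤ + + toℕ i) ⟩
  ∑ℤ.sum {n} (λ i → 1ℤ + + toℕ (Fin.inject₁ i)) + (1ℤ + + toℕ (Fin.fromℕ n))
    ≡⟨ cong₂ _+_ (∑ℤ.sum-cong-≗ {n} λ i → cong (λ k → 1ℤ + + k) (Fin.toℕ-inject₁ i))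
         (cong (λ k → 1ℤ + + k) (Fin.toℕ-fromℕ n)) ⟩
  windowSum n id 1ℤ + + suc n
    ≡⟨ cong (_+ + suc n) (windowSum-id n) ⟩
  + (suc n C 2 ℕ.+ suc n)
    ≡⟨ cong +_ (trans (ℕ.+-comm (suc n C 2) (suc n))
         (trans (cong (ℕ._+ suc n C 2) (sym (nC1≡n (suc n)))) (nCk+nC[k+1]≡[n+1]C[k+1] (suc n) 1))) ⟩
  + (suc (suc n) C 2) ∎

-- Bijections of ℤ that commute with the translation by n, without the
-- normalisation of the sum over a window.
record ExtendedPerm (n : ℕ) : Set where
  field
    fun inv     : ℤ → ℤ
    equivariant : Equivariant n fun
    fun-inv     : ∀ i → fun (inv i) ≡ i
    inv-fun     : ∀ i → inv (fun i) ≡ i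

  injective : ∀ {i j} → fun i ≡ fun j → i ≡ j
  injective {i} {j} eq = trans (sym (inv-fun i)) (trans (cong inv eq) (inv-fun j))

  inv-equivariant : Equivariant n inv
  inv-equivariant i = begin
    inv (i + + n)  ≡⟨ cong (λ j → inv (j + + n)) (fun-inv i) ⟨
    inv (fun (inv i) + + n)  ≡⟨ cong inv (equivariant (inv i)) ⟨
    inv (fun (inv i + + n))  ≡⟨ inv-fun _ ⟩
    inv i + + n  ∎

open ExtendedPerm using (fun; inv)

module _ {n : ℕ} where

  idᵉ : ExtendedPerm n
  idᵉ = record
    { fun = id ; inv = id ; equivariant = λ _ → refl ; fun-inv = λ _ → refl ; inv-fun = λ _ → refl }

  composeᵉ : ExtendedPerm n → ExtendedPerm n → ExtendedPerm n
  composeᵉ p q = record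
    { fun         = fun p ∘ fun q
    ; inv         = inv q ∘ inv p
    ; equivariant = λ i → trans (cong (fun p) (q.equivariant i)) (p.equivariant (fun q i))
    ; fun-inv     = λ i → trans (cong (fun p) (q.fun-inv (inv p i))) (p.fun-inv i)
    ; inv-fun     = λ i → trans (cong (inv q) (p.inv-fun (fun q i))) (q.inv-fun i)
    }
    where
    module p = ExtendedPerm p
    module q = ExtendedPerm q

  invertᵉ : ExtendedPerm n → ExtendedPerm n
  invertᵉ p = record
    { fun         = inv p
    ; inv         = fun p
    ; equivariant = p.inv-equivariant
    ; fun-inv     = p.inv-fun
    ; inv-fun     = p.fun-inv
    }
    where module p = ExtendedPerm p

  forget : AffinePerm n → ExtendedPerm n
  forget v = record
    { fun         = to v
    ; inv         = from v
    ; equivariant = AffinePerm.shift v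
    ; fun-inv     = Inverse.strictlyInverseˡ (AffinePerm.bijection v)
    ; inv-fun     = Inverse.strictlyInverseʳ (AffinePerm.bijection v)
    }

  module _ (v : AffinePerm n) where
    private module v = ExtendedPerm (forget v)

    to-from : ∀ i → to v (from v i) ≡ i
    to-from = v.fun-inv

    from-to : ∀ i → from v (to v i) ≡ i
    from-to = v.inv-fun

    to-injective : ∀ {i j} → to v i ≡ to v j → i ≡ j
    to-injective = v.injective

    from-injective : ∀ {i j} → from v i ≡ from v j → i ≡ j
    from-injective = ExtendedPerm.injective (invertᵉ (forget v))

    to-* : ∀ i t → to v (i + t * + n) ≡ to v i + t * + n
    to-* = equivariant-* (to v) v.equivariant

    from-* : ∀ i t → from v (i + t * + n) ≡ from v i + t * + n
    from-* = equivariant-* (from v) v.inv-equivariant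

module _ (n : ℕ) .{{_ : NonZero n}} where

  residue : ℤ → Fin n
  residue i = fromℕ< (ℤ.n%ℕd<d i n)

  residue-quotient : ∀ i → i ≡ + toℕ (residue i) + (i /ℕ n) * + n
  residue-quotient i rewrite Fin.toℕ-fromℕ< (ℤ.n%ℕd<d i n) = ℤ.a≡a%ℕn+[a/ℕn]*n i n

  residue-quotient-unique : ∀ {i} k t → i ≡ + toℕ k + t * + n → i /ℕ n ≡ t × residue i ≡ k
  residue-quotient-unique {i} k t eq
    with q≡ , r≡ ← quotient-unique n (+≤+ z≤n) (+<+ (Fin.toℕ<n (residue i)))
                     (+≤+ z≤n) (+<+ (Fin.toℕ<n k)) (trans (sym (residue-quotient i)) eq)
    = q≡ , Fin.toℕ-injective (ℤ.+-injective r≡)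

  -- An equivariant bijection permutes the residues, and a periodic function does not see by how
  -- many periods the representatives differ.
  windowSum-permute : ∀ {h} → Periodic n h → (p : ExtendedPerm n) → ∀ a b →
                      windowSum n (h ∘ fun p) a ≡ windowSum n h b
  windowSum-permute {h} periodic p a b = begin
    windowSum n (h ∘ fun p) a
      ≡⟨ ∑ℤ.sum-cong-≗ {n} (λ k → sym (h-move k)) ⟩
    ∑ℤ.sum {n} (λ k → h (b + + toℕ (move (fun p) a b k)))
      ≡⟨ ∑ℤ.sum-permute {n} {n} (λ k → h (b + + toℕ k)) permutation ⟨
    windowSum n h b ∎
    where
    module p = ExtendedPerm p

    move : (ℤ → ℤ) → ℤ → ℤ → Fin n → Fin n
    move f a b k = residue (f (a + + toℕ k) - b)

    move-quotient : ∀ f a b k → f (a + + toℕ k) ≡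
      b + + toℕ (move f a b k) + ((f (a + + toℕ k) - b) /ℕ n) * + n
    move-quotient f a b k = linear 4
      (λ x b r q → x :- b :≡ r :+ q ∷ [] ⊢ x :≡ b :+ r :+ q) _ b _ _
      (residue-quotient (f (a + + toℕ k) - b))

    move-inverse : ∀ {f g} → Equivariant n f → (∀ i → f (g i) ≡ i) → ∀ a b k →
                   move f a b (move g b a k) ≡ k
    move-inverse {f} {g} equi fg a b k =
      proj₂ (residue-quotient-unique k (- t)
        (trans landed (cong (λ y → + toℕ k + y) (trans (+-identityˡ _) (neg-distribˡ-* t (+ n))))))
      where
      i = g (b + + toℕ k)
      t = (i - a) /ℕ n
      r = a + + toℕ (move g b a k)
      moved : f i ≡ f r + t * + n
      moved = trans (cong f (move-quotient g b a k)) (equivariant-* f equi r t)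
      landed : f r - b ≡ + toℕ k + (0ℤ - t * + n)
      landed = linear 5
        (λ x y b k q → x :+ q :≡ y ∷ y :≡ b :+ k ∷ [] ⊢ x :- b :≡ k :+ (κ 0ℤ :- q))
        (f r) (f i) b (+ toℕ k) (t * + n) (sym moved) (fg (b + + toℕ k))

    permutation : Permutation.Permutation n n
    permutation = Permutation.permutation (move (fun p) a b) (move (inv p) b a)
      (move-inverse {fun p} {inv p} p.equivariant p.fun-inv a b)
      (move-inverse {inv p} {fun p} p.inv-equivariant p.inv-fun b a)

    h-move : ∀ k → h (b + + toℕ (move (fun p) a b k)) ≡ h (fun p (a + + toℕ k))
    h-move k = sym (trans (cong h (move-quotient (fun p) a b k)) (periodic-* h periodic _ ((fun p (a + + toℕ k) - b) /ℕ n)))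

  -- The total displacement over a period. Displacements are periodic while the values themselves
  -- are not, so this quantity, unlike the window sum, is additive under composition; it vanishes
  -- exactly when the window is normalised.
  degree : (ℤ → ℤ) → ℤ
  degree f = windowSum n (λ i → f i - i) 1ℤ

  displacement-periodic : ∀ f → Equivariant n f → Periodic n (λ i → f i - i)
  displacement-periodic f equi i = trans (cong (_- (i + + n)) (equi i))
    (linear 3 (λ a i n → [] ⊢ (a :+ n) :- (i :+ n) :≡ a :- i) (f i) i (+ n))

  degree-∘ : (q p : ExtendedPerm n) →
             degree (fun q ∘ fun p) ≡ degree (fun q) + degree (fun p)
  degree-∘ q p = begin
    degree (f ∘ fun p)
      ≡⟨ windowSum-cong n 1ℤ (λ i → linear 3 (λ a b c → [] ⊢ a :- c :≡ (a :- b) :+ (b :- c))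
           (f (fun p i)) (fun p i) i) ⟩
    windowSum n (λ i → (f (fun p i) - fun p i) + (fun p i - i)) 1ℤ
      ≡⟨ windowSum-+ n (λ i → f (fun p i) - fun p i) (λ i → fun p i - i) 1ℤ ⟩
    windowSum n (λ i → f (fun p i) - fun p i) 1ℤ + degree (fun p)
      ≡⟨ cong (_+ degree (fun p)) (windowSum-permute (displacement-periodic f (ExtendedPerm.equivariant q)) p 1ℤ 1ℤ) ⟩
    degree f + degree (fun p) ∎
    where
    f = fun q

  degree-window : ∀ f → windowSum n f 1ℤ ≡ degree f + + (suc n C 2)
  degree-window f = begin
    windowSum n f 1ℤ
      ≡⟨ windowSum-cong n 1ℤ (λ i → linear 2 (λ a i → [] ⊢ a :≡ (a :- i) :+ i) (f i) i) ⟩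
    windowSum n (λ i → (f i - i) + i) 1ℤ
      ≡⟨ windowSum-+ n (λ i → f i - i) id 1ℤ ⟩
    degree f + windowSum n id 1ℤ
      ≡⟨ cong (λ x → degree f + x) (windowSum-id n) ⟩
    degree f + + (suc n C 2) ∎

  degree-to : (v : AffinePerm n) → degree (to v) ≡ 0ℤ
  degree-to v = linear 2 (λ d c → d :+ c :≡ c ∷ [] ⊢ d :≡ κ 0ℤ) _ (+ (suc n C 2))
    (trans (sym (degree-window (to v))) (AffinePerm.window v))

  degree-id : degree id ≡ 0ℤ
  degree-id = trans (windowSum-cong n 1ℤ (λ i → +-inverseʳ i)) (windowSum-const0 n 1ℤ)

  normalised : (p : ExtendedPerm n) → degree (fun p) ≡ 0ℤ → AffinePerm n
  normalised p degree≡0 = record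
    { bijection = mk↔ₛ′ (fun p) (inv p) p.fun-inv p.inv-fun
    ; shift     = p.equivariant
    ; window    = trans (degree-window (fun p)) (cong (_+ + (suc n C 2)) degree≡0)
    }
    where module p = ExtendedPerm p

  compose : AffinePerm n → AffinePerm n → AffinePerm n
  compose v w = normalised (composeᵉ (forget v) (forget w))
    (trans (degree-∘ (forget v) (forget w)) (cong₂ _+_ (degree-to v) (degree-to w)))

  invert : AffinePerm n → AffinePerm n
  invert v = normalised (invertᵉ (forget v)) (linear 3
    (λ d e f → e :+ f :≡ d ∷ κ 0ℤ :≡ e ∷ d :≡ κ 0ℤ ∷ [] ⊢ f :≡ κ 0ℤ) _ _ _
    (sym (degree-∘ (forget v) (invertᵉ (forget v)))) (sym (degree-to v))
    (trans (windowSum-cong n 1ℤ (λ i → cong (_- i) (to-from v i))) degree-id))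

-- Reflections and simple generators

infix 4 _≢_[mod_]
_≢_[mod_] : ℤ → ℤ → ℕ → Set
x ≢ y [mod n ] = ∀ t → x ≢ y + t * + n

≢[mod]-sym : ∀ {n x y} → x ≢ y [mod n ] → y ≢ x [mod n ]
≢[mod]-sym {n} {x} {y} x≢y t y≡x = x≢y (- t) (trans
  (linear 3 (λ x y a → x :+ a :≡ y ∷ [] ⊢ x :≡ y :+ (κ 0ℤ :- a)) x y (t * + n) (sym y≡x))
  (cong (λ a → y + a) (trans (+-identityˡ _) (neg-distribˡ-* t (+ n)))))

congruent-translates : ∀ {n} x y t t′ → x + t * + n ≡ y + t′ * + n →
                       x ≡ y + (t′ - t) * + n
congruent-translates {n} x y t t′ eq = trans
  (linear 4 (λ x y a b → x :+ a :≡ y :+ b ∷ [] ⊢ x :≡ y :+ (b :- a)) x y _ _ eq)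
  (cong (λ a → y + a) (distrib t t′ (+ n)))
  where
  distrib : ∀ t t′ n → t′ * n - t * n ≡ (t′ - t) * n
  distrib = solve-∀

-- The graph of the affine reflection exchanging `p + t * + n` and `q + t * + n` for all `t`. It
-- serves the generators and general reflections alike, and its symmetry in `p` and `q` replaces
-- case distinctions on divisibility.
data Reflects (n : ℕ) (p q : ℤ) : ℤ → ℤ → Set where
  at-p : ∀ t → Reflects n p q (p + t * + n) (q + t * + n)
  at-q : ∀ t → Reflects n p q (q + t * + n) (p + t * + n)
  away : ∀ {x} → x ≢ p [mod n ] → x ≢ q [mod n ] → Reflects n p q x x

module _ {n : ℕ} {p q : ℤ} where

  reflects-sym : ∀ {x y} → Reflects n p q x y → Reflects n p q y x
  reflects-sym (at-p t)       = at-q t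
  reflects-sym (at-q t)       = at-p t
  reflects-sym (away x≢p x≢q) = away x≢p x≢q

  reflects-swap : ∀ {x y} → Reflects n p q x y → Reflects n q p x y
  reflects-swap (at-p t)       = at-q t
  reflects-swap (at-q t)       = at-p t
  reflects-swap (away x≢p x≢q) = away x≢q x≢p

  reflects-shift : ∀ {x y} → Reflects n p q x y → Reflects n p q (x + + n) (y + + n)
  reflects-shift (at-p t) rewrite sym (suc-multiple {n} p t) | sym (suc-multiple {n} q t) = at-p (1+ t)
  reflects-shift (at-q t) rewrite sym (suc-multiple {n} p t) | sym (suc-multiple {n} q t) = at-q (1+ t)
  reflects-shift {x} (away x≢p x≢q) = away (shifted p x≢p) (shifted q x≢q)
    where
    shifted : ∀ p → x ≢ p [mod n ] → x + + n ≢ p [mod n ]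
    shifted p x≢p t eq = x≢p (ℤ.pred t) (linear 3
      (λ x y n → x :+ n :≡ y :+ n ∷ [] ⊢ x :≡ y) x (p + ℤ.pred t * + n) (+ n)
      (trans eq (trans (cong (λ t → p + t * + n) (sym (suc-pred t))) (suc-multiple p (ℤ.pred t)))))

  module _ (p≢q : p ≢ q [mod n ]) where

    private
      p+t≢q+t′ : ∀ t t′ → p + t * + n ≢ q + t′ * + n
      p+t≢q+t′ t t′ eq = p≢q (t′ - t) (congruent-translates p q t t′ eq)

    reflects-unique : ∀ {x x′ y y′} → x ≡ x′ → Reflects n p q x y → Reflects n p q x′ y′ → y ≡ y′
    reflects-unique eq (at-p t) (at-p t′) =
      linear 4 (λ p q a b → p :+ a :≡ p :+ b ∷ [] ⊢ q :+ a :≡ q :+ b) p q _ _ eq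
    reflects-unique eq (at-p t) (at-q t′) = contradiction eq (p+t≢q+t′ t t′)
    reflects-unique eq (at-p t) (away x≢p _) = contradiction (sym eq) (x≢p t)
    reflects-unique eq (at-q t) (at-p t′) = contradiction (sym eq) (p+t≢q+t′ t′ t)
    reflects-unique eq (at-q t) (at-q t′) =
      linear 4 (λ p q a b → q :+ a :≡ q :+ b ∷ [] ⊢ p :+ a :≡ p :+ b) p q _ _ eq
    reflects-unique eq (at-q t) (away _ x≢q) = contradiction (sym eq) (x≢q t)
    reflects-unique eq (away x≢p _) (at-p t) = contradiction eq (x≢p t)
    reflects-unique eq (away _ x≢q) (at-q t) = contradiction eq (x≢q t)
    reflects-unique eq (away _ _) (away _ _) = eq

    reflectionᵉ : (f : ℤ → ℤ) → (∀ x → Reflects n p q x (f x)) → ExtendedPerm n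
    reflectionᵉ f view = record
      { fun         = f
      ; inv         = f
      ; equivariant = λ x → reflects-unique refl (view (x + + n)) (reflects-shift (view x))
      ; fun-inv     = involutive
      ; inv-fun     = involutive
      }
      where
      involutive : ∀ x → f (f x) ≡ x
      involutive x = reflects-unique refl (view (f x)) (reflects-sym (view x))

    -- A reflection is an involution, so twice its degree is the degree of id.
    reflection-degree : .{{_ : NonZero n}} (f : ℤ → ℤ) → (∀ x → Reflects n p q x (f x)) →
                        degree n f ≡ 0ℤ
    reflection-degree f view = half (trans (sym (degree-∘ n r r))
      (trans (windowSum-cong n 1ℤ (λ i → cong (_- i) (ExtendedPerm.fun-inv r i))) (degree-id n)))
      where
      r = reflectionᵉ f view
      half : ∀ {d} → d + d ≡ 0ℤ → d ≡ 0ℤ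
      half {d} 2d≡0 with <-cmp d 0ℤ
      ... | tri< d<0 _ _ = contradiction 2d≡0 (<⇒≢ (+-mono-< d<0 d<0))
      ... | tri≈ _ d≡0 _ = d≡0
      ... | tri> _ _ 0<d = contradiction (sym 2d≡0) (<⇒≢ (+-mono-< 0<d 0<d))

transpose : ℕ → ℤ → ℤ → ℤ → ℤ
transpose n p q x with + n ∣? x - p
... | yes _ = x + (q - p)
... | no  _ with + n ∣? x - q
...   | yes _ = x + (p - q)
...   | no  _ = x

value : ∀ {n} → Generator n → ℤ
value g = + suc (toℕ (Generator.index g))

private
  module _ {n : ℕ} {x p : ℤ} where
    indivisible : ¬ (+ n ∣ x - p) → x ≢ p [mod n ]
    indivisible n∤ t eq = n∤ (divides t
      (linear 3 (λ x p a → x :≡ p :+ a ∷ [] ⊢ x :- p :≡ a) x p (t * + n) eq))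

    module _ {y q : ℤ} where
      reflects-p : + n ∣ x - p → y ≡ x + (q - p) → Reflects n p q x y
      reflects-p (divides t x-p≡) y≡ = reflect x≡ y≡q+a
        where
        a = t * + n
        x≡ : x ≡ p + a
        x≡ = linear 3 (λ x p a → x :- p :≡ a ∷ [] ⊢ x :≡ p :+ a) x p a x-p≡
        y≡q+a : y ≡ q + a
        y≡q+a = linear 5 (λ x y p q a → x :- p :≡ a ∷ y :≡ x :+ (q :- p) ∷ [] ⊢ y :≡ q :+ a)
          x y p q a x-p≡ y≡
        reflect : x ≡ p + t * + n → y ≡ q + t * + n → Reflects n p q x y
        reflect refl refl = at-p t

      reflects-q : + n ∣ x - p → y ≡ x + (q - p) → Reflects n q p x y
      reflects-q n∣ y≡ = reflects-swap (reflects-p n∣ y≡)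

transpose-reflects : ∀ n p q x → Reflects n p q x (transpose n p q x)
transpose-reflects n p q x with + n ∣? x - p
... | yes n∣x-p = reflects-p n∣x-p refl
... | no  n∤x-p with + n ∣? x - q
...   | yes n∣x-q = reflects-q n∣x-q refl
...   | no  n∤x-q = away (indivisible n∤x-p) (indivisible n∤x-q)

generate-reflects : ∀ {n} (g : Generator n) x →
                    Reflects n (value g) (1+ (value g)) x (generate g x)
generate-reflects {n} g x with + n ∣? x - value g
... | yes n∣x-k = reflects-p n∣x-k
  (linear 2 (λ x k → [] ⊢ :1+ x :≡ x :+ (:1+ k :- k)) x (value g))
... | no  n∤x-k with + n ∣? x - 1+ (value g)
...   | yes n∣x-[1+k] = reflects-q n∣x-[1+k]
  (linear 2 (λ x k → [] ⊢ κ -1ℤ :+ x :≡ x :+ (k :- :1+ k)) x (value g))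
...   | no  n∤x-[1+k] = away (indivisible n∤x-k) (indivisible n∤x-[1+k])

module _ {n : ℕ} (g : Generator n) where

  value≢suc : value g ≢ 1+ (value g) [mod n ]
  value≢suc = ≢[mod]-sym λ t eq → contradiction
    (proj₂ (quotient-unique n {0ℤ} {t} (+≤+ z≤n) (+<+ (Generator.1<n g)) (+≤+ z≤n)
      (<-trans (+<+ (s≤s z≤n)) (+<+ (Generator.1<n g)))
      (linear 2 (λ k a → κ 1ℤ :+ k :≡ k :+ a ∷ [] ⊢ :1+ κ 0ℤ :≡ κ 0ℤ :+ a) (value g) (t * + n) eq)))
    λ ()

  generateᵉ : ExtendedPerm n
  generateᵉ = reflectionᵉ value≢suc (generate g) (generate-reflects g)

  generate-involutive : ∀ x → generate g (generate g x) ≡ x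
  generate-involutive = ExtendedPerm.fun-inv generateᵉ

  generate-value : ∀ t → generate g (value g + t * + n) ≡ 1+ (value g) + t * + n
  generate-value t = reflects-unique value≢suc refl (generate-reflects g _) (at-p t)

  generate-suc-value : ∀ t → generate g (1+ (value g) + t * + n) ≡ value g + t * + n
  generate-suc-value t = reflects-unique value≢suc refl (generate-reflects g _) (at-q t)

  generate-value₀ : generate g (value g) ≡ 1+ (value g)
  generate-value₀ = trans (cong (generate g) (sym (+-identityʳ (value g))))
    (trans (generate-value 0ℤ) (+-identityʳ (1+ (value g))))

  data Moves : ℤ → ℤ → Set where
    up   : ∀ t → Moves (value g + t * + n) (1+ (value g + t * + n))
    down : ∀ t → Moves (1+ (value g + t * + n)) (value g + t * + n)
    stay : ∀ {x} → x ≢ value g [mod n ] → x ≢ 1+ (value g) [mod n ] → Moves x x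

  generate-moves : ∀ x → Moves x (generate g x)
  generate-moves x = convert (generate-reflects g x)
    where
    convert : ∀ {x y} → Reflects n (value g) (1+ (value g)) x y → Moves x y
    convert (at-p t) = subst (Moves (value g + t * + n)) (sym (+-assoc 1ℤ (value g) (t * + n))) (up t)
    convert (at-q t) = subst (λ x → Moves x (value g + t * + n)) (sym (+-assoc 1ℤ (value g) (t * + n))) (down t)
    convert (away x≢k x≢1+k) = stay x≢k x≢1+k

  simple : .{{_ : NonZero n}} → AffinePerm n
  simple = normalised n generateᵉ (reflection-degree value≢suc (generate g) (generate-reflects g))

  generate-inverts : ∀ {a b} → a < b → generate g b < generate g a →
                     ∃ λ t → a ≡ value g + t * + n × b ≡ 1+ a
  generate-inverts {a} {b} a<b gb<ga = moved (generate-moves a) (generate-moves b) a<b gb<ga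
    where
    moved : ∀ {a a′ b b′} → Moves a a′ → Moves b b′ → a < b → b′ < a′ →
            ∃ λ t → a ≡ value g + t * + n × b ≡ 1+ a
    moved (up t) (up t′) a<b b′<a′ = ⊥-elim (linear 2
      (λ a b → a :< b ∷ :1+ b :< :1+ a ∷ [] ⊢ :⊥) _ _ a<b b′<a′)
    moved (up t) (down t′) a<b b′<a′ = t , refl , ≤-antisym
      (linear 2 (λ a b → b :< :1+ a ∷ [] ⊢ :1+ b :≤ :1+ a)
        (value g + t * + n) (value g + t′ * + n) b′<a′)
      (i<j⇒suc[i]≤j a<b)
    moved (up t) (stay _ _) a<b b′<a′ = contradiction a<b (≤⇒≯ (<suc⇒≤ b′<a′))
    moved (down t) (up t′) a<b b′<a′ = ⊥-elim (linear 2
      (λ a b → κ 1ℤ :+ a :< b ∷ :1+ b :< a ∷ [] ⊢ :⊥) _ _ a<b b′<a′)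
    moved (down t) (down t′) a<b b′<a′ = ⊥-elim (linear 2
      (λ a b → κ 1ℤ :+ a :< :1+ b ∷ b :< a ∷ [] ⊢ :⊥) _ _ a<b b′<a′)
    moved (down t) (stay _ _) a<b b′<a′ = ⊥-elim (linear 2
      (λ a b → κ 1ℤ :+ a :< b ∷ b :< a ∷ [] ⊢ :⊥) _ _ a<b b′<a′)
    moved (stay _ _) (up t′) a<b b′<a′ = ⊥-elim (linear 2
      (λ a b → a :< b ∷ :1+ b :< a ∷ [] ⊢ :⊥) _ _ a<b b′<a′)
    moved (stay _ _) (down t′) a<b b′<a′ = contradiction b′<a′ (≤⇒≯ (<suc⇒≤ a<b))
    moved (stay _ _) (stay _ _) a<b b′<a′ = contradiction a<b (<-asym b′<a′)

-- Coxeter length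

private
  square : ℤ → ℤ
  square x = x * x

  square≥0 : ∀ x → 0ℤ ≤ square x
  square≥0 (+ zero)  = +≤+ z≤n
  square≥0 (+ suc _) = +≤+ z≤n
  square≥0 -[1+ _ ]  = +≤+ z≤n

module _ {n : ℕ} .{{_ : NonZero n}} where

  ¬decreasing : (u : AffinePerm n) → ¬ (∀ i → to u i < i)
  ¬decreasing u u<id = <⇒≢ {degree n (to u)} {0ℤ}
    (windowSum-<0 n (λ i → to u i - i) 1ℤ (residue n 0ℤ) (λ i → <⇒≤ (negative i)) (negative _))
    (degree-to n u)
    where
    negative : ∀ i → to u i - i < 0ℤ
    negative i = linear 2 (λ a i → a :< i ∷ [] ⊢ a :- i :< κ 0ℤ) (to u i) i (u<id i)

  -- An increasing bijection of ℤ is a translation. A translation to the left contradicts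
  -- `¬decreasing` for `u`, one to the right contradicts it for the inverse.
  increasing⇒identity : (u : AffinePerm n) → (∀ {i j} → i < j → to u i < to u j) → to u ≗ id
  increasing⇒identity u mono i = by-sign (<-cmp (to u 0ℤ) 0ℤ)
    where
    cancel-< : ∀ {i j} → to u i < to u j → i < j
    cancel-< {i} {j} ui<uj with <-cmp i j
    ... | tri< i<j _ _  = i<j
    ... | tri≈ _ refl _ = contradiction ui<uj (<-irrefl refl)
    ... | tri> _ _ j<i  = contradiction ui<uj (<-asym (mono j<i))

    step : ∀ i → to u (1+ i) ≡ 1+ (to u i)
    step i with <-cmp (1+ (to u i)) (to u (1+ i))
    ... | tri≈ _ eq _ = sym eq
    ... | tri> _ _ gt = contradiction (mono (i<suc[i] i)) (≤⇒≯ (<suc⇒≤ gt))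
    -- The value `1+ (to u i)` would have to occur strictly between the positions `i` and `1+ i`.
    ... | tri< lt _ _ = contradiction
      (cancel-< (subst (_< to u (1+ i)) (sym (to-from u (1+ (to u i)))) lt))
      (≤⇒≯ (i<j⇒suc[i]≤j (cancel-<
        (subst (to u i <_) (sym (to-from u (1+ (to u i)))) (i<suc[i] (to u i))))))

    translation : ∀ i → to u i ≡ i + to u 0ℤ
    translation = ℤ-induction _ (sym (+-identityˡ _))
      (λ i eq → trans (step i) (trans (cong 1+ eq) (sym (+-assoc 1ℤ i (to u 0ℤ)))))
      (λ i eq → linear 4 (λ a b i c → κ 1ℤ :+ a :≡ b ∷ b :≡ :1+ i :+ c ∷ [] ⊢ a :≡ i :+ c)
        (to u i) (to u (1+ i)) i (to u 0ℤ) (sym (step i)) eq)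

    by-sign : Tri (to u 0ℤ < 0ℤ) (to u 0ℤ ≡ 0ℤ) (0ℤ < to u 0ℤ) → to u i ≡ i
    by-sign (tri≈ _ c≡0 _) =
      trans (translation i) (trans (cong (λ c → i + c) c≡0) (+-identityʳ i))
    by-sign (tri< c<0 _ _) = contradiction
      (λ i → linear 3 (λ a i c → a :≡ i :+ c ∷ c :< κ 0ℤ ∷ [] ⊢ a :< i)
        (to u i) i (to u 0ℤ) (translation i) c<0)
      (¬decreasing u)
    by-sign (tri> _ _ 0<c) = contradiction
      (λ i → linear 3 (λ a i c → a :+ c :≡ i ∷ κ 0ℤ :< c ∷ [] ⊢ a :< i)
        (from u i) i (to u 0ℤ) (trans (sym (translation (from u i))) (to-from u i)) 0<c)
      (¬decreasing (invert n u))

  -- A left descent, expressed by positions: of two neighbouring values the larger one stands first.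
  -- The product `g • u` exchanges these two values.
  Descent : AffinePerm n → Generator n → Set
  Descent u g = from u (1+ (value g)) < from u (value g)

  descent-translate : ∀ u g → Descent u g → ∀ t →
    from u (1+ (value g + t * + n)) < from u (value g + t * + n)
  descent-translate u g descent t = subst₂ _<_
    (trans (sym (from-* u (1+ (value g)) t)) (cong (from u) (+-assoc 1ℤ (value g) (t * + n))))
    (sym (from-* u (value g) t))
    (+-monoˡ-< (t * + n) descent)

  -- For n = 1 there is no generator, but no descent either.
  descent-at : ∀ u {y} → from u (1+ y) < from u y →
               ∃ λ g → Descent u g × ∃ λ t → y ≡ value g + t * + n
  descent-at u {y} lt = g , descent , t , y≡
    where
    1<n : 1 ℕ.< n
    1<n with ℕ.<-cmp 1 n
    ... | tri< lt _ _ = lt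
    ... | tri≈ _ refl _ = contradiction lt (<-asym (subst (from u y <_)
      (sym (trans (cong (from u) (ℤ.+-comm 1ℤ y)) (ExtendedPerm.inv-equivariant (forget u) y)))
      (linear 1 (λ a → [] ⊢ a :< a :+ κ 1ℤ) (from u y))))
    ... | tri> _ _ gt = contradiction gt (ℕ.≤⇒≯ (ℕ.>-nonZero⁻¹ n))

    -- `value g` is the index plus one, so the residue is that of `y - 1ℤ`.
    g = record { 1<n = 1<n ; index = residue n (y - 1ℤ) }
    t = (y - 1ℤ) /ℕ n

    y≡ : y ≡ value g + t * + n
    y≡ = linear 3 (λ y r q → y :- κ 1ℤ :≡ r :+ q ∷ [] ⊢ y :≡ :1+ r :+ q)
      y (+ toℕ (residue n (y - 1ℤ))) (t * + n) (residue-quotient n (y - 1ℤ))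

    descent : Descent u g
    descent = linear 3 (λ a b t → a :+ t :< b :+ t ∷ [] ⊢ a :< b)
      (from u (1+ (value g))) (from u (value g)) (t * + n)
      (subst₂ _<_
        (trans (cong (from u) (trans (cong 1+ y≡) (sym (+-assoc 1ℤ (value g) (t * + n)))))
          (from-* u (1+ (value g)) t))
        (trans (cong (from u) y≡) (from-* u (value g) t)) lt)

  descent⊎identity : ∀ u → ∃ (Descent u) ⊎ to u ≗ id
  descent⊎identity u with Fin.any? (λ (i : Fin n) → from u (+ suc (suc (toℕ i))) <? from u (+ suc (toℕ i)))
  ... | yes (i , lt) = let (g , descent , _) = descent-at u lt in inj₁ (g , descent)
  ... | no none = inj₂ λ i → trans (cong (to u) (sym (from-id i))) (to-from u i)
    where
    ascent : ∀ k → from u k < from u (1+ k)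
    ascent k = subst₂ _<_
      (trans (sym (from-* u (1ℤ + + toℕ r) q)) (cong (from u) (sym k≡)))
      (trans (sym (from-* u (1+ (1ℤ + + toℕ r)) q)) (cong (from u) (trans
        (+-assoc 1ℤ (1ℤ + + toℕ r) (q * + n)) (cong 1+ (sym k≡)))))
      (+-monoˡ-< (q * + n) (≤∧≢⇒< (≮⇒≥ (λ lt → none (r , lt)))
        (λ eq → <⇒≢ (i<suc[i] (1ℤ + + toℕ r)) (from-injective u eq))))
      where
      r = residue n (k - 1ℤ)
      q = (k - 1ℤ) /ℕ n
      k≡ : k ≡ (1ℤ + + toℕ r) + q * + n
      k≡ = linear 3 (λ k r q → k :- κ 1ℤ :≡ r :+ q ∷ [] ⊢ k :≡ :1+ r :+ q)
        k (+ toℕ r) (q * + n) (residue-quotient n (k - 1ℤ))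

    from-id : from u ≗ id
    from-id = increasing⇒identity (invert n u) λ {i} {j} i<j →
      upward (λ j → from u i < from u j) (1+ i) (ascent i)
        (λ j _ lt → <-trans lt (ascent j)) (i<j⇒suc[i]≤j i<j)

  infixr 7 _•_
  _•_ : Generator n → AffinePerm n → AffinePerm n
  g • u = compose n (simple g) u

  -- The measure for removing descents: the squared distances between values and their positions,
  -- over one period of values. It is nonnegative, and exchanging two neighbouring values that are
  -- out of order brings values closer to their positions in this sense.
  energy : AffinePerm n → ℤ
  energy u = windowSum n (λ y → square (y - from u y)) 1ℤ

  private
    neg*pos : ∀ {i j} → i < 0ℤ → 0ℤ < j → i * j < 0ℤ
    neg*pos { -[1+ _ ]} {+ suc _} _ _ = -<+
    neg*pos {+ _} (+<+ ()) _
    neg*pos { -[1+ _ ]} {+ zero} _ (+<+ ())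

    differences-<0 : ∀ a b c d → a < b → d < c → (a - b) * (c - d) < 0ℤ
    differences-<0 a b c d a<b d<c = neg*pos
      (linear 2 (λ a b → a :< b ∷ [] ⊢ a :- b :< κ 0ℤ) a b a<b)
      (linear 2 (λ d c → d :< c ∷ [] ⊢ κ 0ℤ :< c :- d) d c d<c)

    differences-swap : ∀ a b c d → (b - a) * (d - c) ≡ (a - b) * (c - d)
    differences-swap = solve-∀

    squares-exchange : ∀ a b c d →
      square (a - d) + square (b - c) ≡
      (square (a - c) + square (b - d)) +
      ((a - b) * (c - d) + (a - b) * (c - d))
    squares-exchange = expanded
      where
      expanded : ∀ a b c d →
        (a - d) * (a - d) + (b - c) * (b - c) ≡
        ((a - c) * (a - c) + (b - d) * (b - d)) +
        ((a - b) * (c - d) + (a - b) * (c - d))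
      expanded = solve-∀

  energy≥0 : ∀ u → 0ℤ ≤ energy u
  energy≥0 u = windowSum-≥0 n (λ y → square (y - from u y)) 1ℤ (λ y → square≥0 (y - from u y))

  -- Replacing y by s y in half of the sum pairs the terms of y and s y, and
  -- what remains of a pair is a product of two differences of opposite sign.
  energy-descends : ∀ u g → Descent u g → energy (g • u) < energy u
  energy-descends u g descent = ≰⇒> λ E≤E′ → linear 3
    (λ E E′ Δ → E :≤ E′ ∷ E :≤ E′ ∷ E′ :+ E′ :≡ E :+ E :+ Δ ∷ Δ :< κ 0ℤ ∷ [] ⊢ :⊥)
    (energy u) (energy (g • u)) (windowSum n Δ 1ℤ) E≤E′ E≤E′ doubled
    -- The window starts at `1ℤ`, so its term at the index of `g` is the one at `value g`, where the
    -- product is strictly negative.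
    (windowSum-<0 n Δ 1ℤ (Generator.index g) Δ≤0 Δ<0)
    where
    s = generate g
    f = from u
    F G product Δ : ℤ → ℤ
    F y = square (y - f (s y))
    G y = square (y - f y)
    product y = (y - s y) * (f y - f (s y))
    Δ y = product y + product y

    product≤0 : ∀ y → product y ≤ 0ℤ
    product≤0 y = from-moves (generate-moves g y)
      where
      from-moves : ∀ {x x′} → Moves g x x′ → (x - x′) * (f x - f x′) ≤ 0ℤ
      from-moves (up t)         = <⇒≤ (differences-<0 k (1+ k) (f k) (f (1+ k))
        (i<suc[i] k) (descent-translate u g descent t))
        where k = value g + t * + n
      from-moves (down t)       = ≤-trans
        (≤-reflexive (differences-swap k (1+ k) (f k) (f (1+ k))))
        (<⇒≤ (differences-<0 k (1+ k) (f k) (f (1+ k))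
          (i<suc[i] k) (descent-translate u g descent t)))
        where k = value g + t * + n
      from-moves {x} (stay _ _) = ≤-reflexive
        (trans (cong (_* (f x - f x)) (+-inverseʳ x)) (ℤ.*-zeroˡ (f x - f x)))

    product<0 : product (value g) < 0ℤ
    product<0 = subst (λ x → (value g - x) * (f (value g) - f x) < 0ℤ)
      (sym (generate-value₀ g)) (differences-<0 k (1+ k) (f k) (f (1+ k)) (i<suc[i] k) descent)
      where k = value g

    Δ≤0 : ∀ y → Δ y ≤ 0ℤ
    Δ≤0 y = linear 1 (λ x → x :≤ κ 0ℤ ∷ x :≤ κ 0ℤ ∷ [] ⊢ x :+ x :≤ κ 0ℤ) (product y)
      (product≤0 y) (product≤0 y)

    Δ<0 : Δ (value g) < 0ℤ
    Δ<0 = linear 1 (λ x → x :< κ 0ℤ ∷ x :< κ 0ℤ ∷ [] ⊢ x :+ x :< κ 0ℤ) (product (value g))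
      product<0 product<0

    displacement² : ∀ (p : ExtendedPerm n) → Periodic n (λ y → square (y - fun p y))
    displacement² p y = cong square (trans (cong (λ x → y + + n - x) (ExtendedPerm.equivariant p y))
      (linear 3 (λ y n x → [] ⊢ y :+ n :- (x :+ n) :≡ y :- x) y (+ n) (fun p y)))

    doubled-sum : ∀ h → Periodic n h →
                  windowSum n (λ y → h y + h (s y)) 1ℤ ≡ windowSum n h 1ℤ + windowSum n h 1ℤ
    doubled-sum h periodic = trans (windowSum-+ n h (h ∘ s) 1ℤ)
      (cong (λ x → windowSum n h 1ℤ + x) (windowSum-permute n {h} periodic (generateᵉ g) 1ℤ 1ℤ))

    F-periodic : Periodic n F
    F-periodic = displacement² (invertᵉ (forget (g • u)))

    G-periodic : Periodic n G
    G-periodic = displacement² (invertᵉ (forget u))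

    exchanged : ∀ y → F y + F (s y) ≡ G y + G (s y) + Δ y
    exchanged y = trans
      (cong (λ x → F y + square (s y - f x)) (generate-involutive g y))
      (squares-exchange y (s y) (f y) (f (s y)))

    doubled : windowSum n F 1ℤ + windowSum n F 1ℤ ≡
              windowSum n G 1ℤ + windowSum n G 1ℤ + windowSum n Δ 1ℤ
    doubled = begin
      windowSum n F 1ℤ + windowSum n F 1ℤ
        ≡⟨ doubled-sum F F-periodic ⟨
      windowSum n (λ y → F y + F (s y)) 1ℤ
        ≡⟨ windowSum-cong n 1ℤ exchanged ⟩
      windowSum n (λ y → G y + G (s y) + Δ y) 1ℤ
        ≡⟨ windowSum-+ n (λ y → G y + G (s y)) Δ 1ℤ ⟩
      windowSum n (λ y → G y + G (s y)) 1ℤ + windowSum n Δ 1ℤ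
        ≡⟨ cong (_+ windowSum n Δ 1ℤ) (doubled-sum G G-periodic) ⟩
      windowSum n G 1ℤ + windowSum n G 1ℤ + windowSum n Δ 1ℤ ∎

  -- Each removal of a descent lowers the nonnegative integer `energy`, and without descents only
  -- the identity is left.
  descent-induction : (P : AffinePerm n → Set) → (∀ u → to u ≗ id → P u) →
                      (∀ u g → Descent u g → P (g • u) → P u) → ∀ u → P u
  descent-induction P base step u = go (energy≥0 u) refl (ℕ.<-wellFounded ∣ energy u ∣)
    where
    ∣∣-mono-< : ∀ {i j} → 0ℤ ≤ i → 0ℤ ≤ j → i < j → ∣ i ∣ ℕ.< ∣ j ∣
    ∣∣-mono-< (+≤+ _) (+≤+ _) = drop‿+<+

    go : ∀ {u E} → 0ℤ ≤ E → energy u ≡ E → Acc ℕ._<_ ∣ E ∣ → P u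
    go {u} {E} 0≤E E≡ (acc rec) = by-descent (descent⊎identity u)
      where
      by-descent : ∃ (Descent u) ⊎ to u ≗ id → P u
      by-descent (inj₂ u≗id)          = base u u≗id
      by-descent (inj₁ (g , descent)) = step u g descent
        (go (energy≥0 (g • u)) refl (rec (∣∣-mono-< (energy≥0 (g • u)) 0≤E
          (subst (energy (g • u) <_) E≡ (energy-descends u g descent)))))

-- Words in the simple generators and the exchange condition

module _ {n : ℕ} where

  generate-equivariant : ∀ (g : Generator n) x t → generate g (x + t * + n) ≡ generate g x + t * + n
  generate-equivariant g x t = equivariant-* (generate g) (ExtendedPerm.equivariant (generateᵉ g)) x t

  evaluateᵉ : List (Generator n) → ExtendedPerm n
  evaluateᵉ []       = idᵉ
  evaluateᵉ (g ∷ gs) = composeᵉ (generateᵉ g) (evaluateᵉ gs)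

  fun-evaluateᵉ : ∀ gs → fun (evaluateᵉ gs) ≡ evaluate gs
  fun-evaluateᵉ []       = refl
  fun-evaluateᵉ (g ∷ gs) = cong (generate g ∘_) (fun-evaluateᵉ gs)

  evaluate-injective : ∀ gs {x y} → evaluate gs x ≡ evaluate gs y → x ≡ y
  evaluate-injective gs with evaluate gs | fun-evaluateᵉ gs
  ... | _ | refl = ExtendedPerm.injective (evaluateᵉ gs)

  evaluate-* : ∀ gs x t → evaluate gs (x + t * + n) ≡ evaluate gs x + t * + n
  evaluate-* gs with evaluate gs | fun-evaluateᵉ gs
  ... | _ | refl = equivariant-* (fun (evaluateᵉ gs)) (ExtendedPerm.equivariant (evaluateᵉ gs))

  evaluate-++ : ∀ (gs hs : List (Generator n)) x → evaluate (gs ++ hs) x ≡ evaluate gs (evaluate hs x)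
  evaluate-++ []       hs x = refl
  evaluate-++ (g ∷ gs) hs x = cong (generate g) (evaluate-++ gs hs x)

  -- The word carries `p` and `q` to neighbouring values that `g` exchanges, and by equivariance it
  -- does so for all translates. Hence it conjugates the reflection of positions into the simple
  -- reflection of values.
  reflect-positions : ∀ (g : Generator n) (gs : List (Generator n)) {p q} → p ≢ q [mod n ] → ∀ t₀ →
    evaluate gs p ≡ value g + t₀ * + n → evaluate gs q ≡ 1+ (evaluate gs p) →
    ∀ x → evaluate gs (transpose n p q x) ≡ generate g (evaluate gs x)
  reflect-positions g gs {p} {q} p≢q t₀ fp fq x =
    by-view (transpose-reflects n p q x)
    where
    f = evaluate gs
    k = value g
    fp+ : ∀ t → f (p + t * + n) ≡ k + t₀ * + n + t * + n
    fp+ t = trans (evaluate-* gs p t) (cong (_+ t * + n) fp)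
    fq+ : ∀ t → f (q + t * + n) ≡ 1+ k + t₀ * + n + t * + n
    fq+ t = trans (evaluate-* gs q t) (cong (_+ t * + n)
      (trans fq (trans (cong 1+ fp) (sym (+-assoc 1ℤ k (t₀ * + n))))))

    away-from : ∀ c y → f y ≡ c + t₀ * + n → ∀ {x} → x ≢ y [mod n ] → f x ≢ c [mod n ]
    away-from c y fy {x} x≢y t fx = x≢y (t - t₀) (evaluate-injective gs (begin
      f x  ≡⟨ fx ⟩
      c + t * + n  ≡⟨ cancel c t₀ t (+ n) ⟩
      c + t₀ * + n + (t - t₀) * + n  ≡⟨ cong (_+ (t - t₀) * + n) fy ⟨
      f y + (t - t₀) * + n  ≡⟨ evaluate-* gs y (t - t₀) ⟨
      f (y + (t - t₀) * + n)  ∎))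
      where
      cancel : ∀ c t₀ t n → c + t * n ≡ c + t₀ * n + (t - t₀) * n
      cancel = solve-∀

    by-view : ∀ {x y} → Reflects n p q x y → f y ≡ generate g (f x)
    by-view (at-p t) = begin
      f (q + t * + n)  ≡⟨ fq+ t ⟩
      1+ k + t₀ * + n + t * + n  ≡⟨ cong (_+ t * + n) (generate-value g t₀) ⟨
      generate g (k + t₀ * + n) + t * + n  ≡⟨ generate-equivariant g (k + t₀ * + n) t ⟨
      generate g (k + t₀ * + n + t * + n)  ≡⟨ cong (generate g) (fp+ t) ⟨
      generate g (f (p + t * + n))  ∎
    by-view (at-q t) = begin
      f (p + t * + n)  ≡⟨ fp+ t ⟩
      k + t₀ * + n + t * + n  ≡⟨ cong (_+ t * + n) (generate-suc-value g t₀) ⟨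
      generate g (1+ k + t₀ * + n) + t * + n  ≡⟨ generate-equivariant g (1+ k + t₀ * + n) t ⟨
      generate g (1+ k + t₀ * + n + t * + n)  ≡⟨ cong (generate g) (fq+ t) ⟨
      generate g (f (q + t * + n))  ∎
    by-view {x} (away x≢p x≢q) = sym (reflects-unique (value≢suc g) refl (generate-reflects g (f x))
      (away (away-from k p fp x≢p)
        (away-from (1+ k) q (trans fq (trans (cong 1+ fp) (sym (+-assoc 1ℤ k (t₀ * + n))))) x≢q)))

  -- On each residue class an equivariant map is a translation, which preserves order.
  inversion-incongruent : (f : ℤ → ℤ) → (∀ x t → f (x + t * + n) ≡ f x + t * + n) →
                          ∀ {p q} → p < q → f q < f p → q ≢ p [mod n ]
  inversion-incongruent f f-* {p} p<q fq<fp t refl = linear 3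
    (λ p a b → p :< p :+ a ∷ b :+ a :< b ∷ [] ⊢ :⊥) p (t * + n) (f p)
    p<q (subst (_< f p) (f-* p t) fq<fp)

  -- The strong exchange condition. Some letter of the word turns the values of `p` and `q` around.
  -- They are neighbours at that moment, so this letter acts there as the reflection of positions,
  -- and deleting it has the same effect as composing the word with that reflection.
  exchange : ∀ (gs : List (Generator n)) {p q} → p < q → evaluate gs q < evaluate gs p →
             ∃ λ (hs : List (Generator n)) → (∀ x → evaluate hs x ≡ evaluate gs (transpose n p q x)) ×
                      suc (length hs) ≡ length gs
  exchange [] p<q q<p = contradiction p<q (<-asym q<p)
  exchange (g ∷ gs) {p} {q} p<q gfq<gfp with <-cmp (evaluate gs p) (evaluate gs q)
  ... | tri≈ _ fp≡fq _ = contradiction (cong (generate g) (sym fp≡fq)) (<⇒≢ gfq<gfp)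
  ... | tri> _ _ fq<fp with hs , hs≗ , len ← exchange gs p<q fq<fp =
    g ∷ hs , (λ x → cong (generate g) (hs≗ x)) , cong suc len
  ... | tri< fp<fq _ _ with t₀ , fp , fq ← generate-inverts g fp<fq gfq<gfp =
    gs , (λ x → trans (sym (generate-involutive g (evaluate gs x)))
                  (cong (generate g) (sym (reflect-positions g gs p≢q t₀ fp fq x)))) , refl
    where
    p≢q = ≢[mod]-sym {n} {q} {p} (inversion-incongruent (evaluate (g ∷ gs)) (evaluate-* (g ∷ gs)) p<q gfq<gfp)

module _ {n : ℕ} .{{_ : NonZero n}} where

  -- Any word for `u` inverts the two positions of the descent. The exchange condition deletes one
  -- of its letters and leaves a word for `g • u`, which has at least `k` letters.
  descent-length : ∀ u g {k} → Descent u g → HasLength n (to (g • u)) k → HasLength n (to u) (suc k)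
  descent-length u g {k} descent L = record
    { expression = g ∷ L.expression
    ; evaluates  = λ x → trans (cong (generate g) (L.evaluates x)) (generate-involutive g (to u x))
    ; size       = cong suc L.size
    ; shortest   = shortest
    }
    where
    module L = HasLength L
    p = from u (1+ (value g))
    q = from u (value g)
    shortest : ∀ gs → evaluate gs ≗ to u → suc k ℕ.≤ length gs
    shortest gs gs≗u =
      subst (suc k ℕ.≤_) (proj₂ (proj₂ reduced)) (s≤s (L.shortest (proj₁ reduced) reduced≗su))
      where
      gsp : evaluate gs p ≡ 1+ (value g)
      gsp = trans (gs≗u p) (to-from u (1+ (value g)))
      gsq : evaluate gs q ≡ value g
      gsq = trans (gs≗u q) (to-from u (value g))
      inverted : evaluate gs q < evaluate gs p
      inverted = subst₂ _<_ (sym gsq) (sym gsp) (i<suc[i] (value g))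
      q≢p : q ≢ p [mod n ]
      q≢p = inversion-incongruent (evaluate gs) (evaluate-* gs) descent inverted
      reduced : ∃ λ (hs : List (Generator n)) → (∀ x → evaluate hs x ≡ evaluate gs (transpose n p q x)) × suc (length hs) ≡ length gs
      reduced = exchange gs descent inverted
      -- `exchange` names the positions from left to right, whereas `reflect-positions` wants the
      -- position of the smaller value first, which here is the right one. Hence the reflection is
      -- swapped.
      reduced≗su : ∀ x → evaluate (proj₁ reduced) x ≡ generate g (to u x)
      reduced≗su x = trans (proj₁ (proj₂ reduced) x) (trans (cong (evaluate gs) (reflects-unique (≢[mod]-sym {n} {q} {p} q≢p) refl
          (transpose-reflects n p q x) (reflects-swap (transpose-reflects n q p x))))
        (trans (reflect-positions g gs q≢p 0ℤ (trans gsq (sym (+-identityʳ (value g))))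
                 (trans gsp (cong 1+ (sym gsq))) x)
               (cong (generate g) (gs≗u x))))

  length-exists : ∀ u → ∃ (HasLength n (to u))
  length-exists = descent-induction (λ u → ∃ (HasLength n (to u)))
    (λ u u≗id → 0 , record { expression = [] ; evaluates = λ x → sym (u≗id x) ; size = refl
                           ; shortest = λ _ _ → z≤n })
    (λ u g descent (k , L) → suc k , descent-length u g descent L)

  descent-≤L : ∀ u g → Descent u g → g • u ≤L u
  descent-≤L u g descent = compare (length-exists (g • u))
    where
    quotient : ∀ y → generate g y ≡ to u (from (g • u) y)
    quotient y = sym (to-from u (generate g y))

    fixes-value : evaluate {n} [] ≗ to u ∘ from (g • u) → value g ≡ generate g (value g)
    fixes-value eq = trans (eq (value g)) (to-from u (generate g (value g)))

    shortest : ∀ gs → evaluate gs ≗ to u ∘ from (g • u) → 1 ℕ.≤ length gs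
    shortest (_ ∷ _) _  = s≤s z≤n
    shortest []      eq = contradiction (trans (fixes-value eq) (generate-value₀ g))
      (<⇒≢ {value g} (i<suc[i] (value g)))

    length-quotient : HasLength n (to u ∘ from (g • u)) 1
    length-quotient = record
      { expression = [ g ] ; evaluates = quotient ; size = refl ; shortest = shortest }

    compare : ∃ (HasLength n (to (g • u))) → g • u ≤L u
    compare (k , L) = record
      { length-x    = L
      ; length-y    = descent-length u g descent L
      ; length-yx⁻¹ = length-quotient
      ; difference  = linear 1 (λ k → [] ⊢ κ 1ℤ :≡ :1+ k :- k) (+ k)
      }

  -- Were an inversion of u lost in u′, then cancelling it both in a reduced
  -- word of u and in the word of u′ would leave a word of u′ that is too short.
  ≤L-inversion : ∀ {u u′} → u ≤L u′ → ∀ {i j} → i < j → to u j < to u i → to u′ j < to u′ i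
  ≤L-inversion {u} {u′} u≤u′ {i} {j} i<j uj<ui with <-cmp (to u′ i) (to u′ j)
  ... | tri> _ _ u′j<u′i = u′j<u′i
  ... | tri≈ _ eq _ = contradiction (to-injective u′ eq) (<⇒≢ i<j)
  ... | tri< u′i<u′j _ _ = contradiction (Ly.shortest ks ks≗u′) (ℕ.<⇒≱ shorter)
    where
    open _≤L_ u≤u′
    module Lx = HasLength length-x
    module Ly = HasLength length-y
    module Lz = HasLength length-yx⁻¹
    j≢i : j ≢ i [mod n ]
    j≢i = inversion-incongruent (to u) (to-* u) i<j uj<ui
    τ = transpose n i j
    i≢j = ≢[mod]-sym {n} {j} {i} j≢i
    τ-view = transpose-reflects n i j
    at-0 : ∀ x → x ≡ x + 0ℤ * + n
    at-0 x = sym (+-identityʳ x)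
    τi : τ i ≡ j
    τi = trans (reflects-unique i≢j (at-0 i) (τ-view i) (at-p 0ℤ)) (sym (at-0 j))
    τj : τ j ≡ i
    τj = trans (reflects-unique i≢j (at-0 j) (τ-view j) (at-q 0ℤ)) (sym (at-0 i))

    reduced : ∃ λ (hs : List (Generator n)) → (∀ x → evaluate hs x ≡ evaluate Lx.expression (τ x)) ×
                       suc (length hs) ≡ length Lx.expression
    reduced = exchange Lx.expression i<j
      (subst₂ _<_ (sym (Lx.evaluates j)) (sym (Lx.evaluates i)) uj<ui)
    hs = proj₁ reduced

    word = Lz.expression ++ hs
    word≗ : ∀ x → evaluate word x ≡ to u′ (τ x)
    word≗ x = begin
      evaluate word x  ≡⟨ evaluate-++ Lz.expression hs x ⟩
      evaluate Lz.expression (evaluate hs x)  ≡⟨ Lz.evaluates _ ⟩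
      to u′ (from u (evaluate hs x))  ≡⟨ cong (to u′ ∘ from u) (proj₁ (proj₂ reduced) x) ⟩
      to u′ (from u (evaluate Lx.expression (τ x))) ≡⟨ cong (to u′ ∘ from u) (Lx.evaluates (τ x)) ⟩
      to u′ (from u (to u (τ x)))  ≡⟨ cong (to u′) (from-to u (τ x)) ⟩
      to u′ (τ x)  ∎

    reduced² : ∃ λ (ks : List (Generator n)) → (∀ x → evaluate ks x ≡ evaluate word (τ x)) × suc (length ks) ≡ length word
    reduced² = exchange word i<j (subst₂ _<_
      (sym (trans (word≗ j) (cong (to u′) τj))) (sym (trans (word≗ i) (cong (to u′) τi))) u′i<u′j)
    ks = proj₁ reduced²

    ks≗u′ : evaluate ks ≗ to u′
    ks≗u′ x = trans (proj₁ (proj₂ reduced²) x) (trans (word≗ (τ x))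
      (cong (to u′) (ExtendedPerm.fun-inv (reflectionᵉ i≢j τ τ-view) x)))

    shorter : length ks ℕ.< ℓy
    shorter = drop‿+<+ (linear 5
      (λ x y z h k → κ 1ℤ :+ k :≡ z :+ h ∷ z :≡ y :- x ∷ :1+ h :≡ x ∷ [] ⊢ k :< y)
      (+ ℓx) (+ ℓy) (+ ℓyx⁻¹) (+ length hs) (+ length ks)
      (cong +_ (trans (proj₂ (proj₂ reduced²)) (trans (List.length-++ Lz.expression)
        (cong (ℕ._+ length hs) Lz.size))))
      difference
      (cong +_ (trans (proj₂ (proj₂ reduced)) Lx.size)))

-- The minimal element of an affine sylvester class

-- For `i < j` and injective `w`, `Dominates` puts the node at `j` into the right subtree of the
-- node at `i`, and `Dominatedˡ` puts the node at `i` into the left subtree of the node at `j`.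
-- Together they determine the order `≼[ w ]`.
Dominates : (ℤ → ℤ) → ℤ → ℤ → Set
Dominates w i j = ∀ k → i < k → k ≤ j → w k < w i

Dominatedˡ : (ℤ → ℤ) → ℤ → ℤ → Set
Dominatedˡ w i j = ∀ k → i ≤ k → k < j → w k < w j

-- The permutation u sends a position of w to the rank, in the postorder of
-- the decreasing tree of w, of the node at that position.
record Postorder (w u : ℤ → ℤ) : Set where
  field
    dominated : ∀ {i j} → i < j → u j < u i → Dominates w i j
    inverted  : ∀ {i j} → i < j → Dominates w i j → u j < u i

postorder-cong : ∀ {w u u′} → u ≗ u′ → Postorder w u → Postorder w u′
postorder-cong {w} {u} {u′} u≗u′ post = record
  { dominated = λ {i} {j} i<j lt →
      Postorder.dominated post i<j (subst₂ _<_ (sym (u≗u′ j)) (sym (u≗u′ i)) lt)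
  ; inverted  = λ {i} {j} i<j dom → subst₂ _<_ (u≗u′ j) (u≗u′ i) (Postorder.inverted post i<j dom)
  }

module _ {n : ℕ} (w : AffinePerm n) where

  ≮⇒> : ∀ {i j} → i ≢ j → ¬ (to w i < to w j) → to w j < to w i
  ≮⇒> i≢j ≮ = ≤∧≢⇒< (≮⇒≥ ≮) (λ eq → i≢j (sym (to-injective w eq)))

  incomparable-sym : ∀ i j → Incomparable w j i → Incomparable w i j
  incomparable-sym i j (k , lo , hi , above) = k , subst (_< k) (ℤ.⊓-comm j i) lo ,
    subst (k <_) (ℤ.⊔-comm j i) hi , subst (_< to w k) (ℤ.⊔-comm (to w j) (to w i)) above

  module _ {i j : ℤ} (i<j : i < j) where

    private
      i≢j = <⇒≢ i<j
      minimum : i ℤ.⊓ j ≡ i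
      minimum = ℤ.i≤j⇒i⊓j≡i (<⇒≤ i<j)
      maximum : i ℤ.⊔ j ≡ j
      maximum = ℤ.i≤j⇒i⊔j≡j (<⇒≤ i<j)

    incomparable : ∀ k → i < k → k < j → to w i < to w k → to w j < to w k →
                   Incomparable w i j
    incomparable k i<k k<j wi<wk wj<wk =
      k , subst (_< k) (sym minimum) i<k , subst (k <_) (sym maximum) k<j , ⊔-< (ℤ.⊔-sel (to w i) (to w j))
      where
      ⊔-< : to w i ℤ.⊔ to w j ≡ to w i ⊎ to w i ℤ.⊔ to w j ≡ to w j → to w i ℤ.⊔ to w j < to w k
      ⊔-< (inj₁ eq) = subst (_< to w k) (sym eq) wi<wk
      ⊔-< (inj₂ eq) = subst (_< to w k) (sym eq) wj<wk

    incomparable⁻ : Incomparable w i j →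
                    ∃ λ k → i < k × k < j × to w i < to w k × to w j < to w k
    incomparable⁻ (k , lo , hi , above) =
      k , subst (_< k) minimum lo , subst (k <_) maximum hi ,
      ≤-<-trans (ℤ.i≤i⊔j (to w i) (to w j)) above , ≤-<-trans (ℤ.i≤j⊔i (to w i) (to w j)) above

    ≼⇒dominates : j ≼[ w ] i → Dominates (to w) i j
    ≼⇒dominates (comparable , wj≤wi) k i<k k≤j with ≤⇒<⊎≡ k≤j
    ... | inj₂ refl = ≤∧≢⇒< wj≤wi (λ eq → i≢j (sym (to-injective w eq)))
    ... | inj₁ k<j with to w k <? to w i
    ...   | yes lt = lt
    ...   | no  ≮  = contradiction
      (incomparable-sym j i (incomparable k i<k k<j wi<wk (≤-<-trans wj≤wi wi<wk))) comparable
      where wi<wk = ≮⇒> (λ eq → <⇒≢ i<k (sym eq)) ≮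

    dominates⇒≼ : Dominates (to w) i j → j ≼[ w ] i
    dominates⇒≼ dom = comparable , <⇒≤ (dom j i<j ≤-refl)
      where
      comparable : ¬ Incomparable w j i
      comparable inc with k , i<k , k<j , wi<wk , _ ← incomparable⁻ (incomparable-sym i j inc) =
        <-asym wi<wk (dom k i<k (<⇒≤ k<j))

    ≼⇒dominatedˡ : i ≼[ w ] j → Dominatedˡ (to w) i j
    ≼⇒dominatedˡ (comparable , wi≤wj) k i≤k k<j with ≤⇒<⊎≡ i≤k
    ... | inj₂ refl = ≤∧≢⇒< wi≤wj (λ eq → i≢j (to-injective w eq))
    ... | inj₁ i<k with to w k <? to w j
    ...   | yes lt = lt
    ...   | no  ≮  = contradiction
      (incomparable k i<k k<j (≤-<-trans wi≤wj wj<wk) wj<wk) comparable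
      where wj<wk = ≮⇒> (<⇒≢ k<j) ≮

    dominatedˡ⇒≼ : Dominatedˡ (to w) i j → i ≼[ w ] j
    dominatedˡ⇒≼ dom = comparable , <⇒≤ (dom i ≤-refl i<j)
      where
      comparable : ¬ Incomparable w i j
      comparable inc with k , i<k , k<j , _ , wj<wk ← incomparable⁻ inc =
        <-asym wj<wk (dom k (<⇒≤ i<k) k<j)

  ≼-refl : ∀ i → i ≼[ w ] i
  ≼-refl i = (λ (k , lo , hi , _) → <-asym (subst (_< k) (ℤ.⊓-idem i) lo)
               (subst (k <_) (ℤ.⊔-idem i) hi)) , ≤-refl

module _ {n : ℕ} where

  syl-congruence : ∀ {v w : AffinePerm n} →
    (∀ {i j} → i < j → Dominates (to v) i j → Dominates (to w) i j) →
    (∀ {i j} → i < j → Dominates (to w) i j → Dominates (to v) i j) →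
    (∀ {i j} → i < j → Dominatedˡ (to v) i j → Dominatedˡ (to w) i j) →
    (∀ {i j} → i < j → Dominatedˡ (to w) i j → Dominatedˡ (to v) i j) → v ≡syl w
  syl-congruence {v} {w} dom dom⁻ domˡ domˡ⁻ i j with <-cmp i j
  ... | tri< i<j _ _  = mk⇔ (dominatedˡ⇒≼ w i<j ∘ domˡ i<j ∘ ≼⇒dominatedˡ v i<j)
                            (dominatedˡ⇒≼ v i<j ∘ domˡ⁻ i<j ∘ ≼⇒dominatedˡ w i<j)
  ... | tri≈ _ refl _ = mk⇔ (λ _ → ≼-refl w i) (λ _ → ≼-refl v i)
  ... | tri> _ _ j<i  = mk⇔ (dominates⇒≼ w j<i ∘ dom j<i ∘ ≼⇒dominates v j<i)
                            (dominates⇒≼ v j<i ∘ dom⁻ j<i ∘ ≼⇒dominates w j<i)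

  syl-sym-trans : ∀ {u v w : AffinePerm n} → u ≡syl v → v ≡syl w → u ≡syl w
  syl-sym-trans u≡v v≡w i j = mk⇔
    (Equivalence.to (v≡w i j) ∘ Equivalence.to (u≡v i j))
    (Equivalence.from (u≡v i j) ∘ Equivalence.from (v≡w i j))

module _ {n : ℕ} .{{_ : NonZero n}} where

  -- For minimality: the inversions of `u` are forced on every member `u′` of the class by the order
  -- of the tree, while `u′ ≤L u` allows `u′` no others. So `u` composed with the inverse of `u′` is
  -- increasing, hence the identity.
  postorder⇒isπ↓ : ∀ {u w : AffinePerm n} → Postorder (to w) (to u) → u isπ↓ w
  postorder⇒isπ↓ {u} {w} post = record { congruent = congruent ; minimal = minimal }
    where
    open Postorder post

    congruent : u ≡syl w
    congruent = syl-congruence {v = u} {w}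
      (λ i<j dom → dominated i<j (dom _ i<j ≤-refl))
      (λ i<j dom k i<k k≤j → inverted i<k (λ l i<l l≤k → dom l i<l (≤-trans l≤k k≤j)))
      dominatedˡ-w
      (λ i<j dom k i≤k k<j → ≮⇒> u (λ eq → <⇒≢ k<j (sym eq))
        (λ uj<uk → <-asym (dom k i≤k k<j) (dominated k<j uj<uk _ k<j ≤-refl)))
      where
      -- A maximal entry of w before position j that exceeds w(j) would dominate j.
      dominatedˡ-w : ∀ {i j} → i < j → Dominatedˡ (to u) i j → Dominatedˡ (to w) i j
      dominatedˡ-w {i} {j} i<j dom k i≤k k<j = by-max (argmax (to w) i<j)
        where
        by-max : MaximumIn (to w) i j → to w k < to w j
        by-max (m , i≤m , m<j , max) = by-order (to w m <? to w j)
          where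
          dominates : ¬ (to w m < to w j) → Dominates (to w) m j
          dominates ≮ l m<l l≤j with ≤⇒<⊎≡ l≤j
          ... | inj₂ refl = ≮⇒> w (<⇒≢ m<j) ≮
          ... | inj₁ l<j  = ≤∧≢⇒< (max l (<⇒≤ (≤-<-trans i≤m m<l)) l<j)
            (λ eq → <⇒≢ m<l (sym (to-injective w eq)))

          by-order : Dec (to w m < to w j) → to w k < to w j
          by-order (yes wm<wj) = ≤-<-trans (max k i≤k k<j) wm<wj
          by-order (no ≮)      = contradiction (dom m i≤m m<j) (<-asym (inverted m<j (dominates ≮)))

    minimal : ∀ u′ → u′ ≡syl w → u′ ≤L u → u′ ≈ u
    minimal u′ u′≡w u′≤u x = sym (trans
      (cong (to u) (sym (from-to u′ x)))
      (increasing⇒identity (compose n u (invert n u′)) (λ {i} {j} i<j → monotone (from u′ i) (from u′ j)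
        (subst₂ _<_ (sym (to-from u′ i)) (sym (to-from u′ j)) i<j)) (to u′ x)))
      where
      monotone : ∀ a b → to u′ a < to u′ b → to u a < to u b
      monotone a b u′a<u′b with <-cmp a b
      ... | tri≈ _ refl _ = contradiction u′a<u′b (<-irrefl refl)
      ... | tri> _ _ b<a  = ≤L-inversion {u = u′} {u} u′≤u b<a u′a<u′b
      ... | tri< a<b _ _  = ≮⇒> u (λ eq → <⇒≢ a<b (sym eq)) λ ub<ua →
        contradiction u′a<u′b (≤⇒≯ (proj₂ (Equivalence.from (u′≡w b a)
          (dominates⇒≼ w a<b (dominated a<b ub<ua)))))

  -- Exchanging neighbouring values affects the relative order of the translates of `a` and `b`
  -- only. The tree sees neither order of these two, because the larger entry at `c` separates their
  -- positions.
  exchange-congruent : ∀ u g {a b c} → to u a ≡ 1+ (value g) → to u b ≡ value g →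
                       a < c → c < b → to u a < to u c → g • u ≡syl u
  exchange-congruent u g {a} {b} {c} ua ub a<c c<b ua<uc =
    syl-congruence {v = g • u} {u} dominates dominates⁻ dominatedˡ dominatedˡ⁻
    where
    s = generate g

    a<c+ : ∀ t → a + t * + n < c + t * + n
    a<c+ t = +-monoˡ-< (t * + n) a<c
    c<b+ : ∀ t → c + t * + n < b + t * + n
    c<b+ t = +-monoˡ-< (t * + n) c<b
    a<b+ : ∀ t → a + t * + n < b + t * + n
    a<b+ t = <-trans (a<c+ t) (c<b+ t)
    ua<uc+ : ∀ t → to u (a + t * + n) < to u (c + t * + n)
    ua<uc+ t = subst₂ _<_ (sym (to-* u a t)) (sym (to-* u c t)) (+-monoˡ-< (t * + n) ua<uc)
    ub<ua : to u b < to u a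
    ub<ua = subst₂ _<_ (sym ub) (sym ua) (i<suc[i] (value g))

    ub<ua+ : ∀ t → to u (b + t * + n) < to u (a + t * + n)
    ub<ua+ t = subst₂ _<_ (sym (to-* u b t)) (sym (to-* u a t)) (+-monoˡ-< (t * + n) ub<ua)

    position-b : ∀ {x} t → to u x ≡ value g + t * + n → x ≡ b + t * + n
    position-b t eq = to-injective u (trans eq (trans (cong (_+ t * + n) (sym ub)) (sym (to-* u b t))))
    position-a : ∀ {x} t → to u x ≡ 1+ (value g) + t * + n → x ≡ a + t * + n
    position-a t eq = to-injective u (trans eq (trans (cong (_+ t * + n) (sym ua)) (sym (to-* u a t))))

    suc-assoc : ∀ t → 1+ (value g + t * + n) ≡ 1+ (value g) + t * + n
    suc-assoc t = sym (+-assoc 1ℤ (value g) (t * + n))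

    -- Only values `value g` and `1+ (value g)`, up to translation, can be turned around by `s`, and
    -- they stand at the translates of `b` and `a`.
    exchanged : ∀ {x y} → to u x < to u y →
                ¬ (∃ λ t → x ≡ b + t * + n × y ≡ a + t * + n) → s (to u x) < s (to u y)
    exchanged {x} {y} ux<uy ¬pair = ≮⇒> (g • u) (λ eq → <⇒≢ ux<uy (cong (to u) (sym eq))) not
      where
      adjacent : (∃ λ t → to u x ≡ value g + t * + n × to u y ≡ 1+ (to u x)) → ⊥
      adjacent (t , ux , uy) =
        ¬pair (t , position-b t ux , position-a t (trans uy (trans (cong 1+ ux) (suc-assoc t))))
      not : ¬ (s (to u y) < s (to u x))
      not lt = adjacent (generate-inverts g ux<uy lt)

    reflected : ∀ {x y} → s (to u x) < s (to u y) →
                ¬ (∃ λ t → x ≡ a + t * + n × y ≡ b + t * + n) → to u x < to u y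
    reflected {x} {y} sux<suy ¬pair = ≮⇒> u (λ eq → <⇒≢ sux<suy (cong (s ∘ to u) (sym eq))) not
      where
      flip : ∀ {x y} → s x ≡ y → x ≡ s y
      flip {x} eq = trans (sym (generate-involutive g x)) (cong s eq)
      adjacent : (∃ λ t → s (to u x) ≡ value g + t * + n × s (to u y) ≡ 1+ (s (to u x))) → ⊥
      adjacent (t , sux , suy) = ¬pair
        (t , position-a t (trans (flip sux) (generate-value g t)) ,
             position-b t (trans (flip (trans suy (trans (cong 1+ sux) (suc-assoc t))))
               (generate-suc-value g t)))
      not : ¬ (to u y < to u x)
      not lt = adjacent (generate-inverts g sux<suy
        (subst₂ _<_ (sym (generate-involutive g (to u y))) (sym (generate-involutive g (to u x))) lt))

    sub<suc+ : ∀ t → s (to u (b + t * + n)) < s (to u (c + t * + n))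
    sub<suc+ t = exchanged (<-trans (ub<ua+ t) (ua<uc+ t)) λ (t′ , b≡ , c≡) → <⇒≢ a<c (linear 5
        (λ a b c x y → b :+ x :≡ b :+ y ∷ a :+ y :≡ c :+ x ∷ [] ⊢ a :≡ c)
        a b c (t * + n) (t′ * + n) b≡ (sym c≡))

    dominates : ∀ {i j} → i < j → Dominates (s ∘ to u) i j → Dominates (to u) i j
    dominates {i} {j} i<j dom k i<k k≤j = reflected (dom k i<k k≤j) λ (t , k≡ , i≡) →
      <-asym i<k (subst₂ _<_ (sym k≡) (sym i≡) (a<b+ t))

    dominatedˡ⁻ : ∀ {i j} → i < j → Dominatedˡ (to u) i j → Dominatedˡ (s ∘ to u) i j
    dominatedˡ⁻ {i} {j} i<j dom k i≤k k<j = exchanged (dom k i≤k k<j) λ (t , k≡ , j≡) →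
      <-asym k<j (subst₂ _<_ (sym j≡) (sym k≡) (a<b+ t))

    dominates⁻ : ∀ {i j} → i < j → Dominates (to u) i j → Dominates (s ∘ to u) i j
    dominates⁻ {i} {j} i<j dom k i<k k≤j = exchanged (dom k i<k k≤j) not
      where
      not : ¬ (∃ λ t → k ≡ b + t * + n × i ≡ a + t * + n)
      not (t , k≡ , i≡) = <-asym
        (dom (c + t * + n) (subst (_< c + t * + n) (sym i≡) (a<c+ t))
          (≤-trans (<⇒≤ (subst (c + t * + n <_) (sym k≡) (c<b+ t))) k≤j))
        (subst (λ i → to u i < to u (c + t * + n)) (sym i≡) (ua<uc+ t))

    dominatedˡ : ∀ {i j} → i < j → Dominatedˡ (s ∘ to u) i j → Dominatedˡ (to u) i j
    dominatedˡ {i} {j} i<j dom k i≤k k<j = reflected (dom k i≤k k<j) not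
      where
      not : ¬ (∃ λ t → k ≡ a + t * + n × j ≡ b + t * + n)
      not (t , k≡ , j≡) = <-asym
        (dom (c + t * + n)
          (≤-trans i≤k (<⇒≤ (subst (_< c + t * + n) (sym k≡) (a<c+ t))))
          (subst (c + t * + n <_) (sym j≡) (c<b+ t)))
        (subst (λ j → s (to u j) < s (to u (c + t * + n))) (sym j≡) (sub<suc+ t))

  isπ↓⇒postorder : ∀ {u w : AffinePerm n} → u isπ↓ w → Postorder (to w) (to u)
  isπ↓⇒postorder {u} {w} π = record { dominated = dominated ; inverted = inverted }
    where
    open _isπ↓_ π

    inverted : ∀ {i j} → i < j → Dominates (to w) i j → to u j < to u i
    inverted {i} {j} i<j dom = ≤∧≢⇒<
      (proj₂ (Equivalence.from (congruent j i) (dominates⇒≼ w i<j dom)))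
      (λ eq → <⇒≢ i<j (sym (to-injective u eq)))

    -- Between u(j) and u(i) there are adjacent values on different sides of
    -- k; exchanging them gives a smaller element of the class.
    no-obstacle : ∀ {i j k} → i < k → k < j → to u j < to u i → ¬ (to u i < to u k)
    no-obstacle {i} {j} {k} i<k k<j uj<ui ui<uk =
      by-last (greatest (λ y → k <? from u y) (to u j) (to u i))
      where
      After : ℤ → Set
      After y = k < from u y
      by-last : GreatestIn After (to u j) (to u i) ⊎ NoneIn After (to u j) (to u i) → ⊥
      by-last (inj₂ none) = none (to u j) ≤-refl uj<ui (subst (k <_) (sym (from-to u j)) k<j)
      by-last (inj₁ (y , uj≤y , y<ui , k<fy , above)) = by-descent (descent-at u (<-trans f[1+y]<k k<fy))
       where
       f[1+y]<k : from u (1+ y) < k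
       f[1+y]<k with ≤⇒<⊎≡ (i<j⇒suc[i]≤j y<ui)
       ... | inj₂ eq      = subst (_< k) (sym (trans (cong (from u) eq) (from-to u i))) i<k
       ... | inj₁ 1+y<ui = ≤∧≢⇒< (≮⇒≥ (above (1+ y) (i<suc[i] y) 1+y<ui))
         (λ eq → <⇒≢ (<-trans 1+y<ui ui<uk) (trans (sym (to-from u (1+ y))) (cong (to u) eq)))

       by-descent : (∃ λ g → Descent u g × ∃ λ t → y ≡ value g + t * + n) → ⊥
       by-descent (g , descent , t , y≡) = <⇒≢ (i<suc[i] (value g)) (begin
         value g  ≡⟨ to-from u (value g) ⟨
         to u (from u (value g))  ≡⟨ minimal (g • u) g•u≡w (descent-≤L u g descent) (from u (value g)) ⟨
         generate g (to u (from u (value g))) ≡⟨ cong (generate g) (to-from u (value g)) ⟩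
         generate g (value g)  ≡⟨ generate-value₀ g ⟩
         1+ (value g)  ∎)
         where
         a = t * + n
         -- The generator `g` names the translate of the descent by `- t` periods, so the separating
         -- position `k` is moved along with it.
         c = k + (- t) * + n
         -a : (- t) * + n ≡ 0ℤ - a
         -a = sym (trans (+-identityˡ (- a)) (neg-distribˡ-* t (+ n)))

         f[1+y]≡ : from u (1+ y) ≡ from u (1+ (value g)) + a
         f[1+y]≡ = trans (cong (from u) (trans (cong 1+ y≡) (sym (+-assoc 1ℤ (value g) a))))
           (from-* u (1+ (value g)) t)

         fy≡ : from u y ≡ from u (value g) + a
         fy≡ = trans (cong (from u) y≡) (from-* u (value g) t)

         left : from u (1+ (value g)) < c
         left = subst (from u (1+ (value g)) <_) (cong (λ x → k + x) (sym -a))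
           (linear 3 (λ p a k → p :+ a :< k ∷ [] ⊢ p :< k :+ (κ 0ℤ :- a)) _ a k
             (subst (_< k) f[1+y]≡ f[1+y]<k))

         right : c < from u (value g)
         right = subst (_< from u (value g)) (cong (λ x → k + x) (sym -a))
           (linear 3 (λ p a k → k :< p :+ a ∷ [] ⊢ k :+ (κ 0ℤ :- a) :< p) _ a k
             (subst (k <_) fy≡ k<fy))

         larger : to u (from u (1+ (value g))) < to u c
         larger = subst₂ _<_ (sym (to-from u (1+ (value g))))
           (sym (trans (to-* u k (- t)) (cong (λ x → to u k + x) -a)))
           (linear 5 (λ v a y ui uk → v :+ a :≡ y ∷ y :< ui ∷ ui :< uk ∷ [] ⊢ :1+ v :< uk :+ (κ 0ℤ :- a))
             (value g) a y (to u i) (to u k) (sym y≡) y<ui ui<uk)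

         g•u≡w : (g • u) ≡syl w
         g•u≡w = syl-sym-trans {u = g • u} {u} {w}
           (exchange-congruent u g (to-from u (1+ (value g))) (to-from u (value g)) left right larger)
           congruent

    dominated : ∀ {i j} → i < j → to u j < to u i → Dominates (to w) i j
    dominated {i} {j} i<j uj<ui = ≼⇒dominates w i<j (Equivalence.to (congruent j i) (dominates⇒≼ u i<j dom))
      where
      dom : Dominates (to u) i j
      dom k i<k k≤j with ≤⇒<⊎≡ k≤j
      ... | inj₂ refl = uj<ui
      ... | inj₁ k<j  = ≮⇒> u (<⇒≢ i<k) (no-obstacle i<k k<j uj<ui)

  -- Cuts that no inversion crosses

  NoInversionAcross : ℤ → AffinePerm n → Set
  NoInversionAcross p u = ∀ {i j} → i < p → p ≤ j → to u i < to u j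

  Preserves : ℤ → (ℤ → ℤ) → Set
  Preserves p f = (∀ {i} → i < p → f i < p) × (∀ {i} → p ≤ i → p ≤ f i)

  private
    preserves-step : ∀ p u g → Descent u g → NoInversionAcross p u →
                     (NoInversionAcross p (g • u) → Preserves p (to (g • u))) → Preserves p (to u)
    preserves-step p u g descent straight IH =
      (λ {i} i<p → subst (_< p) (generate-involutive g (to u i)) (below (proj₁ preserved i<p))) ,
      (λ {j} p≤j → subst (p ≤_) (generate-involutive g (to u j)) (above (proj₂ preserved p≤j)))
      where
      s = generate g

      straight′ : NoInversionAcross p (g • u)
      straight′ {i} {j} i<p p≤j = ≮⇒> (g • u) (λ eq → <⇒≢ (<-≤-trans i<p p≤j) (sym eq))
        λ lt → inverted (generate-inverts g (straight i<p p≤j) lt)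
        where
        inverted : (∃ λ t → to u i ≡ value g + t * + n × to u j ≡ 1+ (to u i)) → ⊥
        inverted (t , ui , uj) = <-asym (<-≤-trans i<p p≤j) (subst₂ _<_
          (trans (cong (from u) (trans (cong 1+ (sym ui)) (sym uj))) (from-to u j))
          (trans (cong (from u) (sym ui)) (from-to u i))
          (descent-translate u g descent t))

      preserved = IH straight′

      position<p : ∀ {x} → x < p → from u (s x) < p
      position<p {x} x<p = ≰⇒> λ p≤i → <⇒≱ x<p
        (subst (p ≤_) (to-from (g • u) x) (proj₂ preserved p≤i))

      p≤position : ∀ {x} → p ≤ x → p ≤ from u (s x)
      p≤position {x} p≤x = ≮⇒≥ λ i<p → <⇒≱
        (subst (_< p) (to-from (g • u) x) (proj₁ preserved i<p)) p≤x

      -- `from u (s x)` is the position of `x` in `g • u`, which lies on the same side of `p` as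
      -- `x`. So `s` inherits from `u` that no inversion crosses the cut.
      s-straight : ∀ {x y} → x < p → p ≤ y → s x < s y
      s-straight {x} {y} x<p p≤y = subst₂ _<_ (to-from u (s x)) (to-from u (s y))
        (straight (position<p x<p) (p≤position p≤y))

      -- An involution that carried `x` across the cut would invert the pair `x`, `s x`.
      below : ∀ {x} → x < p → s x < p
      below {x} x<p = ≰⇒> λ p≤sx → <-asym (<-≤-trans x<p p≤sx)
        (subst (s x <_) (generate-involutive g x) (s-straight x<p p≤sx))

      above : ∀ {y} → p ≤ y → p ≤ s y
      above {y} p≤y = ≮⇒≥ λ sy<p → <-asym (<-≤-trans sy<p p≤y)
        (subst (_< s y) (generate-involutive g y) (s-straight sy<p p≤y))

  -- Order across the cut alone would also hold for a translation; what excludes drift is that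
  -- removing descents ends at the identity. Removing a descent keeps the cut free of inversions,
  -- and the removed generator itself then preserves the cut.
  no-inversion-across⇒preserves : ∀ p u → NoInversionAcross p u → Preserves p (to u)
  no-inversion-across⇒preserves p = descent-induction (λ u → NoInversionAcross p u → Preserves p (to u))
    (λ u u≗id _ → (λ {i} i<p → subst (_< p) (sym (u≗id i)) i<p) ,
                  (λ {i} p≤i → subst (p ≤_) (sym (u≗id i)) p≤i))
    (λ u g descent IH straight → preserves-step p u g descent straight IH)

  sorts⇒postorder : ∀ (v w : AffinePerm n) → AffineStackSortsTo w v → Postorder (to w) (from v ∘ to w)
  sorts⇒postorder v w (u , π , v≗) =
    postorder-cong {to w} {to u} {from v ∘ to w} position (isπ↓⇒postorder {u} {w} π)
    where
    position : ∀ i → to u i ≡ from v (to w i)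
    position i = begin
      to u i  ≡⟨ from-to v (to u i) ⟨
      from v (to v (to u i))  ≡⟨ cong (from v) (v≗ (to u i)) ⟩
      from v (to w (from u (to u i)))  ≡⟨ cong (λ j → from v (to w j)) (from-to u i) ⟩
      from v (to w i)  ∎

  postorder⇒sorts : ∀ (v w : AffinePerm n) → Postorder (to w) (from v ∘ to w) → AffineStackSortsTo w v
  postorder⇒sorts v w post = u , minimal , v≗
    where
    u : AffinePerm n
    u = compose n (invert n v) w
    minimal : u isπ↓ w
    minimal = postorder⇒isπ↓ {u} {w} post
    v≗ : to v ≗ to w ∘ from u
    v≗ i = sym (to-from w (to v i))

-- The stack-sorting map on an interval of positions

private
  run : ℤ → ℕ → List ℤ
  run a zero    = []
  run a (suc p) = 1+ a ∷ run (1+ a) p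

  between-run : ∀ a p → between a (1+ a + + p) ≡ run a p
  between-run a p = trans (cong (λ k → map (λ k → 1+ a + + k) (upTo k)) length≡)
    (trans (List.map-applyUpTo id (λ k → 1+ a + + k) p) (applied a p))
    where
    length≡ : ∣ 1+ a + + p - 1+ a ∣ ≡ p
    length≡ = cong ∣_∣ (linear 2 (λ a p → [] ⊢ :1+ a :+ p :- :1+ a :≡ p) a (+ p))

    applyUpTo-cong : ∀ {f g : ℕ → ℤ} p → (∀ k → f k ≡ g k) → applyUpTo f p ≡ applyUpTo g p
    applyUpTo-cong zero    f≗g = refl
    applyUpTo-cong (suc p) f≗g = cong₂ _∷_ (f≗g 0) (applyUpTo-cong p (f≗g ∘ suc))

    applied : ∀ a p → applyUpTo (λ k → 1+ a + + k) p ≡ run a p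
    applied a zero    = refl
    applied a (suc p) = cong₂ _∷_ (+-identityʳ (1+ a)) (trans
      (applyUpTo-cong p (λ k → linear 2 (λ a k → [] ⊢ :1+ a :+ :1+ k :≡ :1+ :1+ a :+ k) a (+ k)))
      (applied (1+ a) p))

  run-++ : ∀ a p q → run a (p ℕ.+ q) ≡ run a p ++ run (a + + p) q
  run-++ a zero    q = cong (λ a → run a q) (sym (+-identityʳ a))
  run-++ a (suc p) q = cong (1+ a ∷_) (trans (run-++ (1+ a) p q) (cong (λ b → run (1+ a) p ++ run b q)
    (linear 2 (λ a p → [] ⊢ :1+ a :+ p :≡ a :+ :1+ p) a (+ p))))

  run-All : ∀ {P : ℤ → Set} a p → (∀ i → a < i → i < 1+ a + + p → P i) → All P (run a p)
  run-All a zero    h = []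
  run-All a (suc p) h =
    h (1+ a) (i<suc[i] a)
      (linear 2 (λ a p → κ 0ℤ :≤ p ∷ [] ⊢ :1+ a :< :1+ a :+ :1+ p) a (+ p) (+≤+ z≤n)) ∷
    run-All (1+ a) p λ i 1+a<i i<b → h i (<-trans (i<suc[i] a) 1+a<i) (subst (i <_)
      (linear 2 (λ a p → [] ⊢ :1+ :1+ a :+ p :≡ :1+ a :+ :1+ p) a (+ p)) i<b)

between-length : ∀ a b → length (between a b) ≡ ∣ b - 1+ a ∣
between-length a b = trans (List.length-map (λ k → 1+ a + + k) (upTo ∣ b - 1+ a ∣))
  (List.length-applyUpTo id ∣ b - 1+ a ∣)

between-empty : ∀ a → between a (1+ a) ≡ []
between-empty a = cong (λ d → map (λ k → 1+ a + + k) (upTo ∣ d ∣)) (+-inverseʳ (1+ a))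

between-++ : ∀ {a c b} → a ≤ c → c < b → between a b ≡ between a (1+ c) ++ between c b
between-++ {a} {c} {b} a≤c c<b = split (offset a≤c) (offset (i<j⇒suc[i]≤j c<b))
  where
  split : (∃ λ p → c ≡ a + + p) → (∃ λ q → b ≡ 1+ c + + q) →
          between a b ≡ between a (1+ c) ++ between c b
  split (p , refl) (q , refl) = begin
    between a (1+ (a + + p) + + q)
      ≡⟨ cong (between a) (linear 3 (λ a p q → [] ⊢ :1+ (a :+ p) :+ q :≡ :1+ a :+ (p :+ q)) a (+ p) (+ q)) ⟩
    between a (1+ a + + (p ℕ.+ q))
      ≡⟨ trans (between-run a (p ℕ.+ q)) (run-++ a p q) ⟩
    run a p ++ run (a + + p) q
      ≡⟨ cong₂ _++_ (between-run a p) (between-run (a + + p) q) ⟨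
    between a (1+ a + + p) ++ between (a + + p) (1+ (a + + p) + + q)
      ≡⟨ cong (λ x → between a x ++ between (a + + p) (1+ (a + + p) + + q)) (+-assoc 1ℤ a (+ p)) ⟩
    between a (1+ (a + + p)) ++ between (a + + p) (1+ (a + + p) + + q) ∎

between-∷ : ∀ {a b} → 1+ a < b → between a b ≡ 1+ a ∷ between (1+ a) b
between-∷ {a} {b} 1+a<b = uncons (offset (i<j⇒suc[i]≤j 1+a<b))
  where
  uncons : (∃ λ q → b ≡ 1+ (1+ a) + + q) → between a b ≡ 1+ a ∷ between (1+ a) b
  uncons (q , refl) = begin
    between a (1+ (1+ a) + + q)
      ≡⟨ cong (between a) (linear 2 (λ a q → [] ⊢ :1+ :1+ a :+ q :≡ :1+ a :+ :1+ q) a (+ q)) ⟩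
    between a (1+ a + + suc q)
      ≡⟨ between-run a (suc q) ⟩
    1+ a ∷ run (1+ a) q
      ≡⟨ cong (1+ a ∷_) (between-run (1+ a) q) ⟨
    1+ a ∷ between (1+ a) (1+ (1+ a) + + q) ∎

between-split : ∀ {a m b} → a < m → m < b → between a b ≡ between a m ++ m ∷ between m b
between-split {a} {m} {b} a<m m<b = begin
  between a b  ≡⟨ between-++ a≤m-1 (<-trans m-1<m m<b) ⟩
  between a (1+ m-1) ++ between m-1 b  ≡⟨ cong (between a (1+ m-1) ++_) (between-∷ {m-1} {b} (subst (_< b) (sym suc≡) m<b)) ⟩
  between a (1+ m-1) ++ 1+ m-1 ∷ between (1+ m-1) b
    ≡⟨ cong (λ m → between a m ++ m ∷ between m b) suc≡ ⟩
  between a m ++ m ∷ between m b ∎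
  where
  m-1 = ℤ.pred m
  suc≡ : 1+ m-1 ≡ m
  suc≡ = suc-pred m
  m-1<m : m-1 < m
  m-1<m = subst (m-1 <_) suc≡ (i<suc[i] m-1)
  a≤m-1 : a ≤ m-1
  a≤m-1 = i<j⇒i≤pred[j] a<m

between-All : ∀ {P : ℤ → Set} {a b} → a < b → (∀ i → a < i → i < b → P i) → All P (between a b)
between-All {P} {a} {b} a<b h = by-offset (offset (i<j⇒suc[i]≤j a<b))
  where
  by-offset : (∃ λ p → b ≡ 1+ a + + p) → All P (between a b)
  by-offset (p , refl) = subst (All P) (sym (between-run a p)) (run-All a p h)

∈-between : ∀ {a b i} → a < i → i < b → i ∈ between a b
∈-between {a} {b} {i} a<i i<b =
  subst (i ∈_) (sym (between-split a<i i<b)) (∈.∈-++⁺ʳ (between a i) (here refl))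

module _ {A : Set} {f g : ℤ → A} {a b : ℤ} where

  map-between-injective : map f (between a b) ≡ map g (between a b) →
                          ∀ {i} → a < i → i < b → f i ≡ g i
  map-between-injective eq a<i i<b = All.lookup (pointwise (between a b) eq) (∈-between a<i i<b)
    where
    pointwise : ∀ xs → map f xs ≡ map g xs → All (λ i → f i ≡ g i) xs
    pointwise []       _  = []
    pointwise (x ∷ xs) eq = List.∷-injectiveˡ eq ∷ pointwise xs (List.∷-injectiveʳ eq)

unique-between : ∀ {w : ℤ → ℤ} {a b} → Unique (map w (between a b)) →
                 ∀ {i j} → a < i → i < j → j < b → w i ≢ w j
unique-between {w} {a} {b} unique {i} {j} a<i i<j j<b =
  head-distinct (map w (between a i)) (subst Unique split unique) (∈.∈-map⁺ w (∈-between i<j j<b))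
  where
  split : map w (between a b) ≡ map w (between a i) ++ w i ∷ map w (between i b)
  split = trans (cong (map w) (between-split a<i (<-trans i<j j<b)))
    (List.map-++ w (between a i) (i ∷ between i b))

  head-distinct : ∀ xs {x y ys} → Unique (xs ++ x ∷ ys) → y ∈ ys → x ≢ y
  head-distinct []       (x≢ys ∷ _)   y∈ys = All.lookup x≢ys y∈ys
  head-distinct (_ ∷ xs) (_ ∷ unique) y∈ys = head-distinct xs unique y∈ys

splitMax-++ : ∀ x xs → let (L , m , R) = splitMax x xs in L ++ m ∷ R ≡ x ∷ xs
splitMax-++ x []       = refl
splitMax-++ x (y ∷ ys) with splitMax y ys | splitMax-++ y ys
... | L , m , R | eq with x <? m
...   | yes _ = cong (x ∷_) eq
...   | no  _ = refl

sortWithin-↭ : ∀ d w → length w ℕ.≤ d → sortWithin d w ↭ w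
sortWithin-↭ zero    []       _          = ↭-refl
sortWithin-↭ (suc d) []       _          = ↭-refl
sortWithin-↭ (suc d) (x ∷ xs) (s≤s xs≤d) with splitMax x xs | splitMax-++ x xs
... | L , m , R | eq = ↭-trans
  (↭.++⁺ (sortWithin-↭ d L L≤d)
    (↭-trans (↭.++⁺ˡ (sortWithin d R) ↭-refl) (↭-trans (↭.++-comm (sortWithin d R) [ m ])
      (↭-prep m (sortWithin-↭ d R R≤d)))))
  (subst ((L ++ m ∷ R) ↭_) eq ↭-refl)
  where
  total-length : length L ℕ.+ length R ≡ length xs
  total-length = ℕ.suc-injective (trans (sym (trans (List.length-++ L) (ℕ.+-suc (length L) (length R)))) (cong length eq))
  L≤d : length L ℕ.≤ d
  L≤d = ℕ.m+n≤o⇒m≤o (length L) (ℕ.≤-trans (ℕ.≤-reflexive total-length) xs≤d)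
  R≤d : length R ℕ.≤ d
  R≤d = ℕ.m+n≤o⇒n≤o (length L) (ℕ.≤-trans (ℕ.≤-reflexive total-length) xs≤d)

stackSort-↭ : ∀ w → stackSort w ↭ w
stackSort-↭ w = sortWithin-↭ (length w) w ℕ.≤-refl

-- The decreasing tree of the word of w on the open interval (a , b), whose
-- nodes u numbers in postorder by the positions of (a - t , b - t).
data Tree (w u : ℤ → ℤ) (t a b : ℤ) : Set where
  leaf : b ≡ 1+ a → Tree w u t a b
  -- The root takes the last rank of the interval, which moves the ranks of the right subtree one
  -- further step to the left: hence `1+ t`.
  node : ∀ m → a < m → m < b → (∀ i → a < i → i < b → i ≢ m → w i < w m) →
         u m ≡ b - 1ℤ - t → Tree w u t a m → Tree w u (1+ t) m b → Tree w u t a b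

module _ {w u : ℤ → ℤ} where

  tree-bounds : ∀ {t a b} → Tree w u t a b → ∀ i → a < i → i < b → a - t < u i × u i < b - t
  tree-bounds {t} {a} (leaf refl) i a<i i<1+a = contradiction a<i (≤⇒≯ (<suc⇒≤ i<1+a))
  tree-bounds {t} {a} {b} (node m a<m m<b _ um L R) i a<i i<b with <-cmp i m
  ... | tri< i<m _ _ = let (lo , hi) = tree-bounds L i a<i i<m in
    lo , linear 4 (λ x m t b → x :< m :- t ∷ m :< b ∷ [] ⊢ x :< b :- t) (u i) m t b hi m<b
  ... | tri≈ _ refl _ =
    linear 4 (λ x a b t → b :- κ 1ℤ :- t :≤ x ∷ a :+ κ 1ℤ :< b ∷ [] ⊢ a :- t :< x) (u m) a b t
      (≤-reflexive (sym um)) (linear 3 (λ a m b → a :< m ∷ m :< b ∷ [] ⊢ a :+ κ 1ℤ :< b) a m b a<m m<b) ,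
    linear 3 (λ x b t → x :≤ b :- κ 1ℤ :- t ∷ [] ⊢ x :< b :- t) (u m) b t (≤-reflexive um)
  ... | tri> _ _ m<i = let (lo , hi) = tree-bounds R i m<i i<b in
    linear 4 (λ x m t a → m :- :1+ t :< x ∷ a :< m ∷ [] ⊢ a :- t :< x) (u i) m t a lo a<m ,
    linear 3 (λ x b t → x :< b :- :1+ t ∷ [] ⊢ x :< b :- t) (u i) b t hi

  tree-surjective : ∀ {t a b} → Tree w u t a b → ∀ y → a - t < y → y < b - t →
                    ∃ λ i → a < i × i < b × u i ≡ y
  tree-surjective {t} {a} (leaf refl) y lo hi = ⊥-elim (linear 3
    (λ a t y → a :- t :< y ∷ y :< :1+ a :- t ∷ [] ⊢ :⊥) a t y lo hi)
  tree-surjective {t} {a} {b} (node m a<m m<b _ um L R) y lo hi with y <? m - t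
  ... | yes y<m-t = let (i , a<i , i<m , ui) = tree-surjective L y lo y<m-t in i , a<i , <-trans i<m m<b , ui
  ... | no  y≮m-t with y <? b - 1+ t
  ...   | yes y<b-1-t = let (i , m<i , i<b , ui) = tree-surjective R y
                              (linear 3 (λ m t y → m :- t :≤ y ∷ [] ⊢ m :- :1+ t :< y) m t y (≮⇒≥ y≮m-t))
                              y<b-1-t
                        in i , <-trans a<m m<i , i<b , ui
  ...   | no  y≮b-1-t = m , a<m , m<b , trans um (≤-antisym
    (linear 3 (λ b t y → b :- :1+ t :≤ y ∷ [] ⊢ b :- κ 1ℤ :- t :≤ y) b t y (≮⇒≥ y≮b-1-t))
    (linear 3 (λ b t y → y :< b :- t ∷ [] ⊢ y :≤ b :- κ 1ℤ :- t) b t y hi))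

  PostorderPair : ℤ → ℤ → Set
  PostorderPair i j = (u j < u i × Dominates w i j) ⊎ (u i < u j × ¬ Dominates w i j)

  tree-postorder : ∀ {t a b} → Tree w u t a b → ∀ {i j} → a < i → i < j → j < b → PostorderPair i j
  tree-postorder {t} {a} (leaf refl) a<i i<j j<1+a =
    contradiction (<-trans a<i i<j) (≤⇒≯ (<suc⇒≤ j<1+a))
  tree-postorder {t} {a} {b} (node m a<m m<b max um L R) {i} {j} a<i i<j j<b with <-cmp i m
  ... | tri> _ _ m<i = tree-postorder R m<i i<j j<b
  ... | tri≈ _ refl _ = inj₁
    (linear 4 (λ x y b t → y :< b :- :1+ t ∷ b :- κ 1ℤ :- t :≤ x ∷ [] ⊢ y :< x) (u m) (u j) b t
      (proj₂ (tree-bounds R j i<j j<b)) (≤-reflexive (sym um)) ,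
    λ k m<k k≤j → max k (<-trans a<m m<k) (≤-<-trans k≤j j<b) (λ eq → <⇒≢ m<k (sym eq)))
  ... | tri< i<m _ _ with <-cmp j m
  ...   | tri< j<m _ _ = tree-postorder L a<i i<j j<m
  ...   | tri≈ _ refl _ = inj₂
    (linear 5 (λ x y m b t → x :< m :- t ∷ m :< b ∷ b :- κ 1ℤ :- t :≤ y ∷ [] ⊢ x :< y) (u i) (u j) m b t
      (proj₂ (tree-bounds L i a<i i<m)) m<b (≤-reflexive (sym um)) ,
    λ dom → <-asym (dom m i<m ≤-refl) (max i a<i (<-trans i<m m<b) (<⇒≢ i<m)))
  ...   | tri> _ _ m<j = inj₂
    (linear 4 (λ x y m t → x :< m :- t ∷ m :- :1+ t :< y ∷ [] ⊢ x :< y) (u i) (u j) m t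
      (proj₂ (tree-bounds L i a<i i<m)) (proj₁ (tree-bounds R j m<j j<b)) ,
    λ dom → <-asym (dom m i<m (<⇒≤ m<j)) (max i a<i (<-trans i<m m<b) (<⇒≢ i<m)))

LocallyInjective : (ℤ → ℤ) → ℤ → ℤ → Set
LocallyInjective w a b = ∀ {i j} → a < i → i < j → j < b → w i ≢ w j

StrictMaximumIn : (ℤ → ℤ) → ℤ → ℤ → Set
StrictMaximumIn w a b = ∃ λ m → a < m × m < b × (∀ i → a < i → i < b → i ≢ m → w i < w m)

strict-maximum : ∀ {w a b} → LocallyInjective w a b → 1+ a < b → StrictMaximumIn w a b
strict-maximum {w} {a} {b} distinct 1+a<b = strict (argmax w 1+a<b)
  where
  strict : MaximumIn w (1+ a) b → StrictMaximumIn w a b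
  strict (m , a<m , m<b , max) = m , suc[i]≤j⇒i<j a<m , m<b , λ i a<i i<b i≢m →
    ≤∧≢⇒< (max i (i<j⇒suc[i]≤j a<i) i<b) (differ i a<i i<b i≢m)
    where
    differ : ∀ i → a < i → i < b → i ≢ m → w i ≢ w m
    differ i a<i i<b i≢m with <-cmp i m
    ... | tri< i<m _ _  = distinct a<i i<m m<b
    ... | tri≈ _ i≡m _  = contradiction i≡m i≢m
    ... | tri> _ _ m<i  = λ eq → distinct (suc[i]≤j⇒i<j a<m) m<i i<b (sym eq)

private
  locally-injectiveˡ : ∀ {w a m b} → m < b → LocallyInjective w a b → LocallyInjective w a m
  locally-injectiveˡ m<b distinct a<i i<j j<m = distinct a<i i<j (<-trans j<m m<b)

  locally-injectiveʳ : ∀ {w a m b} → a < m → LocallyInjective w a b → LocallyInjective w m b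
  locally-injectiveʳ a<m distinct m<i = distinct (<-trans a<m m<i)

  boundˡ : ∀ {a m b d} → m < b → b ≤ 1+ a + + suc d → m ≤ 1+ a + + d
  boundˡ {a} {m} {b} {d} = linear 4
    (λ a m b d → m :< b ∷ b :≤ :1+ a :+ :1+ d ∷ [] ⊢ m :≤ :1+ a :+ d) a m b (+ d)

  boundʳ : ∀ {a m b d} → a < m → b ≤ 1+ a + + suc d → b ≤ 1+ m + + d
  boundʳ {a} {m} {b} {d} = linear 4
    (λ a m b d → a :< m ∷ b :≤ :1+ a :+ :1+ d ∷ [] ⊢ b :≤ :1+ m :+ d) a m b (+ d)

  ++-injective : ∀ {A : Set} (xs xs′ : List A) {ys ys′} → length xs ≡ length xs′ →
                 xs ++ ys ≡ xs′ ++ ys′ → xs ≡ xs′ × ys ≡ ys′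
  ++-injective []       []         _   eq = refl , eq
  ++-injective (x ∷ xs) (x′ ∷ xs′) len eq
    with xs≡ , ys≡ ← ++-injective xs xs′ (ℕ.suc-injective len) (List.∷-injectiveʳ eq) =
    cong₂ _∷_ (List.∷-injectiveˡ eq) xs≡ , ys≡

  -- The positions of the left subtree, of the right subtree and of the root.
  postorder-positions : ∀ {a m b} t → a < m → m < b →
    between (a - t) (b - t) ≡
    between (a - t) (m - t) ++ between (m - 1+ t) (b - 1+ t) ++ [ b - 1ℤ - t ]
  postorder-positions {a} {m} {b} t a<m m<b = begin
    between (a - t) (b - t)
      ≡⟨ between-++ {a - t} {m - 1+ t} {b - t}
           (linear 3 (λ a m t → a :< m ∷ [] ⊢ a :- t :≤ m :- :1+ t) a m t a<m)
           (linear 3 (λ b m t → m :< b ∷ [] ⊢ m :- :1+ t :< b :- t) b m t m<b) ⟩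
    between (a - t) (1+ (m - 1+ t)) ++ between (m - 1+ t) (b - t)
      ≡⟨ cong₂ (λ x xs → between (a - t) x ++ xs) (suc-minus m t)
           (trans (between-split {m - 1+ t} {b - 1+ t} {b - t}
             (linear 3 (λ b m t → m :< b ∷ [] ⊢ m :- :1+ t :< b :- :1+ t) b m t m<b)
             (linear 2 (λ b t → [] ⊢ b :- :1+ t :< b :- t) b t))
           (cong (between (m - 1+ t) (b - 1+ t) ++_) (cong₂ _∷_
             (linear 2 (λ b t → [] ⊢ b :- :1+ t :≡ b :- κ 1ℤ :- t) b t)
             (trans (cong (between (b - 1+ t)) (sym (suc-minus b t))) (between-empty (b - 1+ t)))))) ⟩
    between (a - t) (m - t) ++ between (m - 1+ t) (b - 1+ t) ++ [ b - 1ℤ - t ] ∎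
    where
    suc-minus : ∀ m t → 1+ (m - 1+ t) ≡ m - t
    suc-minus m t = linear 2 (λ m t → [] ⊢ :1+ (m :- :1+ t) :≡ m :- t) m t

  map-++₃ : ∀ (v : ℤ → ℤ) xs ys z → map v (xs ++ ys ++ [ z ]) ≡ map v xs ++ map v ys ++ [ v z ]
  map-++₃ v xs ys z = trans (List.map-++ v xs (ys ++ [ z ])) (cong (map v xs ++_) (List.map-++ v ys [ z ]))

  stackSort-node : ∀ {w : ℤ → ℤ} {a m b} → a < m → m < b →
    (∀ i → a < i → i < b → i ≢ m → w i < w m) →
    stackSort (map w (between a b)) ≡
    stackSort (map w (between a m)) ++ stackSort (map w (between m b)) ++ [ w m ]
  stackSort-node {w} {a} {m} {b} a<m m<b max = trans
    (cong stackSort (trans (cong (map w) (between-split a<m m<b)) (List.map-++ w (between a m) (m ∷ between m b))))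
    (stackSort-split (map w (between a m)) (map w (between m b))
      (All.map⁺ (between-All a<m λ i a<i i<m → max i a<i (<-trans i<m m<b) (<⇒≢ i<m)))
      (All.map⁺ (between-All m<b λ i m<i i<b → max i (<-trans a<m m<i) i<b (λ eq → <⇒≢ m<i (sym eq)))))

tree⇒stackSort : ∀ {w u v t a b} → (∀ i → v (u i) ≡ w i) → Tree w u t a b →
                 stackSort (map w (between a b)) ≡ map v (between (a - t) (b - t))
tree⇒stackSort {w} {u} {v} {t} {a} vu (leaf refl) = trans
  (cong (stackSort ∘ map w) (between-empty a))
  (cong (map v) (sym (trans (cong (between (a - t))
    (linear 2 (λ a t → [] ⊢ :1+ a :- t :≡ :1+ (a :- t)) a t)) (between-empty (a - t)))))
tree⇒stackSort {w} {u} {v} {t} {a} {b} vu (node m a<m m<b max um L R) = begin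
  stackSort (map w (between a b))
    ≡⟨ stackSort-node a<m m<b max ⟩
  stackSort (map w (between a m)) ++ stackSort (map w (between m b)) ++ [ w m ]
    ≡⟨ cong₂ _++_ (tree⇒stackSort vu L) (cong₂ _++_ (tree⇒stackSort vu R)
         (cong [_] (trans (sym (vu m)) (cong v um)))) ⟩
  map v (between (a - t) (m - t)) ++ map v (between (m - 1+ t) (b - 1+ t)) ++ [ v (b - 1ℤ - t) ]
    ≡⟨ map-++₃ v (between (a - t) (m - t)) (between (m - 1+ t) (b - 1+ t)) (b - 1ℤ - t) ⟨
  map v (between (a - t) (m - t) ++ between (m - 1+ t) (b - 1+ t) ++ [ b - 1ℤ - t ])
    ≡⟨ cong (map v) (postorder-positions t a<m m<b) ⟨
  map v (between (a - t) (b - t)) ∎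

-- The bound on d makes the recursion on the length of the interval structural.
stackSort⇒tree : ∀ {w v f} → (∀ y → f (v y) ≡ y) → ∀ d {t a b} → a < b → b ≤ 1+ a + + d →
                 LocallyInjective w a b →
                 stackSort (map w (between a b)) ≡ map v (between (a - t) (b - t)) →
                 Tree w (f ∘ w) t a b
stackSort⇒tree fv zero    {t} {a} {b} a<b b≤1+a distinct eq = leaf (≤-antisym
  (subst (b ≤_) (+-identityʳ (1+ a)) b≤1+a) (i<j⇒suc[i]≤j a<b))
stackSort⇒tree {w} {v} {f} fv (suc d) {t} {a} {b} a<b bound distinct eq with ≤⇒<⊎≡ (i<j⇒suc[i]≤j a<b)
... | inj₂ 1+a≡b = leaf (sym 1+a≡b)
... | inj₁ 1+a<b = split (strict-maximum distinct 1+a<b)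
  where
  split : StrictMaximumIn w a b → Tree w (f ∘ w) t a b
  split (m , a<m , m<b , max) = node m a<m m<b max
    (trans (cong f (List.∷-injectiveˡ (proj₂ rest-parts))) (fv (b - 1ℤ - t)))
    (stackSort⇒tree {w} {v} {f} fv d a<m (boundˡ {a} {m} {b} {d} m<b bound)
      (locally-injectiveˡ m<b distinct) (proj₁ parts))
    (stackSort⇒tree {w} {v} {f} fv d m<b (boundʳ {a} {m} {b} {d} a<m bound)
      (locally-injectiveʳ a<m distinct) (proj₁ rest-parts))
    where
    A = between a m
    B = between m b
    X = between (a - t) (m - t)
    Y = between (m - 1+ t) (b - 1+ t)

    split-eq : stackSort (map w A) ++ stackSort (map w B) ++ [ w m ] ≡ map v X ++ map v Y ++ [ v (b - 1ℤ - t) ]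
    split-eq = trans (sym (stackSort-node a<m m<b max))
      (trans eq (trans (cong (map v) (postorder-positions t a<m m<b)) (map-++₃ v X Y (b - 1ℤ - t))))

    same-length : ∀ a b t → length (stackSort (map w (between a b))) ≡ length (map v (between (a - t) (b - t)))
    same-length a b t = begin
      length (stackSort (map w (between a b)))  ≡⟨ ↭.↭-length (stackSort-↭ (map w (between a b))) ⟩
      length (map w (between a b))  ≡⟨ List.length-map w (between a b) ⟩
      length (between a b)  ≡⟨ between-length a b ⟩
      ∣ b - 1+ a ∣  ≡⟨ cong ∣_∣ (linear 3 (λ a b t → [] ⊢
                                                          b :- :1+ a :≡ b :- t :- (:1+ (a :- t))) a b t) ⟩
      ∣ b - t - 1+ (a - t) ∣  ≡⟨ between-length (a - t) (b - t) ⟨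
      length (between (a - t) (b - t))  ≡⟨ List.length-map v (between (a - t) (b - t)) ⟨
      length (map v (between (a - t) (b - t)))  ∎

    -- Stack-sorting preserves length, so an equation between the two concatenations splits into
    -- equations between their parts.
    parts : stackSort (map w A) ≡ map v X × stackSort (map w B) ++ [ w m ] ≡ map v Y ++ [ v (b - 1ℤ - t) ]
    parts = ++-injective (stackSort (map w A)) (map v X) (same-length a m t) split-eq

    rest-parts : stackSort (map w B) ≡ map v Y × [ w m ] ≡ [ v (b - 1ℤ - t) ]
    rest-parts = ++-injective (stackSort (map w B)) (map v Y) (same-length m b (1+ t)) (proj₂ parts)

module _ {w u : ℤ → ℤ} (u-injective : ∀ {i j} → u i ≡ u j → i ≡ j) (post : Postorder w u) where

  open Postorder post

  private
    ordered : ∀ {i j} → i < j → ¬ Dominates w i j → u i < u j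
    ordered i<j ¬dom = ≤∧≢⇒< (≮⇒≥ (¬dom ∘ dominated i<j)) (λ eq → <⇒≢ i<j (u-injective eq))

  -- By the pigeonhole principle each subtree occupies an interval of ranks.
  postorder⇒tree : ∀ d {t a b} → a < b → b ≤ 1+ a + + d → LocallyInjective w a b →
                   (∀ i → a < i → i < b → a - t < u i × u i < b - t) → Tree w u t a b
  postorder⇒tree zero    {t} {a} {b} a<b b≤1+a distinct inside = leaf (≤-antisym
    (subst (b ≤_) (+-identityʳ (1+ a)) b≤1+a) (i<j⇒suc[i]≤j a<b))
  postorder⇒tree (suc d) {t} {a} {b} a<b bound distinct inside with ≤⇒<⊎≡ (i<j⇒suc[i]≤j a<b)
  ... | inj₂ 1+a≡b = leaf (sym 1+a≡b)
  ... | inj₁ 1+a<b = split (strict-maximum distinct 1+a<b)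
    where
    split : StrictMaximumIn w a b → Tree w u t a b
    split (m , a<m , m<b , max) = node m a<m m<b max um
      (postorder⇒tree d a<m (boundˡ {a} {m} {b} {d} m<b bound)
        (locally-injectiveˡ m<b distinct) (λ i a<i i<m → lower i a<i (<-trans i<m m<b) , left i a<i i<m))
      (postorder⇒tree d m<b (boundʳ {a} {m} {b} {d} a<m bound)
        (locally-injectiveʳ a<m distinct) (λ j m<j j<b → right j m<j j<b , right-upper j m<j j<b))
      where
      lower : ∀ i → a < i → i < b → a - t < u i
      lower i a<i i<b = proj₁ (inside i a<i i<b)

      upper : ∀ i → a < i → i < b → u i < b - t
      upper i a<i i<b = proj₂ (inside i a<i i<b)

      undominated : ∀ {i j} → a < i → i < m → m ≤ j → j < b → u i < u j
      undominated {i} a<i i<m m≤j j<b = ordered (<-≤-trans i<m m≤j) λ dom →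
        <-asym (dom m i<m m≤j) (max i a<i (<-trans i<m m<b) (<⇒≢ i<m))

      below-root : ∀ j → m < j → j < b → u j < u m
      below-root j m<j j<b = inverted m<j λ k m<k k≤j →
        max k (<-trans a<m m<k) (≤-<-trans k≤j j<b) (λ eq → <⇒≢ m<k (sym eq))

      ≤um : ∀ i → a < i → i < b → u i ≤ u m
      ≤um i a<i i<b with <-cmp i m
      ... | tri< i<m _ _  = <⇒≤ (undominated a<i i<m ≤-refl m<b)
      ... | tri≈ _ refl _ = ≤-refl
      ... | tri> _ _ m<i  = <⇒≤ (below-root i m<i i<b)

      -- The root has the largest rank, so all `b - a - 1` distinct ranks lie above `a - t` and do
      -- not exceed `u m`.
      um : u m ≡ b - 1ℤ - t
      um = ≤-antisym
        (linear 3 (λ x b t → x :< b :- t ∷ [] ⊢ x :≤ b :- κ 1ℤ :- t) (u m) b t (upper m a<m m<b))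
        (linear 4 (λ x a b t → b :- :1+ a :≤ :1+ x :- (:1+ (a :- t)) ∷ [] ⊢ b :- κ 1ℤ :- t :≤ x)
          (u m) a b t
          (pigeonhole u u-injective {1+ a} {b} {1+ (a - t)} {1+ (u m)}
            (λ i 1+a≤i i<b → let a<i = suc[i]≤j⇒i<j 1+a≤i in
              i<j⇒suc[i]≤j (lower i a<i i<b) , ≤⇒<suc (≤um i a<i i<b))
            (<⇒≤ 1+a<b)
            (<⇒≤ (≤⇒<suc (i<j⇒suc[i]≤j (lower m a<m m<b))))))

      -- Otherwise the `b - m` ranks of the root and the right subtree, all above `u i`, would have
      -- at most `b - m - 1` places.
      left : ∀ i → a < i → i < m → u i < m - t
      left i a<i i<m = ≰⇒> λ m-t≤ui → linear 3
        (λ m b t → b :- m :≤ b :- t :- (:1+ (m :- t)) ∷ [] ⊢ :⊥) m b t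
        (pigeonhole u u-injective {m} {b} {1+ (m - t)} {b - t}
          (λ j m≤j j<b → i<j⇒suc[i]≤j (≤-<-trans m-t≤ui (undominated a<i i<m m≤j j<b)) ,
                         upper j (<-≤-trans a<m m≤j) j<b)
          (<⇒≤ m<b)
          (linear 3 (λ m b t → m :< b ∷ [] ⊢ :1+ (m :- t) :≤ b :- t) m b t m<b))

      -- Dually, the `m - a - 1` ranks of the left subtree, all below `u j`, would have too few
      -- places above `a - t`.
      right : ∀ j → m < j → j < b → m - 1+ t < u j
      right j m<j j<b = ≰⇒> λ uj≤m-1-t → linear 4
        (λ a m t x → m :- :1+ a :≤ x :- (:1+ (a :- t)) ∷ x :≤ m :- :1+ t ∷ [] ⊢ :⊥) a m t (u j)
        (pigeonhole u u-injective {1+ a} {m} {1+ (a - t)} {u j}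
          (λ i 1+a≤i i<m → let a<i = suc[i]≤j⇒i<j 1+a≤i in
            i<j⇒suc[i]≤j (lower i a<i (<-trans i<m m<b)) , undominated a<i i<m (<⇒≤ m<j) j<b)
          (i<j⇒suc[i]≤j a<m)
          (i<j⇒suc[i]≤j (lower j (<-trans a<m m<j) j<b)))
        uj≤m-1-t

      right-upper : ∀ j → m < j → j < b → u j < b - 1+ t
      right-upper j m<j j<b = linear 4 (λ x y b t → x :< y ∷ y :≤ b :- κ 1ℤ :- t ∷ [] ⊢ x :< b :- :1+ t)
        (u j) (u m) b t (below-root j m<j j<b) (≤-reflexive um)

-- The blocks cut out by a skyline

max-increasing : ∀ {n} (w : AffinePerm n) {y y′} → IsLeftToRightMax w y → y < y′ → from w y < from w y′
max-increasing w {y} {y′} max y<y′ with <-cmp (from w y) (from w y′)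
... | tri< lt _ _ = lt
... | tri≈ _ eq _ = contradiction (from-injective w eq) (<⇒≢ y<y′)
... | tri> _ _ gt = contradiction y<y′ (<-asym (subst (_< y) (to-from w y′) (max (from w y′) gt)))

member-max : ∀ {n} {v : AffinePerm n} (M : SkySet v) (I : Indexing M) i p →
             p < from v (Indexing.m I i) → to v p < Indexing.m I i
member-max M I i = SkySet.maxima M (Indexing.m I i) (Indexing.sound I i)

module _ {n : ℕ} .{{_ : NonZero n}} {v : AffinePerm n} (M : SkySet v) where

  open SkySet M using (member; periodic; nonempty)

  Marked : ℤ → Set
  Marked p = T (member (to v p))

  Marked? : ∀ p → Dec (Marked p)
  Marked? p = T? (member (to v p))

  marked-* : ∀ p t → member (to v (p + t * + n)) ≡ member (to v p)
  marked-* p t = trans (cong member (to-* v p t)) (periodic-* member periodic (to v p) t)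

  marked-in-window : ∀ a → ∃ λ p → a ≤ p × p < a + + n × Marked p
  marked-in-window a = p , i≤i+j a (+ toℕ k) , +-monoʳ-< a (+<+ (Fin.toℕ<n k)) ,
    subst T (trans (cong (member ∘ to v) p₀≡) (marked-* p t)) p₀-marked
    where
    p₀ = from v (proj₁ nonempty)
    k = residue n (p₀ - a)
    t = (p₀ - a) /ℕ n
    p = a + + toℕ k
    p₀-marked : Marked p₀
    p₀-marked = subst (T ∘ member) (sym (to-from v (proj₁ nonempty))) (proj₂ nonempty)
    p₀≡ : p₀ ≡ p + t * + n
    p₀≡ = linear 4 (λ p a k q → p :- a :≡ k :+ q ∷ [] ⊢ p :≡ a :+ k :+ q)
      p₀ a (+ toℕ k) (t * + n) (residue-quotient n (p₀ - a))

tree-translate : ∀ {w u} c → (∀ i → w (i + c) ≡ w i + c) → (∀ i → u (i + c) ≡ u i + c) →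
                 ∀ {t a b} → Tree w u t a b → Tree w u t (a + c) (b + c)
tree-translate c w-c u-c {t} {a} (leaf refl) = leaf (+-assoc 1ℤ a c)
tree-translate {w} {u} c w-c u-c {t} {a} {b} (node m a<m m<b max um L R) =
  node (m + c) (+-monoˡ-< c a<m) (+-monoˡ-< c m<b) max′
    (trans (u-c m) (trans (cong (_+ c) um)
      (linear 3 (λ b t c → [] ⊢ b :- κ 1ℤ :- t :+ c :≡ b :+ c :- κ 1ℤ :- t) b t c)))
    (tree-translate c w-c u-c L) (tree-translate c w-c u-c R)
  where
  max′ : ∀ i → a + c < i → i < b + c → i ≢ m + c → w i < w (m + c)
  max′ i lo hi i≢ = subst₂ _<_ (trans (sym (w-c (i - c))) (cong w i≡)) (sym (w-c m))
    (+-monoˡ-< c (max (i - c)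
      (linear 3 (λ a c i → a :+ c :< i ∷ [] ⊢ a :< i :- c) a c i lo)
      (linear 3 (λ b c i → i :< b :+ c ∷ [] ⊢ i :- c :< b) b c i hi)
      (λ eq → i≢ (trans (sym i≡) (cong (_+ c) eq)))))
    where
    i≡ : i - c + c ≡ i
    i≡ = linear 2 (λ i c → [] ⊢ i :- c :+ c :≡ i) i c

module _ {n : ℕ} .{{_ : NonZero n}} where

  -- Summing the representatives of the residues in [x , x + n).
  degree-window-preserving : (p : ExtendedPerm n) (x : ℤ) →
    (∀ i → x ≤ i → i < x + + n → x ≤ fun p i × fun p i < x + + n) → degree n (fun p) ≡ 0ℤ
  degree-window-preserving p x preserves = begin
    degree n (fun p)
      ≡⟨ windowSum-permute n {D} (displacement-periodic n (fun p) (ExtendedPerm.equivariant p)) idᵉ 1ℤ x ⟩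
    windowSum n D x
      ≡⟨ linear 3 (λ s a b → s :+ b :≡ a ∷ a :≡ b ∷ [] ⊢ s :≡ κ 0ℤ)
           (windowSum n D x) (windowSum n (fun p) x) (windowSum n id x) split same ⟩
    0ℤ ∎
    where
    D : ℤ → ℤ
    D i = fun p i - i

    ρ : ℤ → ℤ
    ρ y = x + + toℕ (residue n (y - x))

    ρ-periodic : Periodic n ρ
    ρ-periodic y = cong (λ k → x + + toℕ k) (proj₂ (residue-quotient-unique n
      (residue n (y - x)) (1+ q) (begin
        y + + n - x  ≡⟨ linear 3 (λ x y n → [] ⊢ y :+ n :- x :≡ (y :- x) :+ n) x y (+ n) ⟩
        (y - x) + + n  ≡⟨ cong (_+ + n) (residue-quotient n (y - x)) ⟩
        + toℕ k + q * + n + + n  ≡⟨ suc-multiple (+ toℕ k) q ⟨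
        + toℕ k + 1+ q * + n  ∎)))
      where
      k = residue n (y - x)
      q = (y - x) /ℕ n

    ρ-id : ∀ y → x ≤ y → y < x + + n → ρ y ≡ y
    ρ-id y x≤y y<x+n = by-offset (offset x≤y)
      where
      by-offset : (∃ λ k → y ≡ x + + k) → ρ y ≡ y
      by-offset (k , refl) = cong (λ r → x + + r) (trans
        (cong toℕ (proj₂ (residue-quotient-unique n (fromℕ< k<n) 0ℤ (trans
          (linear 2 (λ x k → [] ⊢ x :+ k :- x :≡ k :+ κ 0ℤ) x (+ k))
          (cong (λ k → + k + 0ℤ) (sym (Fin.toℕ-fromℕ< k<n)))))))
        (Fin.toℕ-fromℕ< k<n))
        where
        k<n : k ℕ.< n
        k<n = drop‿+<+ (linear 3 (λ x k n → x :+ k :< x :+ n ∷ [] ⊢ k :< n) x (+ k) (+ n) y<x+n)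

    in-window : ∀ (k : Fin n) → x ≤ x + + toℕ k × x + + toℕ k < x + + n
    in-window k = i≤i+j x (+ toℕ k) , +-monoʳ-< x (+<+ (Fin.toℕ<n k))

    same : windowSum n (fun p) x ≡ windowSum n id x
    same = begin
      windowSum n (fun p) x
        ≡⟨ ∑ℤ.sum-cong-≗ {n} (λ k → sym (let (lo , hi) = preserves _ (proj₁ (in-window k)) (proj₂ (in-window k))
             in ρ-id (fun p (x + + toℕ k)) lo hi)) ⟩
      windowSum n (ρ ∘ fun p) x  ≡⟨ windowSum-permute n {ρ} ρ-periodic p x x ⟩
      windowSum n ρ x  ≡⟨ ∑ℤ.sum-cong-≗ {n} (λ k → ρ-id (x + + toℕ k) (proj₁ (in-window k)) (proj₂ (in-window k))) ⟩
      windowSum n id x ∎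

    split : windowSum n D x + windowSum n id x ≡ windowSum n (fun p) x
    split = trans (sym (windowSum-+ n D id x))
      (windowSum-cong n x (λ i → linear 2 (λ a i → [] ⊢ (a :- i) :+ i :≡ a) (fun p i) i))

module Blocks {n : ℕ} .{{_ : NonZero n}} {v : AffinePerm n} {M : SkySet v} (I : Indexing M) where

  open SkySet M using (member)
  open Indexing I using (m; increasing; sound; complete; r; r-shift)

  instance
    r≢0 : NonZero r
    r≢0 = Indexing.r-positive I

  -- The blocks of positions are the intervals (e i , e (1+ i)].
  e : ℤ → ℤ
  e i = from v (m i)

  to-e : ∀ i → to v (e i) ≡ m i
  to-e i = to-from v (m i)

  e-increasing : ∀ {i j} → i < j → e i < e j
  e-increasing {i} i<j = max-increasing v (member-max M I i) (increasing i<j)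

  e-monotone : ∀ {i j} → i ≤ j → e i ≤ e j
  e-monotone i≤j with ≤⇒<⊎≡ i≤j
  ... | inj₁ i<j  = <⇒≤ (e-increasing i<j)
  ... | inj₂ refl = ≤-refl

  e-cancel-< : ∀ {i j} → e i < e j → i < j
  e-cancel-< ei<ej = ≰⇒> λ j≤i → <⇒≱ ei<ej (e-monotone j≤i)

  e-shift : ∀ i → e (i + + r) ≡ e i + + n
  e-shift i = trans (cong (from v) (r-shift i)) (ExtendedPerm.inv-equivariant (forget v) (m i))

  e-* : ∀ i t → e (i + t * + r) ≡ e i + t * + n
  e-* i = ℤ-induction _
    (trans (cong e (+-identityʳ i)) (sym (+-identityʳ (e i))))
    (λ t eq → trans (step t) (trans (cong (_+ + n) eq) (sym (suc-multiple (e i) t))))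
    (λ t eq → linear 3 (λ a b n → a :+ n :≡ b :+ n ∷ [] ⊢ a :≡ b) (e (i + t * + r)) (e i + t * + n) (+ n)
      (trans (sym (step t)) (trans eq (suc-multiple (e i) t))))
    where
    step : ∀ t → e (i + 1+ t * + r) ≡ e (i + t * + r) + + n
    step t = trans (cong e (suc-multiple i t)) (e-shift (i + t * + r))

  InBlock : ℤ → ℤ → Set
  InBlock i l = e i < l × l ≤ e (1+ i)

  -- The block without its first position. The list `z` omits the last position instead, so both
  -- ends differ by one from those used there.
  interior : ℤ → List ℤ
  interior i = between (1+ (e i)) (1+ (e (1+ i)))

  block-unique : ∀ {i j l} → InBlock i l → InBlock j l → i ≡ j
  block-unique {i} {j} (ei<l , l≤) (ej<l , l≤′) with <-cmp i j
  ... | tri< i<j _ _ = contradiction (≤-<-trans (≤-trans l≤ (e-monotone (i<j⇒suc[i]≤j i<j))) ej<l) (<-irrefl refl)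
  ... | tri≈ _ eq _  = eq
  ... | tri> _ _ j<i = contradiction (≤-<-trans (≤-trans l≤′ (e-monotone (i<j⇒suc[i]≤j j<i))) ei<l) (<-irrefl refl)

  locate : ∀ l → ∃ λ i → InBlock i l
  locate l = found (greatest (Marked? M) (l - + n) l)
    where
    found : GreatestIn (Marked M) (l - + n) l ⊎ NoneIn (Marked M) (l - + n) l → ∃ λ i → InBlock i l
    found (inj₂ none) = let (p , lo , hi , marked) = marked-in-window M (l - + n) in contradiction marked
      (none p lo (subst (p <_) (linear 2 (λ l n → [] ⊢ l :- n :+ n :≡ l) l (+ n)) hi))
    found (inj₁ (p , _ , p<l , p∈M , above)) = i , subst (_< l) (sym ei≡p) p<l , ≮⇒≥ λ e<l →
      above (e (1+ i)) (subst (_< e (1+ i)) ei≡p (e-increasing (i<suc[i] i))) e<l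
        (subst (T ∘ member) (sym (to-e (1+ i))) (sound (1+ i)))
      where
      i = proj₁ (complete (to v p) p∈M)
      ei≡p : e i ≡ p
      ei≡p = trans (cong (from v) (proj₂ (complete (to v p) p∈M))) (from-to v p)

  -- An element of the fibre over v: in each block the first entry is the last
  -- one of the corresponding block of v, and the others are stack-sorted to
  -- the others of v.
  record Filled (w : ℤ → ℤ) : Set where
    field
      equivariant : Equivariant n w
      start       : ∀ i → w (1+ (e i)) ≡ m (1+ i)
      distinct    : ∀ (k : Fin r) → Unique (map w (interior (+ suc (toℕ k))))
      sorts       : ∀ (k : Fin r) → stackSort (map w (interior (+ suc (toℕ k)))) ≡ zAt I k

-- From filled blocks to a preimage of `v`

module FromFilled {n : ℕ} .{{_ : NonZero n}} {v : AffinePerm n} {M : SkySet v} (I : Indexing M)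
                  {w : ℤ → ℤ} (filled : Blocks.Filled I w) where

  open SkySet M using (member)
  open Indexing I using (m; sound; complete; r)
  open Blocks I
  open Filled filled

  rank : ℤ → ℤ
  rank = from v ∘ w

  to-rank : ∀ l → to v (rank l) ≡ w l
  to-rank l = to-from v (w l)

  rank-equivariant : Equivariant n rank
  rank-equivariant l = trans (cong (from v) (equivariant l)) (ExtendedPerm.inv-equivariant (forget v) (w l))

  -- `Filled` speaks of the words in the blocks 1 to `r` only; any other block is a translate of one
  -- of these. The shift `1ℤ` leaves the last rank of the block to its first position.
  block-tree : ∀ i → Tree w rank 1ℤ (1+ (e i)) (1+ (e (1+ i)))
  block-tree i = subst₂ (Tree w rank 1ℤ)
    (translated e (e i₀) (e-* i₀ t))
    (translated (e ∘ 1+) (e (1+ i₀))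
      (trans (cong e (sym (+-assoc 1ℤ i₀ (t * + r)))) (e-* (1+ i₀) t)))
    (tree-translate (t * + n) (λ l → equivariant-* w equivariant l t)
      (λ l → equivariant-* rank rank-equivariant l t) fundamental)
    where
    k = residue r (i - 1ℤ)
    t = (i - 1ℤ) /ℕ r
    i₀ = + suc (toℕ k)

    i≡ : i₀ + t * + r ≡ i
    i≡ = linear 3 (λ i k q → k :+ q :≡ i :- κ 1ℤ ∷ [] ⊢ :1+ k :+ q :≡ i)
      i (+ toℕ k) (t * + r) (sym (residue-quotient r (i - 1ℤ)))

    translated : ∀ (f : ℤ → ℤ) x → f (i₀ + t * + r) ≡ x + t * + n →
                 1+ x + t * + n ≡ 1+ (f i)
    translated f x eq = trans (+-assoc 1ℤ x (t * + n)) (cong 1+ (trans (sym eq) (cong f i≡)))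

    a<b : 1+ (e i₀) < 1+ (e (1+ i₀))
    a<b = suc-< (e-increasing (i<suc[i] i₀))

    fundamental : Tree w rank 1ℤ (1+ (e i₀)) (1+ (e (1+ i₀)))
    fundamental = stackSort⇒tree {w} {to v} {from v} (from-to v) (proj₁ (length-bound a<b)) a<b
      (proj₂ (length-bound a<b)) (unique-between {w} (distinct k))
      (trans (sorts k) (cong (map (to v)) (sym (cong₂ between (suc-1 (e i₀)) (suc-1 (e (1+ i₀)))))))

  data Place (i : ℤ) : ℤ → Set where
    first : Place i (1+ (e i))
    later : ∀ {l} → 1+ (e i) < l → l < 1+ (e (1+ i)) → Place i l

  place : ∀ {i l} → InBlock i l → Place i l
  place (ei<l , l≤) with ≤⇒<⊎≡ (i<j⇒suc[i]≤j ei<l)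
  ... | inj₁ lt   = later lt (≤⇒<suc l≤)
  ... | inj₂ refl = first

  rank-first : ∀ i → rank (1+ (e i)) ≡ e (1+ i)
  rank-first i = cong (from v) (start i)

  rank-later : ∀ {i l} → 1+ (e i) < l → l < 1+ (e (1+ i)) →
               e i < rank l × rank l < e (1+ i)
  rank-later {i} {l} lo hi = let (lo′ , hi′) = tree-bounds (block-tree i) l lo hi in
    subst (_< rank l) (suc-1 (e i)) lo′ , subst (rank l <_) (suc-1 (e (1+ i))) hi′

  rank-block : ∀ {i l} → InBlock i l → InBlock i (rank l)
  rank-block {i} in-block = by-place (place in-block)
    where
    by-place : ∀ {l} → Place i l → InBlock i (rank l)
    by-place first         = subst (InBlock i) (sym (rank-first i)) (e-increasing (i<suc[i] i) , ≤-refl)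
    by-place (later lo hi) = let (lo′ , hi′) = rank-later lo hi in lo′ , <⇒≤ hi′

  -- The entry `w l` stands in `v` at the position `rank l`, and `m i` is a left-to-right maximum of
  -- `v`. This is how a comparison of ranks yields one of entries.
  value<m : ∀ {l i} → rank l < e i → w l < m i
  value<m {l} {i} lt = subst (_< m i) (to-rank l) (member-max M I i (rank l) lt)

  -- Each pair of positions is classified with evidence for either answer. This gives both fields of
  -- `Postorder`, and also the injectivity of `w`, which at this point is merely a function.
  pair : ∀ {l l′} → l < l′ → PostorderPair {w} {rank} l l′
  pair {l} {l′} l<l′ = by-blocks (locate l) (locate l′)
    where
    same-block : ∀ i {l l′} → l < l′ → Place i l → Place i l′ → PostorderPair {w} {rank} l l′
    same-block i l<l′ first first = contradiction l<l′ (<-irrefl refl)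
    same-block i l<l′ (later lo _) first = contradiction l<l′ (<-asym lo)
    same-block i l<l′ (later lo _) (later _ hi) = tree-postorder (block-tree i) lo l<l′ hi
    same-block i {l′ = l′} l<l′ first (later lo hi) = inj₁
      (subst (rank l′ <_) (sym (rank-first i)) (proj₂ (rank-later lo hi)) ,
       λ k l<k k≤l′ → subst (w k <_) (sym (start i))
         (value<m (proj₂ (rank-later l<k (≤-<-trans k≤l′ hi)))))

    -- The first entry of the block of l′ exceeds everything before that block.
    later-block : ∀ {i j} → InBlock i l → InBlock j l′ → i < j → PostorderPair {w} {rank} l l′
    later-block {i} {j} l∈i l′∈j i<j = inj₂ (≤-<-trans rank≤ (proj₁ (rank-block l′∈j)) ,
      λ dom → <-asym (value<m {l} {1+ j} (≤-<-trans rank≤ (e-increasing (i<suc[i] j))))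
        (subst (_< w l) (start j) (dom (1+ (e j)) (≤⇒<suc l≤ej) (i<j⇒suc[i]≤j (proj₁ l′∈j)))))
      where
      suc-i≤j : 1+ i ≤ j
      suc-i≤j = i<j⇒suc[i]≤j i<j
      l≤ej : l ≤ e j
      l≤ej = ≤-trans (proj₂ l∈i) (e-monotone suc-i≤j)
      rank≤ : rank l ≤ e j
      rank≤ = ≤-trans (proj₂ (rank-block l∈i)) (e-monotone suc-i≤j)

    by-blocks : (∃ λ i → InBlock i l) → (∃ λ i → InBlock i l′) → PostorderPair {w} {rank} l l′
    by-blocks (i , l∈i) (j , l′∈j) with <-cmp i j
    ... | tri< i<j _ _  = later-block l∈i l′∈j i<j
    ... | tri≈ _ refl _ = same-block i l<l′ (place l∈i) (place l′∈j)
    ... | tri> _ _ j<i  = contradiction l<l′ (≤⇒≯ (≤-trans (proj₂ l′∈j)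
      (≤-trans (e-monotone (i<j⇒suc[i]≤j j<i)) (<⇒≤ (proj₁ l∈i)))))

  postorder : Postorder w rank
  postorder = record { dominated = dominated ; inverted = inverted }
    where
    dominated : ∀ {i j} → i < j → rank j < rank i → Dominates w i j
    dominated i<j lt with pair i<j
    ... | inj₁ (_ , dom) = dom
    ... | inj₂ (gt , _)  = contradiction lt (<-asym gt)
    inverted : ∀ {i j} → i < j → Dominates w i j → rank j < rank i
    inverted i<j dom with pair i<j
    ... | inj₁ (lt , _)   = lt
    ... | inj₂ (_ , ¬dom) = contradiction dom ¬dom

  private
    ranks-differ : ∀ {i j} → i < j → w i ≢ w j
    ranks-differ i<j eq with pair i<j
    ... | inj₁ (lt , _) = <⇒≢ lt (cong (from v) (sym eq))
    ... | inj₂ (lt , _) = <⇒≢ lt (cong (from v) eq)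

  w-injective : ∀ {i j} → w i ≡ w j → i ≡ j
  w-injective {i} {j} eq with <-cmp i j
  ... | tri< i<j _ _ = contradiction eq (ranks-differ i<j)
  ... | tri≈ _ i≡j _ = i≡j
  ... | tri> _ _ j<i = contradiction (sym eq) (ranks-differ j<i)

  w-surjective : ∀ y → ∃ λ l → w l ≡ y
  w-surjective y = by-block (locate (from v y))
    where
    from-rank : ∀ {l} → rank l ≡ from v y → w l ≡ y
    from-rank = from-injective v

    by-block : (∃ λ j → InBlock j (from v y)) → ∃ λ l → w l ≡ y
    by-block (j , lo , hi) with ≤⇒<⊎≡ hi
    ... | inj₂ eq = 1+ (e j) , from-rank (trans (rank-first j) (sym eq))
    ... | inj₁ lt = let (l , _ , _ , eq) = tree-surjective (block-tree j) (from v y)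
                          (subst (_< from v y) (sym (suc-1 (e j))) lo)
                          (subst (from v y <_) (sym (suc-1 (e (1+ j)))) lt)
                    in l , from-rank eq

  extended : ExtendedPerm n
  extended = record
    { fun         = w
    ; inv         = λ y → proj₁ (w-surjective y)
    ; equivariant = equivariant
    ; fun-inv     = λ y → proj₂ (w-surjective y)
    ; inv-fun     = λ i → w-injective (proj₂ (w-surjective (w i)))
    }

  rankᵉ : ExtendedPerm n
  rankᵉ = composeᵉ (invertᵉ (forget v)) extended

  -- The blocks 0 to `r - 1` make up a window of length `n`, and `rank` preserves each of them. This
  -- yields the vanishing degree of `rank`, and so the normalisation of `w`.
  rank-window : ∀ l → 1+ (e 0ℤ) ≤ l → l < 1+ (e 0ℤ) + + n →
                1+ (e 0ℤ) ≤ rank l × rank l < 1+ (e 0ℤ) + + n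
  rank-window l lo hi = by-block (locate l)
    where
    end : 1+ (e (+ r)) ≡ 1+ (e 0ℤ) + + n
    end = trans (cong 1+ (e-shift 0ℤ)) (sym (+-assoc 1ℤ (e 0ℤ) (+ n)))

    by-block : (∃ λ i → InBlock i l) → 1+ (e 0ℤ) ≤ rank l × rank l < 1+ (e 0ℤ) + + n
    by-block (i , l∈i@(ei<l , l≤)) =
      i<j⇒suc[i]≤j (≤-<-trans (e-monotone 0≤i) (proj₁ rank∈i)) ,
      subst (rank l <_) end (≤⇒<suc (≤-trans (proj₂ rank∈i) (e-monotone (i<j⇒suc[i]≤j i<r))))
      where
      rank∈i = rank-block l∈i
      0≤i : 0ℤ ≤ i
      0≤i = <suc⇒≤ (e-cancel-< (<-≤-trans (suc[i]≤j⇒i<j lo) l≤))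
      i<r : i < + r
      i<r = e-cancel-< (<-≤-trans ei<l (<suc⇒≤ (subst (l <_) (sym end) hi)))

  perm : AffinePerm n
  perm = normalised n extended (begin
    degree n w
      ≡⟨ windowSum-cong n 1ℤ (λ i → cong (_- i) (sym (to-rank i))) ⟩
    degree n (to v ∘ rank)
      ≡⟨ degree-∘ n (forget v) rankᵉ ⟩
    degree n (to v) + degree n rank
      ≡⟨ cong₂ _+_ (degree-to n v) (degree-window-preserving rankᵉ (1+ (e 0ℤ)) rank-window) ⟩
    0ℤ ∎)

  perm-sorts : AffineStackSortsTo perm v
  perm-sorts = postorder⇒sorts v perm postorder

  max⇒member : ∀ {y} → IsLeftToRightMax perm y → T (member y)
  max⇒member {y} max = by-block (locate (from perm y))
    where
    by-place : ∀ {i l} → Place i l → w l ≡ y → (∀ p → p < l → w p < y) → T (member y)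
    by-place {i} first w≡ _ = subst (T ∘ member) (trans (sym (start i)) w≡) (sound (1+ i))
    by-place {i} {l} (later lo hi) w≡ max = contradiction
      (subst₂ _<_ (start i) (sym w≡) (max (1+ (e i)) lo))
      (<-asym (value<m (proj₂ (rank-later lo hi))))

    by-block : (∃ λ i → InBlock i (from perm y)) → T (member y)
    by-block (i , l∈i) = by-place (place l∈i) (to-from perm y) max

  member⇒max : ∀ {y} → T (member y) → IsLeftToRightMax perm y
  member⇒max {y} y∈M p p<l = subst (w p <_) mj≡y (value<m (by-block (locate p)))
    where
    j = proj₁ (complete y y∈M)
    mj≡y = proj₂ (complete y y∈M)
    j-1 = ℤ.pred j

    l≡ : from perm y ≡ 1+ (e j-1)
    l≡ = w-injective (trans (to-from perm y) (trans (sym mj≡y)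
      (trans (cong m (sym (suc-pred j))) (sym (start j-1)))))

    by-block : (∃ λ i → InBlock i p) → rank p < e j
    by-block (i , p∈i@(ei<p , _)) = ≤-<-trans (proj₂ (rank-block p∈i))
      (subst (λ k → e (1+ i) < e k) (suc-pred j) (e-increasing (suc-<
        (e-cancel-< (<-≤-trans ei<p (<suc⇒≤ (subst (p <_) l≡ p<l)))))))

-- From a preimage of `v` to filled blocks

module ToFilled {n : ℕ} .{{_ : NonZero n}} {v : AffinePerm n} {M : SkySet v} (I : Indexing M)
                (w : AffinePerm n) (post : Postorder (to w) (from v ∘ to w))
                (member⇒max : ∀ y → T (SkySet.member M y) → IsLeftToRightMax w y)
                (max⇒member : ∀ y → IsLeftToRightMax w y → T (SkySet.member M y)) where

  open SkySet M using (member)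
  open Indexing I using (m; increasing; sound; complete; r)
  open Blocks I
  open Postorder post

  private
    u : AffinePerm n
    u = compose n (invert n v) w

    x : ℤ → ℤ
    x i = from w (m i)

    to-x : ∀ i → to w (x i) ≡ m i
    to-x i = to-from w (m i)

    u-x : ∀ i → to u (x i) ≡ e i
    u-x i = cong (from v) (to-x i)

    <m : ∀ i p → p < x i → to w p < m i
    <m i = member⇒max (m i) (sound i)

    x-increasing : ∀ {i j} → i < j → x i < x j
    x-increasing {i} i<j = max-increasing w (<m i) (increasing i<j)

    x-cancel-< : ∀ {i j} → x i < x j → i < j
    x-cancel-< {i} {j} xi<xj with <-cmp i j
    ... | tri< lt _ _   = lt
    ... | tri≈ _ refl _ = contradiction xi<xj (<-irrefl refl)
    ... | tri> _ _ gt   = contradiction xi<xj (<-asym (x-increasing gt))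

    preserves : ∀ i → Preserves (x i) (to u)
    preserves i = no-inversion-across⇒preserves (x i) u λ {p} {q} p<x x≤q →
      ≮⇒> u (λ eq → <⇒≢ (<-≤-trans p<x x≤q) (sym eq)) λ lt →
        <-asym (<m i p p<x)
          (subst (_< to w p) (to-x i) (dominated (<-≤-trans p<x x≤q) lt (x i) p<x x≤q))

    -- The first entry between two consecutive left-to-right maxima that
    -- exceeds the former would itself be a left-to-right maximum.
    between-maxima : ∀ i k → x i < k → k < x (1+ i) → to w k < m i
    between-maxima i k xi<k k<x′ = by-least (least (λ k → m i <? to w k) (1+ (x i)) (x (1+ i)))
      where
      Exceeds : ℤ → Set
      Exceeds k = m i < to w k
      by-least : LeastIn Exceeds (1+ (x i)) (x (1+ i)) ⊎ NoneIn Exceeds (1+ (x i)) (x (1+ i)) →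
                 to w k < m i
      by-least (inj₂ none) = ≤∧≢⇒< (≮⇒≥ (none k (i<j⇒suc[i]≤j xi<k) k<x′))
        (λ eq → <⇒≢ xi<k (trans (cong (from w) (sym eq)) (from-to w k)))
      by-least (inj₁ (l , 1+xi≤l , l<x′ , mi<wl , below)) = ⊥-elim (<⇒≱
        (x-cancel-< (subst (x i <_) (sym xj≡l) xi<l))
        (<suc⇒≤ (x-cancel-< (subst (_< x (1+ i)) (sym xj≡l) l<x′))))
        where
        xi<l = suc[i]≤j⇒i<j 1+xi≤l

        smaller : ∀ p → p < l → to w p < to w l
        smaller p p<l with <-cmp p (x i)
        ... | tri< p<xi _ _ = <-trans (<m i p p<xi) mi<wl
        ... | tri≈ _ refl _ = subst (_< to w l) (sym (to-x i)) mi<wl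
        ... | tri> _ _ xi<p = ≤-<-trans (≮⇒≥ (below p (i<j⇒suc[i]≤j xi<p) p<l)) mi<wl

        wl∈M : T (member (to w l))
        wl∈M = max⇒member (to w l) λ p p<l → smaller p (subst (p <_) (from-to w l) p<l)

        xj≡l : x (proj₁ (complete (to w l) wl∈M)) ≡ l
        xj≡l = trans (cong (from w) (proj₂ (complete (to w l) wl∈M))) (from-to w l)

    dominates-between : ∀ i {l} → l < x (1+ i) → Dominates (to w) (x i) l
    dominates-between i l<x′ k xi<k k≤l =
      subst (to w k <_) (sym (to-x i)) (between-maxima i k xi<k (≤-<-trans k≤l l<x′))

    rank-below : ∀ i l → l < x i → to u l < x i
    rank-below i l = proj₁ (preserves i) {l}

    rank-above : ∀ i l → x i ≤ l → x i ≤ to u l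
    rank-above i l = proj₂ (preserves i) {l}

    e<x : ∀ i → e i < x (1+ i)
    e<x i = subst (_< x (1+ i)) (u-x i) (rank-below (1+ i) (x i) (x-increasing (i<suc[i] i)))

    rank≤e : ∀ i l → l < x (1+ i) → x i ≤ l → to u l ≤ e i
    rank≤e i l l<x xi≤l with ≤⇒<⊎≡ xi≤l
    ... | inj₂ xi≡l = ≤-reflexive (trans (cong (to u) (sym xi≡l)) (u-x i))
    ... | inj₁ xi<l = <⇒≤ (subst (to u l <_) (u-x i) (inverted xi<l (dominates-between i l<x)))

    -- As `u` preserves both cuts, `last` is the rank of a position between them; the largest rank
    -- there is that of the first position `x i`, which dominates the rest.
    last≤e : ∀ i last → last < x (1+ i) → x i ≤ last → last ≤ e i
    last≤e i last last<x xi≤last =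
      subst (_≤ e i) (to-from u last) (rank≤e i (from u last) l<x x≤l)
      where
      l<x : from u last < x (1+ i)
      l<x = ≰⇒> λ x≤l → <⇒≱ last<x
        (subst (x (1+ i) ≤_) (to-from u last) (rank-above (1+ i) (from u last) x≤l))
      x≤l : x i ≤ from u last
      x≤l = ≮⇒≥ λ l<x → <⇒≱
        (subst (_< x i) (to-from u last) (rank-below i (from u last) l<x)) xi≤last

    -- The rank `e i` is the largest in the interval from `x i` up to `x (1+ i)`, and this interval
    -- is preserved, so `e i` is its last position. Thus the blocks given by the maxima of `w` are
    -- those that the skyline cuts out in `v`.
    suc-e≡x : ∀ i → 1+ (e i) ≡ x (1+ i)
    suc-e≡x i = ≤-antisym (i<j⇒suc[i]≤j (e<x i))
      (linear 2 (λ x e → κ -1ℤ :+ x :≤ e ∷ [] ⊢ x :≤ :1+ e) (x (1+ i)) (e i)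
        (last≤e i (ℤ.pred (x (1+ i))) (pred< (x (1+ i))) (i<j⇒i≤pred[j] (x-increasing (i<suc[i] i)))))
      where
      pred< : ∀ y → ℤ.pred y < y
      pred< y = linear 1 (λ y → [] ⊢ κ -1ℤ :+ y :< y) y

    block-tree : ∀ i → Tree (to w) (to u) 1ℤ (1+ (e i)) (1+ (e (1+ i)))
    block-tree i = postorder⇒tree (to-injective u) post (proj₁ (length-bound a<b)) a<b (proj₂ (length-bound a<b))
      (λ _ k<l _ eq → <⇒≢ k<l (to-injective w eq)) inside
      where
      a = 1+ (e i)
      b = 1+ (e (1+ i))
      a<b : a < b
      a<b = suc-< (e-increasing (i<suc[i] i))

      inside : ∀ l → a < l → l < b → a - 1ℤ < to u l × to u l < b - 1ℤ
      inside l a<l l<b =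
        linear 2 (λ a y → a :≤ y ∷ [] ⊢ a :- κ 1ℤ :< y) a (to u l)
          (subst (_≤ to u l) (sym (suc-e≡x i))
            (proj₂ (preserves (1+ i)) (subst (_≤ l) (suc-e≡x i) (<⇒≤ a<l)))) ,
        -- The last rank of the block is already taken by its first position.
        ≤∧≢⇒< (linear 2 (λ b y → y :< b ∷ [] ⊢ y :≤ b :- κ 1ℤ) b (to u l)
            (subst (to u l <_) (sym (suc-e≡x (1+ i)))
              (proj₁ (preserves (1+ (1+ i))) (subst (l <_) (suc-e≡x (1+ i)) l<b))))
          (λ eq → <⇒≢ a<l (trans (suc-e≡x i) (to-injective u
            (trans (u-x (1+ i)) (trans (sym (suc-1 (e (1+ i)))) (sym eq))))))

    between-unique : ∀ a b → Unique (map (to w) (between a b))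
    between-unique a b = Unique.map⁺ (to-injective w) (Unique.map⁺
      (λ {k} {l} eq → ℤ.+-injective (linear 3 (λ a k l → a :+ k :≡ a :+ l ∷ [] ⊢ k :≡ l) (1+ a) (+ k) (+ l) eq))
      (Unique.upTo⁺ ∣ b - 1+ a ∣))

  filled : Filled (to w)
  filled = record
    { equivariant = AffinePerm.shift w
    ; start       = λ i → trans (cong (to w) (suc-e≡x i)) (to-x (1+ i))
    ; distinct    = λ k → let i = + suc (toℕ k) in between-unique (1+ (e i)) (1+ (e (1+ i)))
    ; sorts       = λ k → let i = + suc (toℕ k) in trans
        (tree⇒stackSort {v = to v} (λ l → to-from v (to w l)) (block-tree i))
        (cong (map (to v)) (cong₂ between (suc-1 (e i)) (suc-1 (e (1+ i)))))
    }

-- `fill` never reads the default `0ℤ`: a word has as many letters as its block has positions after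
-- the first.
nth : List ℤ → ℕ → ℤ
nth []       _       = 0ℤ
nth (x ∷ xs) zero    = x
nth (x ∷ xs) (suc c) = nth xs c

applyUpTo-nth : ∀ {f : ℕ → ℤ} xs → (∀ c → c ℕ.< length xs → f c ≡ nth xs c) → applyUpTo f (length xs) ≡ xs
applyUpTo-nth []       _  = refl
applyUpTo-nth (x ∷ xs) eq = cong₂ _∷_ (eq 0 (s≤s z≤n)) (applyUpTo-nth xs (λ c c< → eq (suc c) (s≤s c<)))

-- Filling the blocks with chosen words

module Filling {n : ℕ} .{{_ : NonZero n}} {v : AffinePerm n} {M : SkySet v} (I : Indexing M)
               (h : ∀ k → StackSortPreimage (zAt I k)) where

  open Indexing I using (m; r; r-shift)
  open Blocks I

  word : Fin r → List ℤ
  word k = StackSortPreimage.word (h k)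

  -- The second argument is the distance from the first position of block `i`. Blocks of a period
  -- are numbered from 1 and residues from 0, hence `i - 1ℤ`; the quotient counts the periods by
  -- which the letters are translated.
  entry : ℤ → ℕ → ℤ
  entry i zero    = m (1+ i)
  entry i (suc c) = nth (word (residue r (i - 1ℤ))) c + (i - 1ℤ) /ℕ r * + n

  fill : ℤ → ℤ
  fill l = let i = proj₁ (locate l) in entry i ∣ l - 1+ (e i) ∣

  fill-block : ∀ i l → InBlock i l → fill l ≡ entry i ∣ l - 1+ (e i) ∣
  fill-block i l l∈i = cong (λ i → entry i ∣ l - 1+ (e i) ∣) (block-unique (proj₂ (locate l)) l∈i)

  private
    entry-shift : ∀ i c → entry (i + + r) c ≡ entry i c + + n
    entry-shift i zero    = trans (cong m (sym (+-assoc 1ℤ i (+ r)))) (r-shift (1+ i))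
    entry-shift i (suc c) = trans
      (cong₂ (λ k q → nth (word k) c + q * + n) (proj₂ shifted) (proj₁ shifted))
      (suc-multiple (nth (word k) c) q)
      where
      k = residue r (i - 1ℤ)
      q = (i - 1ℤ) /ℕ r
      i+r : i + + r - 1ℤ ≡ + toℕ k + 1+ q * + r
      i+r = trans (linear 3 (λ i r x → i :- κ 1ℤ :≡ x ∷ [] ⊢ i :+ r :- κ 1ℤ :≡ x :+ r)
          i (+ r) (+ toℕ k + q * + r) (residue-quotient r (i - 1ℤ)))
        (sym (suc-multiple (+ toℕ k) q))
      shifted : (i + + r - 1ℤ) /ℕ r ≡ 1+ q × residue r (i + + r - 1ℤ) ≡ k
      shifted = residue-quotient-unique r k (1+ q) i+r

    fill-equivariant : Equivariant n fill
    fill-equivariant l = by-block (locate l)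
      where
      by-block : (∃ λ i → InBlock i l) → fill (l + + n) ≡ fill l + + n
      by-block (i , l∈i@(ei<l , l≤)) = begin
        fill (l + + n)
          ≡⟨ fill-block (i + + r) (l + + n) (subst (_< l + + n) (sym (e-shift i)) (+-monoˡ-< (+ n) ei<l) ,
               subst (l + + n ≤_) (sym (trans (cong e (sym (+-assoc 1ℤ i (+ r)))) (e-shift (1+ i))))
                 (+-monoˡ-≤ (+ n) l≤)) ⟩
        entry (i + + r) ∣ l + + n - 1+ (e (i + + r)) ∣
          ≡⟨ cong (λ d → entry (i + + r) ∣ d ∣) (linear 4
               (λ l n e e′ → e :+ n :≡ e′ ∷ [] ⊢ l :+ n :- :1+ e′ :≡ l :- :1+ e)
               l (+ n) (e i) (e (i + + r)) (sym (e-shift i))) ⟩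
        entry (i + + r) ∣ l - 1+ (e i) ∣
          ≡⟨ entry-shift i ∣ l - 1+ (e i) ∣ ⟩
        entry i ∣ l - 1+ (e i) ∣ + + n
          ≡⟨ cong (_+ + n) (fill-block i l l∈i) ⟨
        fill l + + n ∎

    fill-start : ∀ i → fill (1+ (e i)) ≡ m (1+ i)
    fill-start i = trans
      (fill-block i (1+ (e i)) (i<suc[i] (e i) , i<j⇒suc[i]≤j (e-increasing (i<suc[i] i))))
      (cong (λ d → entry i ∣ d ∣) (+-inverseʳ (1+ (e i))))

  fill-word : ∀ k → map fill (interior (+ suc (toℕ k))) ≡ word k
  fill-word k = begin
    map fill (interior i)
      ≡⟨ List.map-∘ (upTo ∣ 1+ (e (1+ i)) - 1+ (1+ (e i)) ∣) ⟨
    map at (upTo ∣ 1+ (e (1+ i)) - 1+ (1+ (e i)) ∣)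
      ≡⟨ cong (λ p → map at (upTo p)) length≡ ⟩
    map at (upTo (length (word k)))
      ≡⟨ List.map-upTo at (length (word k)) ⟩
    applyUpTo at (length (word k))
      ≡⟨ applyUpTo-nth (word k) at-nth ⟩
    word k ∎
    where
    i = + suc (toℕ k)
    at : ℕ → ℤ
    at c = fill (1+ (1+ (e i)) + + c)

    length-z : length (word k) ≡ ∣ e (1+ i) - 1+ (e i) ∣
    length-z = begin
      length (word k)  ≡⟨ ↭.↭-length (stackSort-↭ (word k)) ⟨
      length (stackSort (word k))  ≡⟨ cong length (StackSortPreimage.sorts (h k)) ⟩
      length (zAt I k)  ≡⟨ List.length-map (to v) (between (e i) (e (1+ i))) ⟩
      length (between (e i) (e (1+ i)))  ≡⟨ between-length (e i) (e (1+ i)) ⟩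
      ∣ e (1+ i) - 1+ (e i) ∣  ∎

    length≡ : ∣ 1+ (e (1+ i)) - 1+ (1+ (e i)) ∣ ≡ length (word k)
    length≡ = trans (cong ∣_∣ (linear 2 (λ a b → [] ⊢ :1+ b :- (:1+ :1+ a) :≡ b :- :1+ a)
      (e i) (e (1+ i)))) (sym length-z)

    end : + length (word k) ≡ e (1+ i) - 1+ (e i)
    end = trans (cong +_ length-z)
      (0≤i⇒+∣i∣≡i (i≤j⇒0≤j-i (i<j⇒suc[i]≤j (e-increasing (i<suc[i] i)))))

    fundamental : (i - 1ℤ) /ℕ r ≡ 0ℤ × residue r (i - 1ℤ) ≡ k
    fundamental = residue-quotient-unique r k 0ℤ
      (linear 1 (λ k → [] ⊢ :1+ k :- κ 1ℤ :≡ k :+ κ 0ℤ) (+ toℕ k))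

    at-nth : ∀ c → c ℕ.< length (word k) → at c ≡ nth (word k) c
    at-nth c c< = begin
      at c
        ≡⟨ fill-block i (1+ (1+ (e i)) + + c)
             (linear 2 (λ a c → κ 0ℤ :≤ c ∷ [] ⊢ a :< :1+ :1+ a :+ c) (e i) (+ c) (+≤+ z≤n) ,
              linear 4 (λ a b c p → c :< p ∷ p :≡ b :- :1+ a ∷ [] ⊢ :1+ :1+ a :+ c :≤ b)
                (e i) (e (1+ i)) (+ c) (+ length (word k)) (+<+ c<) end) ⟩
      entry i ∣ 1+ (1+ (e i)) + + c - 1+ (e i) ∣
        ≡⟨ cong (λ d → entry i ∣ d ∣)
             (linear 2 (λ a c → [] ⊢ :1+ :1+ a :+ c :- :1+ a :≡ :1+ c) (e i) (+ c)) ⟩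
      entry i (suc c)
        ≡⟨ cong₂ (λ k q → nth (word k) c + q * + n) (proj₂ fundamental) (proj₁ fundamental) ⟩
      nth (word k) c + 0ℤ * + n
        ≡⟨ +-identityʳ (nth (word k) c) ⟩
      nth (word k) c ∎

  filled : Filled fill
  filled = record
    { equivariant = fill-equivariant
    ; start       = fill-start
    ; distinct    = λ k → subst Unique (sym (fill-word k)) (StackSortPreimage.distinct (h k))
    ; sorts       = λ k → trans (cong stackSort (fill-word k)) (StackSortPreimage.sorts (h k))
    }

module _ {n : ℕ} .{{_ : NonZero n}} {v : AffinePerm n} {M : SkySet v} (I : Indexing M) where

  open Indexing I using (r)
  open Blocks I

  filled-unique : ∀ {w w′} → Filled w → Filled w′ →
    (∀ (k : Fin r) → map w (interior (+ suc (toℕ k))) ≡ map w′ (interior (+ suc (toℕ k)))) →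
    w ≗ w′
  filled-unique {w} {w′} F F′ same l = by-block (locate l)
    where
    module F  = Filled F
    module F′ = Filled F′

    fundamental : ∀ k {l} → InBlock (+ suc (toℕ k)) l → w l ≡ w′ l
    fundamental k (lo , hi) with ≤⇒<⊎≡ (i<j⇒suc[i]≤j lo)
    ... | inj₁ lt   = map-between-injective (same k) lt (≤⇒<suc hi)
    ... | inj₂ refl = trans (F.start (+ suc (toℕ k))) (sym (F′.start (+ suc (toℕ k))))

    by-block : (∃ λ i → InBlock i l) → w l ≡ w′ l
    by-block (i , ei<l , l≤) = begin
      w l  ≡⟨ cong w l≡ ⟨
      w (l₀ + t * + n)  ≡⟨ equivariant-* w F.equivariant l₀ t ⟩
      w l₀ + t * + n  ≡⟨ cong (_+ t * + n) (fundamental k (lo , hi)) ⟩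
      w′ l₀ + t * + n  ≡⟨ equivariant-* w′ F′.equivariant l₀ t ⟨
      w′ (l₀ + t * + n)  ≡⟨ cong w′ l≡ ⟩
      w′ l  ∎
      where
      k = residue r (i - 1ℤ)
      t = (i - 1ℤ) /ℕ r
      i₀ = + suc (toℕ k)
      l₀ = l - t * + n

      l≡ : l₀ + t * + n ≡ l
      l≡ = linear 2 (λ l a → [] ⊢ l :- a :+ a :≡ l) l (t * + n)

      i≡ : i ≡ i₀ + t * + r
      i≡ = linear 3 (λ i k q → i :- κ 1ℤ :≡ k :+ q ∷ [] ⊢ i :≡ :1+ k :+ q)
        i (+ toℕ k) (t * + r) (residue-quotient r (i - 1ℤ))

      lo : e i₀ < l₀
      lo = linear 3 (λ x a l → x :+ a :< l ∷ [] ⊢ x :< l :- a) (e i₀) (t * + n) l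
        (subst (_< l) (trans (cong e i≡) (e-* i₀ t)) ei<l)

      hi : l₀ ≤ e (1+ i₀)
      hi = linear 3 (λ x a l → l :≤ x :+ a ∷ [] ⊢ l :- a :≤ x) (e (1+ i₀)) (t * + n) l
        (subst (l ≤_) (trans (cong (e ∘ 1+) i≡)
          (trans (cong e (sym (+-assoc 1ℤ i₀ (t * + r)))) (e-* (1+ i₀) t))) l≤)

-- The indexing of a skyline

module BuildIndexing {n : ℕ} .{{_ : NonZero n}} {v : AffinePerm n} (M : SkySet v) where

  open SkySet M using (member; maxima)

  IsNext IsPrev : ℤ → ℤ → Set
  IsPrev q p = p < q × Marked M p × (∀ l → p < l → l < q → ¬ Marked M l)
  IsNext p q = p < q × Marked M q × (∀ l → p < l → l < q → ¬ Marked M l)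

  next-exists : ∀ p → ∃ (IsNext p)
  next-exists p = by-least (least (Marked? M) (1+ p) (1+ p + + n))
    where
    by-least : LeastIn (Marked M) (1+ p) (1+ p + + n) ⊎ NoneIn (Marked M) (1+ p) (1+ p + + n) →
               ∃ (IsNext p)
    by-least (inj₁ (q , p<q , _ , marked , none)) =
      q , suc[i]≤j⇒i<j p<q , marked , λ l p<l → none l (i<j⇒suc[i]≤j p<l)
    by-least (inj₂ none) = let (q , lo , hi , marked) = marked-in-window M (1+ p) in
      contradiction marked (none q lo hi)

  prev-exists : ∀ q → ∃ (IsPrev q)
  prev-exists q = by-greatest (greatest (Marked? M) (q - + n) q)
    where
    by-greatest : GreatestIn (Marked M) (q - + n) q ⊎ NoneIn (Marked M) (q - + n) q → ∃ (IsPrev q)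
    by-greatest (inj₁ (p , _ , found)) = p , found
    by-greatest (inj₂ none) = let (p , lo , hi , marked) = marked-in-window M (q - + n) in
      contradiction marked (none p lo (subst (p <_) (linear 2 (λ l n → [] ⊢ l :- n :+ n :≡ l) q (+ n)) hi))

  next prev : ℤ → ℤ
  next p = proj₁ (next-exists p)
  prev q = proj₁ (prev-exists q)

  is-next : ∀ p → IsNext p (next p)
  is-next p = proj₂ (next-exists p)

  next-unique : ∀ {p q q′} → IsNext p q → IsNext p q′ → q ≡ q′
  next-unique {p} {q} {q′} (p<q , marked , none) (p<q′ , marked′ , none′) with <-cmp q q′
  ... | tri< q<q′ _ _ = contradiction marked (none′ q p<q q<q′)
  ... | tri≈ _ eq _   = eq
  ... | tri> _ _ q′<q = contradiction marked′ (none q′ p<q′ q′<q)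

  -- The downward half of the induction for `pos-shift` has to cancel `next`.
  next-injective : ∀ {p q} → Marked M p → Marked M q → next p ≡ next q → p ≡ q
  next-injective {p} {q} p∈ q∈ eq with <-cmp p q
  ... | tri< p<q _ _ = contradiction q∈ (proj₂ (proj₂ (is-next p)) q p<q (subst (q <_) (sym eq) (proj₁ (is-next q))))
  ... | tri≈ _ p≡q _ = p≡q
  ... | tri> _ _ q<p = contradiction p∈ (proj₂ (proj₂ (is-next q)) p q<p (subst (p <_) eq (proj₁ (is-next p))))

  next-prev : ∀ {q} → Marked M q → next (prev q) ≡ q
  next-prev {q} q∈ = let (p<q , _ , none) = proj₂ (prev-exists q) in next-unique (is-next (prev q)) (p<q , q∈ , none)

  marked-+ : ∀ p → member (to v (p + + n)) ≡ member (to v p)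
  marked-+ p = trans (cong member (AffinePerm.shift v p)) (SkySet.periodic M (to v p))

  next-shift : ∀ p → next (p + + n) ≡ next p + + n
  next-shift p = next-unique (is-next (p + + n))
    (+-monoˡ-< (+ n) p<q , subst T (sym (marked-+ (next p))) marked , λ l lo hi l∈ →
      none (l - + n) (linear 3 (λ p n l → p :+ n :< l ∷ [] ⊢ p :< l :- n) p (+ n) l lo)
        (linear 3 (λ q n l → l :< q :+ n ∷ [] ⊢ l :- n :< q) (next p) (+ n) l hi)
        (subst T (trans (cong (member ∘ to v) (linear 2 (λ l n → [] ⊢ l :≡ l :- n :+ n) l (+ n)))
          (marked-+ (l - + n))) l∈))
    where
    p<q = proj₁ (is-next p)
    marked = proj₁ (proj₂ (is-next p))
    none = proj₂ (proj₂ (is-next p))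

  -- `pos i` becomes the position of `m (1+ i)`. The base `prev (+ 2)` is the last marked position
  -- not exceeding 1, as the convention for `m₁` demands.
  pos : ℤ → ℤ
  pos (+ zero)     = prev (+ 2)
  pos (+ suc k)    = next (pos (+ k))
  pos -[1+ zero ]  = prev (pos 0ℤ)
  pos -[1+ suc k ] = prev (pos -[1+ k ])

  pos-marked : ∀ i → Marked M (pos i)
  pos-marked (+ zero)     = proj₁ (proj₂ (proj₂ (prev-exists (+ 2))))
  pos-marked (+ suc k)    = proj₁ (proj₂ (is-next (pos (+ k))))
  pos-marked -[1+ zero ]  = proj₁ (proj₂ (proj₂ (prev-exists (pos 0ℤ))))
  pos-marked -[1+ suc k ] = proj₁ (proj₂ (proj₂ (prev-exists (pos -[1+ k ]))))

  pos-suc : ∀ i → pos (1+ i) ≡ next (pos i)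
  pos-suc (+ k)        = refl
  pos-suc -[1+ zero ]  = sym (next-prev (pos-marked 0ℤ))
  pos-suc -[1+ suc k ] = sym (next-prev (pos-marked -[1+ k ]))

  pos-step : ∀ i → pos i < pos (1+ i)
  pos-step i = subst (pos i <_) (sym (pos-suc i)) (proj₁ (is-next (pos i)))

  pos-growth : ∀ i {j} → i ≤ j → pos i + (j - i) ≤ pos j
  pos-growth i = upward (λ j → pos i + (j - i) ≤ pos j) i
    (linear 2 (λ a i → [] ⊢ a :+ (i :- i) :≤ a) (pos i) i)
    (λ j _ le → linear 5
      (λ a b c i j → a :+ (j :- i) :≤ b ∷ b :< c ∷ [] ⊢ a :+ (:1+ j :- i) :≤ c)
      (pos i) (pos j) (pos (1+ j)) i j le (pos-step j))

  pos-increasing : ∀ {i j} → i < j → pos i < pos j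
  pos-increasing {i} {j} i<j = linear 4
    (λ a b i j → a :+ (j :- i) :≤ b ∷ i :< j ∷ [] ⊢ a :< b) (pos i) (pos j) i j
    (pos-growth i (<⇒≤ i<j)) i<j

  -- Positions grow by at least one per index, so the distance from `pos 0ℤ` to `p` bounds the
  -- index, and the last index with `pos i ≤ p` can be found by a bounded search.
  pos-complete : ∀ {p} → Marked M p → ∃ λ i → pos i ≡ p
  pos-complete {p} p∈ = by-greatest (greatest (λ i → pos i ≤? p) -K K)
    where
    d = + ∣ p - pos 0ℤ ∣
    K -K : ℤ
    K = 1+ d
    -K = 0ℤ - d

    0≤d : 0ℤ ≤ d
    0≤d = +≤+ z≤n

    p-b≤d : p - pos 0ℤ ≤ d
    p-b≤d = ≤∣∣ (p - pos 0ℤ)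
      where
      ≤∣∣ : ∀ x → x ≤ + ∣ x ∣
      ≤∣∣ (+ _)    = ≤-refl
      ≤∣∣ -[1+ _ ] = -≤+

    b-p≤d : pos 0ℤ - p ≤ d
    b-p≤d = subst (_≤ d) (linear 2 (λ p b → [] ⊢ κ 0ℤ :- (p :- b) :≡ b :- p) p (pos 0ℤ))
      (-≤∣∣ (p - pos 0ℤ))
      where
      -≤∣∣ : ∀ x → 0ℤ - x ≤ + ∣ x ∣
      -≤∣∣ (+ zero)   = ≤-refl
      -≤∣∣ (+ suc _)  = -≤+
      -≤∣∣ -[1+ _ ]   = ≤-refl

    low : pos -K ≤ p
    low = linear 4 (λ a b p d → a :+ (κ 0ℤ :- (κ 0ℤ :- d)) :≤ b ∷ b :- p :≤ d ∷ [] ⊢ a :≤ p)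
      (pos -K) (pos 0ℤ) p d
      (pos-growth -K {0ℤ} (linear 1 (λ d → κ 0ℤ :≤ d ∷ [] ⊢ κ 0ℤ :- d :≤ κ 0ℤ) d 0≤d)) b-p≤d

    high : p < pos K
    high = linear 4 (λ a b p d → b :+ (:1+ d :- κ 0ℤ) :≤ a ∷ p :- b :≤ d ∷ [] ⊢ p :< a)
      (pos K) (pos 0ℤ) p d
      (pos-growth 0ℤ {K} (linear 1 (λ d → κ 0ℤ :≤ d ∷ [] ⊢ κ 0ℤ :≤ :1+ d) d 0≤d)) p-b≤d

    by-greatest : GreatestIn (λ i → pos i ≤ p) -K K ⊎ NoneIn (λ i → pos i ≤ p) -K K →
                  ∃ λ i → pos i ≡ p
    by-greatest (inj₂ none) = contradiction low (none -K ≤-refl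
      (linear 1 (λ d → κ 0ℤ :≤ d ∷ κ 0ℤ :≤ d ∷ [] ⊢ κ 0ℤ :- d :< :1+ d) d 0≤d 0≤d))
    by-greatest (inj₁ (i , _ , i<K , ≤p , above)) = i , equal (≤⇒<⊎≡ ≤p)
      where
      p<next : p < pos (1+ i)
      p<next with ≤⇒<⊎≡ (i<j⇒suc[i]≤j i<K)
      ... | inj₁ lt = ≰⇒> (above (1+ i) (i<suc[i] i) lt)
      ... | inj₂ eq = subst (λ j → p < pos j) (sym eq) high
      equal : pos i < p ⊎ pos i ≡ p → pos i ≡ p
      equal (inj₂ eq) = eq
      equal (inj₁ lt) = contradiction p∈ (proj₂ (proj₂ (is-next (pos i))) p lt
        (subst (p <_) (pos-suc i) p<next))

  -- By periodicity `pos 0ℤ + + n` is marked, so it has an index, and this is positive because `pos`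
  -- is increasing.
  period : ∃ λ r → NonZero r × pos (+ r) ≡ pos 0ℤ + + n
  period = by-index (pos-complete (subst T (sym (marked-+ (pos 0ℤ))) (pos-marked 0ℤ)))
    where
    by-index : (∃ λ i → pos i ≡ pos 0ℤ + + n) →
               ∃ λ r → NonZero r × pos (+ r) ≡ pos 0ℤ + + n
    by-index (+ suc r , eq) = suc r , record { nonZero = tt } , eq
    by-index (i@(+ zero) , eq) = contradiction eq (<⇒≢ b<b+n)
      where
      b<b+n : pos 0ℤ < pos 0ℤ + + n
      b<b+n = linear 2 (λ b n → κ 0ℤ :< n ∷ [] ⊢ b :< b :+ n) (pos 0ℤ) (+ n) (+<+ (ℕ.>-nonZero⁻¹ n))
    by-index (i@(-[1+ k ]) , eq) = ⊥-elim (linear 3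
      (λ a b n → a :< b ∷ b :+ n :≡ a ∷ κ 0ℤ :≤ n ∷ [] ⊢ :⊥) (pos i) (pos 0ℤ) (+ n)
      (pos-increasing { -[1+ k ]} {0ℤ} -<+) (sym eq) (+≤+ z≤n))

  r : ℕ
  r = proj₁ period

  pos-shift : ∀ i → pos (i + + r) ≡ pos i + + n
  pos-shift = ℤ-induction _ (proj₂ (proj₂ period))
    (λ i eq → begin
      pos (1+ i + + r)  ≡⟨ cong pos (+-assoc 1ℤ i (+ r)) ⟩
      pos (1+ (i + + r))  ≡⟨ pos-suc (i + + r) ⟩
      next (pos (i + + r))  ≡⟨ cong next eq ⟩
      next (pos i + + n)  ≡⟨ next-shift (pos i) ⟩
      next (pos i) + + n  ≡⟨ cong (_+ + n) (pos-suc i) ⟨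
      pos (1+ i) + + n  ∎)
    (λ i eq → next-injective (pos-marked (i + + r))
      (subst T (sym (marked-+ (pos i))) (pos-marked i)) (begin
        next (pos (i + + r))  ≡⟨ pos-suc (i + + r) ⟨
        pos (1+ (i + + r))  ≡⟨ cong pos (+-assoc 1ℤ i (+ r)) ⟨
        pos (1+ i + + r)  ≡⟨ eq ⟩
        pos (1+ i) + + n  ≡⟨ cong (_+ + n) (pos-suc i) ⟩
        next (pos i) + + n  ≡⟨ next-shift (pos i) ⟨
        next (pos i + + n)  ∎))

  indexing : Indexing M
  indexing = record
    { m          = m
    ; increasing = increasing
    ; sound      = λ i → pos-marked (i - 1ℤ)
    ; complete   = complete
    ; start₁     = subst (_≤ 1ℤ) (sym (from-m 1ℤ)) (<suc⇒≤ {_} {1ℤ} (proj₁ (proj₂ (prev-exists (+ 2)))))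
    ; start₂     = subst (1ℤ <_) (sym (from-m (+ 2))) (≰⇒> λ le →
        proj₂ (proj₂ (proj₂ (prev-exists (+ 2)))) (next (pos 0ℤ)) (proj₁ (is-next (pos 0ℤ)))
          (≤⇒<suc {_} {1ℤ} le) (proj₁ (proj₂ (is-next (pos 0ℤ)))))
    ; r          = r
    ; r-positive = proj₁ (proj₂ period)
    ; r-shift    = r-shift
    }
    where
    m : ℤ → ℤ
    m i = to v (pos (i - 1ℤ))

    from-m : ∀ i → from v (m i) ≡ pos (i - 1ℤ)
    from-m i = from-to v (pos (i - 1ℤ))

    increasing : ∀ {i j} → i < j → m i < m j
    increasing {i} {j} i<j = maxima (m j) (pos-marked (j - 1ℤ)) (pos (i - 1ℤ))
      (subst (pos (i - 1ℤ) <_) (sym (from-m j)) (pos-increasing (+-monoˡ-< -1ℤ i<j)))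

    complete : ∀ y → T (member y) → ∃ λ i → m i ≡ y
    complete y y∈ = by-index (pos-complete (subst (T ∘ member) (sym (to-from v y)) y∈))
      where
      by-index : (∃ λ i → pos i ≡ from v y) → ∃ λ i → m i ≡ y
      by-index (i , eq) = 1+ i , trans
        (cong (to v) (trans (cong pos (linear 1 (λ i → [] ⊢ :1+ i :- κ 1ℤ :≡ i) i)) eq)) (to-from v y)

    r-shift : ∀ j → m (j + + r) ≡ m j + + n
    r-shift j = trans (cong (to v) (trans
      (cong pos (linear 2 (λ j r → [] ⊢ j :+ r :- κ 1ℤ :≡ j :- κ 1ℤ :+ r) j (+ r)))
      (pos-shift (j - 1ℤ)))) (AffinePerm.shift v (pos (j - 1ℤ)))

-- Finite setoids

module _ (S : Setoid 0ℓ 0ℓ) where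

  private module S = Setoid S

  finite : ∀ {k} (f : Fin k → S.Carrier) → (∀ {i j} → f i S.≈ f j → i ≡ j) →
           (∀ x → ∃ λ i → f i S.≈ x) → Finite S
  finite {k} f f-injective f-surjective = record
    { card        = k
    ; enumeration = record
      { to        = f
      ; cong      = λ { refl → S.refl }
      ; bijective = f-injective , λ x → let (i , fi≈x) = f-surjective x in i , λ { refl → fi≈x }
      }
    }

  -- Every element has a code in the list `as`, and the elements with a given code are all
  -- equivalent. An element may have several codes, so a decoded element is kept only if it is not
  -- equivalent to an earlier one.
  finite-encoded : {A : Set} (R : S.Carrier → A → Set) →
    (∀ {x y a} → R x a → R y a → x S.≈ y) → (∀ x y → Dec (x S.≈ y)) →
    (∀ a → Dec (∃ λ x → R x a)) → (as : List A) → (∀ x → ∃ λ a → a ∈ as × R x a) → Finite S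
  finite-encoded {A} R R-injective _≈?_ decode as encode =
    let (k , f , f-injective , covered) = cover as in finite f f-injective λ x →
      let (a , a∈as , Rxa) = encode x in covered a∈as Rxa
    where
    Cover : List A → Set
    Cover as = ∃ λ k → Σ[ f ∈ (Fin k → S.Carrier) ]
      (∀ {i j} → f i S.≈ f j → i ≡ j) × (∀ {a x} → a ∈ as → R x a → ∃ λ i → f i S.≈ x)

    cover : ∀ as → Cover as
    cover []       = 0 , (λ ()) , (λ { {()} }) , λ ()
    cover (a ∷ as) = extend (decode a) (cover as)
      where
      extend : Dec (∃ λ x → R x a) → Cover as → Cover (a ∷ as)
      extend (no ¬code) (k , f , f-injective , covered) = k , f , f-injective ,
        λ { (here refl) Rxa → contradiction (_ , Rxa) ¬code ; (there a∈as) → covered a∈as }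
      extend (yes (x , Rxa)) (k , f , f-injective , covered) = insert (Fin.any? (λ i → f i ≈? x))
        where
        insert : Dec (∃ λ i → f i S.≈ x) → Cover (a ∷ as)
        insert (yes (i , fi≈x)) = k , f , f-injective ,
          λ { (here refl) Rya → i , S.trans fi≈x (R-injective Rxa Rya) ; (there a∈as) → covered a∈as }
        insert (no new) = suc k , g , g-injective , g-covers
          where
          g : Fin (suc k) → S.Carrier
          g Fin.zero    = x
          g (Fin.suc i) = f i

          g-injective : ∀ {i j} → g i S.≈ g j → i ≡ j
          g-injective {Fin.zero}  {Fin.zero}  _  = refl
          g-injective {Fin.zero}  {Fin.suc j} eq = contradiction (j , S.sym eq) new
          g-injective {Fin.suc i} {Fin.zero}  eq = contradiction (i , eq) new
          g-injective {Fin.suc i} {Fin.suc j} eq = cong Fin.suc (f-injective eq)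

          g-covers : ∀ {b y} → b ∈ a ∷ as → R y b → ∃ λ i → g i S.≈ y
          g-covers (here refl)  Rya = Fin.zero , R-injective Rxa Rya
          g-covers (there b∈as) Ryb = let (i , eq) = covered b∈as Ryb in Fin.suc i , eq

module _ {A : Set} where

  words : List A → ℕ → List (List A)
  words xs zero    = [ [] ]
  words xs (suc p) = cartesianProductWith _∷_ xs (words xs p)

  ∈-words : ∀ {xs} w → All (_∈ xs) w → w ∈ words xs (length w)
  ∈-words []      _             = here refl
  ∈-words (x ∷ w) (x∈xs ∷ w⊆xs) = ∈.∈-cartesianProductWith⁺ _∷_ x∈xs (∈-words w w⊆xs)

  vectors : List A → ∀ p → List (Vec A p)
  vectors xs zero    = [ [] ]
  vectors xs (suc p) = cartesianProductWith _∷_ xs (vectors xs p)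

  ∈-vectors : ∀ {xs p} → (∀ x → x ∈ xs) → (w : Vec A p) → w ∈ vectors xs p
  ∈-vectors listed []      = here refl
  ∈-vectors listed (x ∷ w) = ∈.∈-cartesianProductWith⁺ _∷_ (listed x) (∈-vectors listed w)

-- Stack-sorting rearranges letters, so a preimage is among the words over the letters of `z` that
-- have its length.
stackSort⁻¹-finite : ∀ z → Finite (stackSort⁻¹ z)
stackSort⁻¹-finite z = finite-encoded (stackSort⁻¹ z)
  (λ p w → word p ≡ w) (λ eq eq′ → trans eq (sym eq′)) (λ p q → List.≡-dec ℤ._≟_ (word p) (word q))
  decode (words z (length z))
  (λ p → word p , subst (λ k → word p ∈ words z k) (length≡ p) (∈-words (word p) (All.tabulate (letters p))) , refl)
  where
  open StackSortPreimage

  decode : ∀ w → Dec (∃ λ p → word p ≡ w)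
  decode w = map′ (λ (unique , eq) → record { word = w ; distinct = unique ; sorts = eq } , refl)
    (λ { (p , refl) → distinct p , sorts p })
    (DecUnique.unique? ℤ._≟_ w ×-dec List.≡-dec ℤ._≟_ (stackSort w) z)

  permutation : ∀ p → z ↭ word p
  permutation p = subst (_↭ word p) (sorts p) (stackSort-↭ (word p))

  length≡ : ∀ p → length (word p) ≡ length z
  length≡ p = sym (↭.↭-length (permutation p))

  letters : ∀ p {x} → x ∈ word p → x ∈ z
  letters p = ↭.∈-resp-↭ (↭-sym (permutation p))

module _ {n : ℕ} .{{_ : NonZero n}} (v : AffinePerm n) where

  -- The condition need only be tested on the n preceding positions.
  isLeftToRightMax? : ∀ y → Dec (IsLeftToRightMax v y)
  isLeftToRightMax? y = map′ everywhere nearby (none? (search (λ p → y ≤? to v p) (x - + n) x))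
    where
    x = from v y
    Exceeded : Set
    Exceeded = ∃ λ p → x - + n ≤ p × p < x × y ≤ to v p

    none? : Dec Exceeded → Dec (¬ Exceeded)
    none? (yes found) = no λ none → none found
    none? (no none)   = yes none

    nearby : IsLeftToRightMax v y → ¬ Exceeded
    nearby max (p , _ , p<x , y≤vp) = <⇒≱ (max p p<x) y≤vp

    everywhere : ¬ Exceeded → IsLeftToRightMax v y
    everywhere none p p<x = ≰⇒> λ y≤vp → none (q ,
      linear 3 (λ x k n → k :< n ∷ [] ⊢ x :- n :≤ x :- κ 1ℤ :- k) x (+ toℕ k) (+ n) (+<+ (Fin.toℕ<n k)) ,
      linear 2 (λ x k → κ 0ℤ :≤ k ∷ [] ⊢ x :- κ 1ℤ :- k :< x) x (+ toℕ k) (+≤+ z≤n) ,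
      subst (y ≤_) (trans (sym (to-* v p t)) (cong (to v) (sym q≡)))
        (linear 3 (λ y a b → y :≤ a ∷ κ 0ℤ :≤ b ∷ [] ⊢ y :≤ a :+ b) y (to v p) (t * + n) y≤vp 0≤tn))
      where
      -- `q` is the translate of `p` among the `n` positions before `x`. It lies `t` periods to the
      -- right with `t` nonnegative, so its entry is at least as large as that of `p`.
      k = residue n (x - 1ℤ - p)
      t = (x - 1ℤ - p) /ℕ n
      q = x - 1ℤ - + toℕ k
      q≡ : q ≡ p + t * + n
      q≡ = linear 4 (λ x p k a → x :- κ 1ℤ :- p :≡ k :+ a ∷ [] ⊢ x :- κ 1ℤ :- k :≡ p :+ a)
        x p (+ toℕ k) (t * + n) (residue-quotient n (x - 1ℤ - p))
      0≤t : 0ℤ ≤ t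
      0≤t = ℤ.0≤n⇒0≤n/ℕd (x - 1ℤ - p) n
        (linear 2 (λ x p → p :< x ∷ [] ⊢ κ 0ℤ :≤ x :- κ 1ℤ :- p) x p p<x)
      0≤tn : 0ℤ ≤ t * + n
      0≤tn = subst (_≤ t * + n) (ℤ.*-zeroˡ (+ n)) (*-monoʳ-≤-nonNeg (+ n) 0≤t)

  leftToRightMax-* : ∀ y t → IsLeftToRightMax v y → IsLeftToRightMax v (y + t * + n)
  leftToRightMax-* y t max p p<x = linear 3 (λ a y b → a :- b :< y ∷ [] ⊢ a :< y :+ b) (to v p) y a
    (subst (_< y) vp-a (max (p - a) (linear 3 (λ p x a → p :< x :+ a ∷ [] ⊢ p :- a :< x) p (from v y) a
      (subst (p <_) (from-* v y t) p<x))))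
    where
    a = t * + n
    vp-a : to v (p - a) ≡ to v p - a
    vp-a = linear 3 (λ x y a → x :+ a :≡ y ∷ [] ⊢ x :≡ y :- a) (to v (p - a)) (to v p) a
      (trans (sym (to-* v (p - a) t)) (cong (to v) (linear 2 (λ p a → [] ⊢ p :- a :+ a :≡ p) p a)))

  periodic-residue : ∀ {A : Set} {f : ℤ → A} → Periodic n f → ∀ j → f (+ toℕ (residue n j)) ≡ f j
  periodic-residue {f = f} periodic j = trans (sym (periodic-* f periodic (+ toℕ (residue n j)) (j /ℕ n)))
    (cong f (sym (residue-quotient n j)))

  -- A periodic set is given by its bits on the residues, and translates of left-to-right maxima are
  -- such maxima again, so a vector of `n` bits can be tested for being a skyline.
  Sky-finite : Finite (Sky v)
  Sky-finite = finite-encoded (Sky v) Encodes (λ {M} {M′} {b} → unique {M} {M′} {b}) _≈?_ decode (vectors (true ∷ false ∷ []) n) encode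
    where
    open SkySet

    Encodes : SkySet v → Vec Bool n → Set
    Encodes M b = ∀ i → member M (+ toℕ i) ≡ Vec.lookup b i

    unique : ∀ {M M′ b} → Encodes M b → Encodes M′ b → member M ≗ member M′
    unique {M} {M′} {b} code code′ j = begin
      member M j  ≡⟨ periodic-residue {f = member M} (periodic M) j ⟨
      member M (+ toℕ (residue n j))  ≡⟨ trans (code (residue n j)) (sym (code′ (residue n j))) ⟩
      member M′ (+ toℕ (residue n j))  ≡⟨ periodic-residue {f = member M′} (periodic M′) j ⟩
      member M′ j  ∎

    encode : ∀ M → ∃ λ b → b ∈ vectors (true ∷ false ∷ []) n × Encodes M b
    encode M = b , ∈-vectors (λ { true → here refl ; false → there (here refl) }) b ,
      λ i → sym (Vec.lookup∘tabulate (λ i → member M (+ toℕ i)) i)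
      where b = Vec.tabulate (λ i → member M (+ toℕ i))

    _≈?_ : ∀ M M′ → Dec (member M ≗ member M′)
    M ≈? M′ = map′
      (λ same j → trans (sym (periodic-residue {f = member M} (periodic M) j))
        (trans (same (residue n j)) (periodic-residue {f = member M′} (periodic M′) j)))
      (λ same i → same (+ toℕ i))
      (Fin.all? (λ i → member M (+ toℕ i) Bool.≟ member M′ (+ toℕ i)))

    Valid : Vec Bool n → Set
    Valid b = (∃ λ i → T (Vec.lookup b i)) × (∀ i → T (Vec.lookup b i) → IsLeftToRightMax v (+ toℕ i))

    valid? : ∀ b → Dec (Valid b)
    valid? b = Fin.any? (λ i → T? (Vec.lookup b i)) ×-dec
      Fin.all? (λ i → T? (Vec.lookup b i) →-dec isLeftToRightMax? (+ toℕ i))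

    residue-toℕ : ∀ (i : Fin n) → residue n (+ toℕ i) ≡ i
    residue-toℕ i = proj₂ (residue-quotient-unique n i 0ℤ (sym (+-identityʳ (+ toℕ i))))

    decode : ∀ b → Dec (∃ λ M → Encodes M b)
    decode b = map′ build validate (valid? b)
      where
      build : Valid b → ∃ λ M → Encodes M b
      build ((i , i∈b) , max) = record
        { member   = λ j → Vec.lookup b (residue n j)
        ; periodic = λ j → cong (Vec.lookup b) (shifted j)
        ; nonempty = + toℕ i , subst (T ∘ Vec.lookup b) (sym (residue-toℕ i)) i∈b
        ; maxima   = λ j j∈b → subst (IsLeftToRightMax v) (sym (residue-quotient n j))
            (leftToRightMax-* (+ toℕ (residue n j)) (j /ℕ n) (max (residue n j) j∈b))
        } , λ i → cong (Vec.lookup b) (residue-toℕ i)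
        where
        shifted : ∀ j → residue n (j + + n) ≡ residue n j
        shifted j = proj₂ (residue-quotient-unique n (residue n j) (1+ (j /ℕ n))
          (trans (cong (_+ + n) (residue-quotient n j))
            (sym (suc-multiple (+ toℕ (residue n j)) (j /ℕ n)))))

      validate : (∃ λ M → Encodes M b) → Valid b
      validate (M , code) = (residue n j₀ , subst T (trans (sym (periodic-residue {f = member M} (periodic M) j₀))
          (code (residue n j₀))) (proj₂ (nonempty M))) ,
        λ i i∈b → maxima M (+ toℕ i) (subst T (sym (code i)) i∈b)
        where j₀ = proj₁ (nonempty M)

-- Indices of a sum and of a product

private
  module +↔ {k l : ℕ} = Inverse (Fin.+↔⊎ {k} {l})
  module *↔ {k l : ℕ} = Inverse (Fin.*↔× {k} {l})

∑-pair : ∀ {k} (f : Fin k → ℕ) → Fin (∑Fin k f) → ∃ λ i → Fin (f i)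
∑-pair {suc k} f c with +↔.to {f Fin.zero} c
... | inj₁ j = Fin.zero , j
... | inj₂ d = let (i , j) = ∑-pair (f ∘ Fin.suc) d in Fin.suc i , j

∑-index : ∀ {k} (f : Fin k → ℕ) → (∃ λ i → Fin (f i)) → Fin (∑Fin k f)
∑-index {suc k} f (Fin.zero  , j) = +↔.from {f Fin.zero} (inj₁ j)
∑-index {suc k} f (Fin.suc i , j) = +↔.from {f Fin.zero} (inj₂ (∑-index (f ∘ Fin.suc) (i , j)))

∑-index-pair : ∀ {k} (f : Fin k → ℕ) c → ∑-index f (∑-pair f c) ≡ c
∑-index-pair {suc k} f c with +↔.to {f Fin.zero} c in eq
... | inj₁ j = trans (cong (+↔.from {f Fin.zero}) (sym eq)) (+↔.strictlyInverseʳ {f Fin.zero} c)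
... | inj₂ d = trans (cong (+↔.from {f Fin.zero} ∘ inj₂) (∑-index-pair (f ∘ Fin.suc) d))
  (trans (cong (+↔.from {f Fin.zero}) (sym eq)) (+↔.strictlyInverseʳ {f Fin.zero} c))

∑-pair-index : ∀ {k} (f : Fin k → ℕ) p → ∑-pair f (∑-index f p) ≡ p
∑-pair-index {suc k} f (Fin.zero  , j)
  rewrite +↔.strictlyInverseˡ {f Fin.zero} {∑Fin k (f ∘ Fin.suc)} (inj₁ j) = refl
∑-pair-index {suc k} f (Fin.suc i , j)
  rewrite +↔.strictlyInverseˡ {f Fin.zero} {∑Fin k (f ∘ Fin.suc)} (inj₂ (∑-index (f ∘ Fin.suc) (i , j)))
        | ∑-pair-index (f ∘ Fin.suc) (i , j) = refl

∏-choice : ∀ {k} (f : Fin k → ℕ) → Fin (∏Fin k f) → ∀ i → Fin (f i)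
∏-choice {suc k} f c Fin.zero    = proj₁ (*↔.to {f Fin.zero} c)
∏-choice {suc k} f c (Fin.suc i) = ∏-choice (f ∘ Fin.suc) (proj₂ (*↔.to {f Fin.zero} c)) i

∏-index : ∀ {k} (f : Fin k → ℕ) → (∀ i → Fin (f i)) → Fin (∏Fin k f)
∏-index {zero}  f h = Fin.zero
∏-index {suc k} f h = *↔.from {f Fin.zero} (h Fin.zero , ∏-index (f ∘ Fin.suc) (h ∘ Fin.suc))

∏-choice-index : ∀ {k} (f : Fin k → ℕ) h i → ∏-choice f (∏-index f h) i ≡ h i
∏-choice-index {suc k} f h Fin.zero =
  cong proj₁ (*↔.strictlyInverseˡ {f Fin.zero} (h Fin.zero , ∏-index (f ∘ Fin.suc) (h ∘ Fin.suc)))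
∏-choice-index {suc k} f h (Fin.suc i) = trans
  (cong (λ p → ∏-choice (f ∘ Fin.suc) (proj₂ p) i)
    (*↔.strictlyInverseˡ {f Fin.zero} (h Fin.zero , ∏-index (f ∘ Fin.suc) (h ∘ Fin.suc))))
  (∏-choice-index (f ∘ Fin.suc) (h ∘ Fin.suc) i)

-- Choices are functions and are compared pointwise; the bijection with indices of the product
-- therefore takes the form of this injectivity together with `∏-choice-index`.
∏-choice-injective : ∀ {k} (f : Fin k → ℕ) {c d} → (∀ i → ∏-choice f c i ≡ ∏-choice f d i) → c ≡ d
∏-choice-injective {zero}  f {Fin.zero} {Fin.zero} _ = refl
∏-choice-injective {suc k} f {c} {d} same = begin
  c  ≡⟨ *↔.strictlyInverseʳ {f Fin.zero} c ⟨
  *↔.from {f Fin.zero} (*↔.to {f Fin.zero} c)  ≡⟨ cong (*↔.from {f Fin.zero}) (cong₂ _,_ (same Fin.zero)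
                                                     (∏-choice-injective (f ∘ Fin.suc) (same ∘ Fin.suc))) ⟩
  *↔.from {f Fin.zero} (*↔.to {f Fin.zero} d)  ≡⟨ *↔.strictlyInverseʳ {f Fin.zero} d ⟩
  d  ∎

-- The decomposition of the fibre

module Decomposition {n : ℕ} .{{_ : NonZero n}} (v : AffinePerm n) where

  abstract
    I : (M : SkySet v) → Indexing M
    I M = BuildIndexing.indexing M

    S : Finite (Sky v)
    S = Sky-finite v

    B : (M : SkySet v) (k : Fin (Indexing.r (I M))) → Finite (stackSort⁻¹ (zAt (I M) k))
    B M k = stackSort⁻¹-finite (zAt (I M) k)

  r : SkySet v → ℕ
  r M = Indexing.r (I M)

  SortedWords : SkySet v → Set
  SortedWords M = ∀ k → StackSortPreimage (zAt (I M) k)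

  block : (M : SkySet v) → Fin (r M) → List ℤ
  block M k = Blocks.interior (I M) (+ suc (toℕ k))

  abstract
    build : (M : SkySet v) → SortedWords M → AffinePerm n
    build M h = FromFilled.perm (I M) (Filling.filled (I M) h)

    build-sorts : ∀ M h → AffineStackSortsTo (build M h) v
    build-sorts M h = FromFilled.perm-sorts (I M) (Filling.filled (I M) h)

    build-max⇒member : ∀ M h y → IsLeftToRightMax (build M h) y → T (SkySet.member M y)
    build-max⇒member M h y = FromFilled.max⇒member (I M) (Filling.filled (I M) h) {y}

    build-member⇒max : ∀ M h y → T (SkySet.member M y) → IsLeftToRightMax (build M h) y
    build-member⇒max M h y = FromFilled.member⇒max (I M) (Filling.filled (I M) h) {y}

    build-word : ∀ M h k → map (to (build M h)) (block M k) ≡ StackSortPreimage.word (h k)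
    build-word M h k = Filling.fill-word (I M) h k

    build-filled : ∀ M h → Blocks.Filled (I M) (to (build M h))
    build-filled M h = Filling.filled (I M) h

  private
    T-ext : ∀ {b c} → (T b → T c) → (T c → T b) → b ≡ c
    T-ext {true}  {true}  _ _ = refl
    T-ext {false} {false} _ _ = refl
    T-ext {true}  {false} f _ = ⊥-elim (f tt)
    T-ext {false} {true}  _ f = ⊥-elim (f tt)

    leftToRightMax-cong : ∀ (w w′ : AffinePerm n) {y} → w ≈ w′ → IsLeftToRightMax w y → IsLeftToRightMax w′ y
    leftToRightMax-cong w w′ {y} w≈w′ max p p<x = subst (_< y) (w≈w′ p) (max p (subst (p <_) same p<x))
      where
      same : from w′ y ≡ from w y
      same = to-injective w′ (trans (to-from w′ y) (sym (trans (sym (w≈w′ (from w y))) (to-from w y))))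

  -- Each skyline is the set of left-to-right maxima of the permutation built from it.
  build-skyline : ∀ M M′ h h′ → build M h ≈ build M′ h′ → SkySet.member M ≗ SkySet.member M′
  build-skyline M M′ h h′ eq y = T-ext
    (λ y∈ → build-max⇒member M′ h′ y
      (leftToRightMax-cong (build M h) (build M′ h′) eq (build-member⇒max M h y y∈)))
    (λ y∈ → build-max⇒member M h y
      (leftToRightMax-cong (build M′ h′) (build M h) (λ l → sym (eq l)) (build-member⇒max M′ h′ y y∈)))

  build-words : ∀ M h h′ → build M h ≈ build M h′ → ∀ k → StackSortPreimage.word (h k) ≡ StackSortPreimage.word (h′ k)
  build-words M h h′ eq k =
    trans (sym (build-word M h k)) (trans (List.map-cong eq (block M k)) (build-word M h′ k))

  module _ (w : AffinePerm n) (w-sorts : AffineStackSortsTo w v) where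

    private
      post : Postorder (to w) (from v ∘ to w)
      post = sorts⇒postorder v w w-sorts

      max? : ∀ y → Dec (IsLeftToRightMax w y)
      max? = isLeftToRightMax? w

      is-max : ℤ → Bool
      is-max y = isYes (max? y)

      is-max⁻ : ∀ y → T (is-max y) → IsLeftToRightMax w y
      is-max⁻ y = toWitness {a? = max? y}

      is-max⁺ : ∀ y → IsLeftToRightMax w y → T (is-max y)
      is-max⁺ y = fromWitness {a? = max? y}

      max-+ : ∀ y → IsLeftToRightMax w y → IsLeftToRightMax w (y + + n)
      max-+ y max = subst (IsLeftToRightMax w) (cong (λ x → y + x) (ℤ.*-identityˡ (+ n))) (leftToRightMax-* w y 1ℤ max)

      max-- : ∀ y → IsLeftToRightMax w (y + + n) → IsLeftToRightMax w y
      max-- y max = subst (IsLeftToRightMax w)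
        (trans (cong (λ x → y + + n + x) (ℤ.-1*i≡-i (+ n)))
          (linear 2 (λ y n → [] ⊢ y :+ n :- n :≡ y) y (+ n)))
        (leftToRightMax-* w (y + + n) -1ℤ max)

      -- A largest entry of a window exceeds the entries of all earlier windows.
      max-exists : ∃ (IsLeftToRightMax w)
      max-exists = to w p , everywhere
        where
        found : MaximumIn (to w) 0ℤ (+ n)
        found = argmax (to w) (+<+ (ℕ.>-nonZero⁻¹ n))
        p = proj₁ found
        p<n = proj₁ (proj₂ (proj₂ found))
        largest = proj₂ (proj₂ (proj₂ found))

        everywhere : IsLeftToRightMax w (to w p)
        everywhere q q<from = ≤∧≢⇒< (subst (_≤ to w p) (sym wq) (linear 3
            (λ a b c → a :≤ b ∷ c :≤ κ 0ℤ ∷ [] ⊢ a :+ c :≤ b) (to w (+ toℕ k)) (to w p) (t * + n)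
            (largest (+ toℕ k) (+≤+ z≤n) (+<+ (Fin.toℕ<n k))) tn≤0))
          (λ eq → <⇒≢ q<p (to-injective w eq))
          where
          q<p : q < p
          q<p = subst (q <_) (from-to w p) q<from
          k = residue n q
          t = q /ℕ n
          wq : to w q ≡ to w (+ toℕ k) + t * + n
          wq = trans (cong (to w) (residue-quotient n q)) (to-* w (+ toℕ k) t)
          tn≤0 : t * + n ≤ 0ℤ
          tn≤0 = ≮⇒≥ λ 0<tn → ⊥-elim (linear 4
            (λ q p k a → k :+ a :≡ q ∷ q :< p ∷ p :< κ 0ℤ :+ a ∷ κ 0ℤ :≤ k ∷ [] ⊢ :⊥) q p (+ toℕ k) (t * + n)
            (sym (residue-quotient n q)) q<p (p<tn 0<tn) (+≤+ z≤n))
            where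
            0<t : 0ℤ < t * + n → 0ℤ < t
            0<t 0<tn = ≰⇒> λ t≤0 → <⇒≱ 0<tn
              (subst (t * + n ≤_) (ℤ.*-zeroˡ (+ n)) (*-monoʳ-≤-nonNeg (+ n) t≤0))
            p<tn : 0ℤ < t * + n → p < 0ℤ + t * + n
            p<tn 0<tn = linear 3 (λ p n a → p :< n ∷ κ 0ℤ :+ n :≤ a ∷ [] ⊢ p :< κ 0ℤ :+ a) p (+ n) (t * + n)
              p<n (subst (λ x → x + + n ≤ t * + n) (ℤ.*-zeroˡ (+ n)) (quotient-step n (0<t 0<tn)))

    maxima-of : SkySet v
    maxima-of = record
      { member   = is-max
      ; periodic = λ y → T-ext (is-max⁺ y ∘ max-- y ∘ is-max⁻ (y + + n)) (is-max⁺ (y + + n) ∘ max-+ y ∘ is-max⁻ y)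
      ; nonempty = proj₁ max-exists , is-max⁺ (proj₁ max-exists) (proj₂ max-exists)
      ; maxima   = λ y y∈ → max⇒max y (is-max⁻ y y∈)
      }
      where
      -- An entry before `y` in `v` either precedes `y` in `w` as well, or sorting has moved it in
      -- front of `y`; in the latter case the position of `y` dominates it.
      max⇒max : ∀ y → IsLeftToRightMax w y → IsLeftToRightMax v y
      max⇒max y max q q<fy = subst (_< y) (to-from w (to v q)) (by-order (<-cmp i l))
        where
        l = from w y
        i = from w (to v q)
        rank-i : from v (to w i) ≡ q
        rank-i = trans (cong (from v) (to-from w (to v q))) (from-to v q)
        rank-l : from v (to w l) ≡ from v y
        rank-l = cong (from v) (to-from w y)
        i-before-l : from v (to w i) < from v (to w l)
        i-before-l = subst₂ _<_ (sym rank-i) (sym rank-l) q<fy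
        by-order : Tri (i < l) (i ≡ l) (l < i) → to w i < y
        by-order (tri< i<l _ _) = max i i<l
        by-order (tri≈ _ i≡l _) = contradiction (cong (from v ∘ to w) i≡l) (<⇒≢ i-before-l)
        by-order (tri> _ _ l<i) = subst (to w i <_) (to-from w y)
          (Postorder.dominated post l<i i-before-l i l<i ≤-refl)

    module _ (M : SkySet v) (M≗ : SkySet.member M ≗ SkySet.member maxima-of) where

      private
        abstract
          w-filled : Blocks.Filled (I M) (to w)
          w-filled = ToFilled.filled (I M) w post
            (λ y y∈ → is-max⁻ y (subst T (M≗ y) y∈)) (λ y max → subst T (sym (M≗ y)) (is-max⁺ y max))

      read-words : SortedWords M
      read-words k = record
        { word     = map (to w) (block M k)
        ; distinct = Blocks.Filled.distinct w-filled k
        ; sorts    = Blocks.Filled.sorts w-filled k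
        }

      build-surjective : ∀ h → (∀ k → StackSortPreimage.word (h k) ≡ map (to w) (block M k)) → build M h ≈ w
      build-surjective h eq = filled-unique (I M) (build-filled M h) w-filled
        (λ k → trans (build-word M h k) (eq k))

  private
    module S = Bijection (Finite.enumeration S)

    module Words (M : SkySet v) (k : Fin (r M)) = Bijection (Finite.enumeration (B M k))

  choices : (M : SkySet v) → Fin (r M) → ℕ
  choices M k = card (B M k)

  preimages : Fin (card S) → ℕ
  preimages a = ∏Fin (r (S.to a)) (choices (S.to a))

  sorted-words : ∀ M → Fin (∏Fin (r M) (choices M)) → SortedWords M
  sorted-words M c k = Words.to M k (∏-choice (choices M) c k)

  built : ∀ a → Fin (preimages a) → AffinePerm n
  built a c = build (S.to a) (sorted-words (S.to a) c)

  preimage : (∃ λ a → Fin (preimages a)) → AffineStackSortPreimage v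
  preimage (a , c) = record
    { perm = built a c ; sorts = build-sorts (S.to a) (sorted-words (S.to a) c) }

  preimage-injective : ∀ a b c d → built a c ≈ built b d → (a , c) ≡ (b , d)
  preimage-injective a b c d eq = by-skyline a b c d
    (S.injective (build-skyline (S.to a) (S.to b) (sorted-words (S.to a) c) (sorted-words (S.to b) d) eq)) eq
    where
    by-skyline : ∀ a b c d → a ≡ b → built a c ≈ built b d → (a , c) ≡ (b , d)
    by-skyline a .a c d refl eq = cong (a ,_) (∏-choice-injective (choices M) λ k →
      Words.injective M k (build-words M (sorted-words M c) (sorted-words M d) eq k))
      where M = S.to a

  preimage-surjective : (w : AffineStackSortPreimage v) → ∃ λ p →
    to (AffineStackSortPreimage.perm (preimage p)) ≗ to (AffineStackSortPreimage.perm w)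
  preimage-surjective w = (a , c) , build-surjective u u-sorts M M≗ (sorted-words M c) λ k →
    trans (cong (λ j → StackSortPreimage.word (Words.to M k j)) (∏-choice-index (choices M) code k)) (proj₂ (coded k))
    where
    u = AffineStackSortPreimage.perm w
    u-sorts = AffineStackSortPreimage.sorts w
    a = proj₁ (S.strictlySurjective (maxima-of u u-sorts))
    M = S.to a
    M≗ : SkySet.member M ≗ SkySet.member (maxima-of u u-sorts)
    M≗ = proj₂ (S.strictlySurjective (maxima-of u u-sorts))
    coded : ∀ k → ∃ λ j → StackSortPreimage.word (Words.to M k j) ≡ map (to u) (block M k)
    coded k = Words.strictlySurjective M k (read-words u u-sorts M M≗ k)
    code : ∀ k → Fin (choices M k)
    code k = proj₁ (coded k)
    c = ∏-index (choices M) code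

  -- The index set is that of the sum over skylines of the products of numbers of words, so the
  -- cardinality is the right-hand side of the formula by definition.
  A : Finite (affineStackSort⁻¹ v)
  A = finite (affineStackSort⁻¹ v) (preimage ∘ ∑-pair preimages)
    (λ {i} {j} eq → trans (sym (∑-index-pair preimages i)) (trans
      (cong (∑-index preimages) (preimage-injective _ _ _ _ eq)) (∑-index-pair preimages j)))
    (λ w → let (p , eq) = preimage-surjective w in
      ∑-index preimages p , subst (λ p → to (AffineStackSortPreimage.perm (preimage p)) ≗ _)
        (sym (∑-pair-index preimages p)) eq)

theorem8p11 : (n : ℕ) .{{_ : NonZero n}} (v : AffinePerm n) →
    Σ[ A ∈ Finite (affineStackSort⁻¹ v) ]
    Σ[ S ∈ Finite (Sky v) ]
    Σ[ I ∈ ((M : SkySet v) → Indexing M) ]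
    Σ[ B ∈ ((M : SkySet v) (k : Fin (Indexing.r (I M))) → Finite (stackSort⁻¹ (zAt (I M) k))) ]
      card A ≡ ∑ S (λ M → ∏Fin (Indexing.r (I M)) (λ k → card (B M k)))
theorem8p11 n v = A , S , I , B , refl
  where open Decomposition v
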